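{- Let $p$ be a prime, $\alpha,n\in\mathbb{N}$ and $r\in\mathbb{Z}$. Let $f(x)\in\mathbb{Q}_p[x]$ with $\deg f\leqslant l\in\mathbb{N}$ and $f(a)\in\mathbb{Z}_p$ for all $a\in\mathbb{Z}$. Then $$\operatorname{ord}_p\Bigg(\sum_{k\equiv r\ (\mathrm{mod}\ p^{\alpha})}\binom nk(-1)^kf\Big(\frac{k-r}{p^{\alpha}}\Big)\Bigg)\ \geqslant\ \operatorname{ord}_p\Big(\Big\lfloor\frac n{p^{\alpha-1}}\Big\rfloor!\Big)-l-\operatorname{ord}_p(l!)+\tau_p\big(\{r\}_{p^{\alpha-1}},\{n-r\}_{p^{\alpha-1}}\big).$$
   Context: The sum runs over all integers $k\equiv r\pmod{p^\alpha}$, with $\binom nk=0$ unless $0\le k\le n$. $\mathbb{Q}_p,\mathbb{Z}_p$ are the $p$-adic numbers and integers; $\operatorname{ord}_p(\omega)=\max\{a\in\mathbb{Z}:\omega/p^a\in\mathbb{Z}_p\}$ for $\omega\ne0$, $\operatorname{ord}_p(0)=+\infty$. For an integer $a$ and positive real $m$, $\{a\}_m$ is the unique number in $[0,m)$ with $a-\{a\}_m\in m\mathbb{Z}$. $\tau_p(a,b)$ is the number of carries when adding $a,b\in\mathbb{N}$ in base $p$. When $\alpha=0$, $\lfloor n/p^{ -1}\rfloor=pn$. -}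

module Defs where

open import Data.Bool.Base using (if_then_else_)
open import Data.Nat.Base as ℕ using (ℕ; zero; suc; NonZero; _!; _^_; _/_; _%_)
import Data.Nat.Properties as ℕP
import Data.Nat.Divisibility as ℕ∣
open import Data.Nat.Combinatorics using (_C_)
open import Data.Nat.Primality using (Prime; prime⇒nonZero; prime⇒nonTrivial)
open import Data.Integer.Base as ℤ using (ℤ; +_; -[1+_]; 0ℤ; 1ℤ; -1ℤ)
import Data.Integer.Properties as ℤP
open import Data.Integer.DivMod using (_%ℕ_)
open import Data.Integer.Divisibility.Signed as ℤ∣ using (_∣_; _∣?_; divides; quotient)
open import Data.Integer.Tactic.RingSolver using (solve-∀)
open import Data.List.Base using (List; []; _∷_; map; foldr; upTo)
open import Data.Nat.ListAction using (sum)
open import Data.Product.Base using (∃-syntax; _×_; _,_)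
open import Data.Sum.Base using (inj₁; inj₂)
open import Data.Unit.Base using (⊤)
open import Function.Bundles using (_⇔_; mk⇔)
open import Relation.Nullary using (yes; no; does; contradiction)
open import Relation.Binary.PropositionalEquality

data ℤ∞ : Set where
  fin : ℤ → ℤ∞
  ∞   : ℤ∞

infix 4 _≤∞_

_≤∞_ : ℤ → ℤ∞ → Set
b ≤∞ fin a = b ℤ.≤ a
b ≤∞ ∞     = ⊤

module Padic (p : ℕ) (p-prime : Prime p) where

  private
    instance
      p≢0 : NonZero p
      p≢0 = prime⇒nonZero p-prime

  p^ : ℕ → ℤ
  p^ k = + (p ^ k)

  ----------------------------------------------------------------------
  -- ℤ_p is the inverse limit of the rings ℤ/pⁿ, each element of which is
  -- given by an integer representative; ℚ_p is ℤ_p[1/p].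

  record ℤₚ : Set where
    constructor mkℤₚ
    field
      approx   : ℕ → ℤ
      coherent : ∀ n → p^ n ∣ approx (suc n) ℤ.- approx n
  open ℤₚ public

  infix  4 _≈ᶻ_ _≈_ _∈ℤₚ
  infixl 6 _+ᶻ_ _⊕_
  infixl 7 _*ᶻ_ _⊗_ _÷p^_

  _≈ᶻ_ : ℤₚ → ℤₚ → Set
  x ≈ᶻ y = ∀ n → p^ n ∣ approx x n ℤ.- approx y n

  constᶻ : ℤ → ℤₚ
  constᶻ a = mkℤₚ (λ _ → a) (λ n → divides 0ℤ (ℤP.+-inverseʳ a))

  private
    +-split : ∀ a a′ b b′ → (a′ ℤ.- a) ℤ.+ (b′ ℤ.- b) ≡ (a′ ℤ.+ b′) ℤ.- (a ℤ.+ b)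
    +-split = solve-∀

    *-split : ∀ a a′ b b′ →
      a′ ℤ.* (b′ ℤ.- b) ℤ.+ b ℤ.* (a′ ℤ.- a) ≡ a′ ℤ.* b′ ℤ.- a ℤ.* b
    *-split = solve-∀

  _+ᶻ_ : ℤₚ → ℤₚ → ℤₚ
  x +ᶻ y = mkℤₚ (λ n → approx x n ℤ.+ approx y n) λ n →
    subst (p^ n ∣_) (+-split (approx x n) (approx x (suc n)) (approx y n) (approx y (suc n)))
      (ℤ∣.∣m∣n⇒∣m+n (coherent x n) (coherent y n))

  _*ᶻ_ : ℤₚ → ℤₚ → ℤₚ
  x *ᶻ y = mkℤₚ (λ n → approx x n ℤ.* approx y n) λ n →
    subst (p^ n ∣_) (*-split (approx x n) (approx x (suc n)) (approx y n) (approx y (suc n)))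
      (ℤ∣.∣m∣n⇒∣m+n (ℤ∣.∣n⇒∣m*n (approx x (suc n)) (coherent y n))
                    (ℤ∣.∣n⇒∣m*n (approx y n) (coherent x n)))

  -- num /p^ den stands for num / p^den.
  record ℚₚ : Set where
    constructor _/p^_
    field
      num : ℤₚ
      den : ℕ
  open ℚₚ public

  _≈_ : ℚₚ → ℚₚ → Set
  (x /p^ d) ≈ (y /p^ e) = x *ᶻ constᶻ (p^ e) ≈ᶻ y *ᶻ constᶻ (p^ d)

  fromℤ : ℤ → ℚₚ
  fromℤ a = constᶻ a /p^ 0

  0ₚ : ℚₚ
  0ₚ = fromℤ 0ℤ

  _⊕_ : ℚₚ → ℚₚ → ℚₚ
  (x /p^ d) ⊕ (y /p^ e) = (x *ᶻ constᶻ (p^ e) +ᶻ y *ᶻ constᶻ (p^ d)) /p^ (d ℕ.+ e)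

  _⊗_ : ℚₚ → ℚₚ → ℚₚ
  (x /p^ d) ⊗ (y /p^ e) = (x *ᶻ y) /p^ (d ℕ.+ e)

  _÷p^_ : ℚₚ → ℤ → ℚₚ
  (x /p^ d) ÷p^ (+ k)    = x /p^ (d ℕ.+ k)
  (x /p^ d) ÷p^ -[1+ k ] = (x *ᶻ constᶻ (p^ (suc k))) /p^ d

  _∈ℤₚ : ℚₚ → Set
  ω ∈ℤₚ = ∃[ z ] ω ≈ (z /p^ 0)

  ----------------------------------------------------------------------
  -- ord ω = max { a ∈ ℤ : ω / p^a ∈ ℤ_p }, with ord 0 = ∞.  It is not a
  -- constructive function on ℚ_p, as ω ≈ 0 is undecidable.  So its graph
  -- is IsOrd, and the inequality ord ω ≥ b says that some a ≥ b lies in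
  -- the set; ord≥⇔ shows that this is the inequality for the maximum.

  IsOrd : ℚₚ → ℤ∞ → Set
  IsOrd ω (fin a) = (ω ÷p^ a) ∈ℤₚ × (∀ b → (ω ÷p^ b) ∈ℤₚ → b ℤ.≤ a)
  IsOrd ω ∞       = ω ≈ 0ₚ

  ord_≥_ : ℚₚ → ℤ → Set
  ord ω ≥ b = ∃[ a ] b ℤ.≤ a × (ω ÷p^ a) ∈ℤₚ

  infix 4 ord_≥_

  -- The largest e ≤ b with p^e ∣ m.
  largestPower : ℕ → ℕ → ℕ
  largestPower m zero    = 0
  largestPower m (suc b) =
    if does (p ^ suc b ℕ∣.∣? m) then suc b else largestPower m b

  -- ord on positive integers (see ordℕ-isOrd); p^e ∣ m forces e < m.
  ordℕ : ℕ → ℕ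
  ordℕ m = largestPower m m

  ----------------------------------------------------------------------
  -- Polynomials over ℚ_p: lists of coefficients, constant term first.

  Poly : Set
  Poly = List ℚₚ

  coeff : Poly → ℕ → ℚₚ
  coeff []      _       = 0ₚ
  coeff (c ∷ f) zero    = c
  coeff (c ∷ f) (suc i) = coeff f i

  deg_≤_ : Poly → ℕ → Set
  deg f ≤ l = ∀ i → l ℕ.< i → coeff f i ≈ 0ₚ

  infix 4 deg_≤_

  eval : Poly → ℚₚ → ℚₚ
  eval []      x = 0ₚ
  eval (c ∷ f) x = c ⊕ x ⊗ eval f x

  ----------------------------------------------------------------------
  -- ∑_{k ≡ r (mod p^α)} C(n,k) (-1)^k f((k-r)/p^α); the binomial
  -- coefficient vanishes unless 0 ≤ k ≤ n.

  term : (α n : ℕ) → ℤ → Poly → ℕ → ℚₚ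
  term α n r f k with p^ α ∣? + k ℤ.- r
  ... | yes d = fromℤ (+ (n C k) ℤ.* -1ℤ ℤ.^ k) ⊗ eval f (fromℤ (quotient d))
  ... | no  _ = 0ₚ

  binomialSum : (α n : ℕ) → ℤ → Poly → ℚₚ
  binomialSum α n r f = foldr _⊕_ 0ₚ (map (term α n r f) (upTo (suc n)))

  ----------------------------------------------------------------------

  -- ⌊ n / p^(α-1) ⌋
  ⌊_/p^_-1⌋ : ℕ → ℕ → ℕ
  ⌊ n /p^ zero  -1⌋ = p ℕ.* n
  ⌊ n /p^ suc β -1⌋ = (n / p ^ β) {{ℕP.m^n≢0 p β}}

  -- { a } modulo p^(α-1).  For α = 0 the modulus is 1/p, and the only
  -- c ∈ [0, 1/p) with a - c ∈ (1/p)ℤ is 0.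
  ⟨_⟩[p^_-1] : ℤ → ℕ → ℕ
  ⟨ a ⟩[p^ zero  -1] = 0
  ⟨ a ⟩[p^ suc β -1] = (a %ℕ (p ^ β)) {{ℕP.m^n≢0 p β}}

  digit : ℕ → ℕ → ℕ
  digit a i = (a / p ^ i) {{ℕP.m^n≢0 p i}} % p

  -- The carry (0 or 1) into position i when adding a and b in base p.
  carry : ℕ → ℕ → ℕ → ℕ
  carry a b zero    = 0
  carry a b (suc i) = (digit a i ℕ.+ digit b i ℕ.+ carry a b i) / p

  -- As a, b < p^(a+b), no carry leaves a position i ≥ a+b.
  τ : ℕ → ℕ → ℕ
  τ a b = sum (map (λ i → carry a b (suc i)) (upTo (a ℕ.+ b)))

  ----------------------------------------------------------------------
  -- Adequacy of ord_≥_ and ordℕ.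

  ord≥⇔ : ∀ {ω v} → IsOrd ω v → ∀ b → ord ω ≥ b ⇔ b ≤∞ v
  ord≥⇔ {ω} {fin a} (a∈ , max) b =
    mk⇔ (λ (c , b≤c , c∈) → ℤP.≤-trans b≤c (max c c∈)) (λ b≤a → a , b≤a , a∈)
  ord≥⇔ {x /p^ d} {∞} ω≈0 b = mk⇔ _ (λ _ → b , ℤP.≤-refl , integral b)
    where
    drop-1 : ∀ a → a ℤ.* 1ℤ ℤ.- 0ℤ ≡ a
    drop-1 = solve-∀

    zero-mult : ∀ a c e → (a ℤ.* c) ℤ.* 1ℤ ℤ.- 0ℤ ℤ.* e ≡ c ℤ.* (a ℤ.* 1ℤ ℤ.- 0ℤ)
    zero-mult = solve-∀

    integral : ∀ b → ((x /p^ d) ÷p^ b) ∈ℤₚ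
    integral (+ k)    = constᶻ 0ℤ , ω≈0
    integral -[1+ k ] = constᶻ 0ℤ , λ n →
      subst (p^ n ∣_) (sym (zero-mult (approx x n) (p^ (suc k)) (p^ d)))
        (ℤ∣.∣n⇒∣m*n (p^ (suc k)) (ω≈0 n))

  ordℕ-isOrd : ∀ m .{{_ : NonZero m}} → IsOrd (fromℤ (+ m)) (fin (+ ordℕ m))
  ordℕ-isOrd m = ordℕ∈ , max
    where
    open import Data.Nat.Base using (_≤_; _<_; z≤n; s≤s)

    1<p : 1 < p
    1<p = ℕ.nonTrivial⇒n>1 p {{prime⇒nonTrivial p-prime}}

    e<p^e : ∀ e → e < p ^ e
    e<p^e zero    = s≤s z≤n
    e<p^e (suc e) = begin-strict
      suc e          ≤⟨ e<p^e e ⟩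
      p ^ e          <⟨ ℕP.m<m*n (p ^ e) p {{ℕP.m^n≢0 p e}} 1<p ⟩
      p ^ e ℕ.* p    ≡⟨ ℕP.*-comm (p ^ e) p ⟩
      p ℕ.* p ^ e    ∎
      where open ℕP.≤-Reasoning

    divides-largest : ∀ b → p ^ largestPower m b ℕ∣.∣ m
    divides-largest zero    = ℕ∣.1∣ m
    divides-largest (suc b) with p ^ suc b ℕ∣.∣? m
    ... | yes d = d
    ... | no  _ = divides-largest b

    largest-max : ∀ b e → e ≤ b → p ^ e ℕ∣.∣ m → e ≤ largestPower m b
    largest-max zero    e e≤b _ = e≤b
    largest-max (suc b) e e≤b d with p ^ suc b ℕ∣.∣? m
    ... | yes _ = e≤b
    ... | no ¬d with ℕP.m≤n⇒m<n∨m≡n e≤b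
    ...   | inj₁ (s≤s e≤b′) = largest-max b e e≤b′ d
    ...   | inj₂ refl       = contradiction d ¬d

    scaled : ∀ q P → (q ℤ.* P) ℤ.* 1ℤ ℤ.- q ℤ.* P ≡ 0ℤ
    scaled = solve-∀

    ordℕ∈ : (fromℤ (+ m) ÷p^ (+ ordℕ m)) ∈ℤₚ
    ordℕ∈ with ℤ∣.∣ᵤ⇒∣ {p^ (ordℕ m)} {+ m} (divides-largest m)
    ... | divides q m≡ = constᶻ q , λ n → divides 0ℤ
      (trans (cong (λ z → z ℤ.* 1ℤ ℤ.- q ℤ.* p^ (ordℕ m)) m≡) (scaled q (p^ (ordℕ m))))

    restore : ∀ M z P → (M ℤ.* 1ℤ ℤ.- z ℤ.* P) ℤ.+ z ℤ.* P ≡ M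
    restore = solve-∀

    max : ∀ b → (fromℤ (+ m) ÷p^ b) ∈ℤₚ → b ℤ.≤ + ordℕ m
    max -[1+ _ ] _        = ℤ.-≤+
    max (+ k)    (z , eq) = ℤ.+≤+ (largest-max m k k≤m pᵏ∣m)
      where
      pᵏ∣m : p ^ k ℕ∣.∣ m
      pᵏ∣m = ℤ∣.∣⇒∣ᵤ (subst (p^ k ∣_) (restore (+ m) (approx z k) (p^ k))
        (ℤ∣.∣m∣n⇒∣m+n (eq k) (ℤ∣.∣n⇒∣m*n (approx z k) ℤ∣.∣-refl)))

      k≤m : k ≤ m
      k≤m = ℕP.<⇒≤ (ℕP.<-≤-trans (e<p^e k) (ℕ∣.∣⇒≤ pᵏ∣m))

{-# OPTIONS --safe #-}

-- Let q = p^(α-1).  The operator D a x = a x - a (x + 1) satisfies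
-- Σ_k C(n,k) (-1)^k a(k) = (D^n a)(0).
--
-- Newton interpolation turns p^l l! f((k - r)/p^α) into an integer
-- polynomial in ⌊k/q⌋, so it suffices to bound, for every integer
-- polynomial P, the sum of C(n,k) (-1)^k P(⌊k/q⌋) over k ≡ r (mod p^α).
--
-- * For P = 1: in ℤ[x]/(x^(p^α) - 1) the power X = (1 - x)^q satisfies
--   X^p ∈ (pX, p²), whence p^m ∣ X^(1 + m(p-1)); by Legendre's formula
--   this gives ord(⌊n/q⌋!) when q ∣ n.
-- * For q ∣ k and q ∣ n, a factor k/q of P is absorbed by the identity
--   k(k-1)⋯(k-q+1) C(n,k) = n(n-1)⋯(n-q+1) C(n-q,k-q).
-- * General r and n are reduced to that case by moving the factors of
--   C(n,k) belonging to the last digits; by Kummer's theorem these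
--   contribute the number of carries.
--
-- The products of consecutive integers arising in the last two steps are
-- p^e (u + pV) with u prime to p and V an integer polynomial in ⌊k/q⌋,
-- and the factor u + pV can be cancelled because the bound is claimed for
-- all P at once.

module Submission where

open import Defs
open import Data.Nat.Base using (ℕ; _!)
open import Data.Nat.Primality using (Prime)
open import Data.Integer.Base using (ℤ; +_; _+_; _-_)

open import Algebra.Bundles using (CommutativeRing; CommutativeSemiring)
import Algebra.Properties.CommutativeMonoid.Mult as CommutativeMonoidMult
import Algebra.Properties.CommutativeSemigroup as CommutativeSemigroupProperties
import Algebra.Properties.CommutativeSemiring.Binomial as Binomial
import Algebra.Properties.CommutativeSemiring.Exp as CommutativeSemiringExp
import Algebra.Properties.Group as GroupProperties
import Algebra.Properties.Ring as RingProperties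
import Algebra.Properties.Semiring.Exp as SemiringExp
import Algebra.Properties.Semiring.Mult as SemiringMult
import Algebra.Properties.Semiring.Sum as SemiringSum
open import Data.Fin.Base as Fin using (Fin; toℕ; fromℕ; inject₁)
import Data.Fin.Properties as FinP
open import Data.Integer.Base as ℤ using (-[1+_]; _*_; -_; 0ℤ; 1ℤ; -1ℤ)
import Data.Integer.DivMod as ℤDM
open import Data.Integer.Divisibility.Signed as ℤ∣ using (_∣_; _∣?_; divides; quotient)
import Data.Integer.Properties as ℤP
open import Data.Integer.Tactic.RingSolver using (solve-∀)
open import Data.List.Base using (List; []; _∷_; map; foldr; upTo; applyUpTo; take; length)
import Data.List.Properties as ListP
open import Data.Nat.Base as ℕ using (zero; suc; NonZero; z≤n; s≤s; _^_; _∸_)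
open import Data.Nat.Combinatorics using (_C_; nCn≡1; k![n∸k]!∣n!; nCk+nC[k+1]≡[n+1]C[k+1])
open import Data.Nat.Combinatorics.Specification using (nCk≡n!/k![n-k]!; k>n⇒nCk≡0)
import Data.Nat.Divisibility as ℕ∣
import Data.Nat.DivMod as ℕDM
open import Data.Nat.Induction using (<-rec)
open import Data.Nat.ListAction using (sum)
open import Data.Nat.Primality using (prime⇒nonZero; prime⇒nonTrivial; euclidsLemma)
import Data.Nat.Properties as ℕP
import Data.Nat.Tactic.RingSolver as ℕSolver
open import Data.Product.Base using (Σ-syntax; ∃-syntax; _×_; _,_; proj₁; proj₂)
open import Data.Sum.Base using (_⊎_; inj₁; inj₂; [_,_]′)
open import Function.Base using (_∘_)
open import Level using (_⊔_)
open import Relation.Binary.PropositionalEquality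
  using (_≡_; _≗_; refl; sym; trans; cong; cong₂; subst; subst₂; module ≡-Reasoning)
import Relation.Binary.Reasoning.Setoid as SetoidReasoning
open import Relation.Nullary using (¬_; Dec; yes; no; contradiction)

-- Binomial coefficients modulo p and the Frobenius congruence

-- The relation X^p ∈ (pX, p²) comes from 1 = X + S + p h with S = x^q and S^p = 1. In the p-th
-- power of the right side each mixed term containing X carries the factor p X, and (S + p h)^p
-- differs from 1 by a multiple of p². So a further factor p costs only p - 1 powers of X; since
-- ord(N!) ≤ (N - 1)/(p - 1), this rate is just enough for X^N to reach ord(N!).
--
-- The condition k ≡ r (mod p^α) is split as k = r₀ + q x together with a p-periodic weight w on x.
-- The weight is not a polynomial, so bounds are stated for pairs of a periodic w and a polynomial
-- P; absorbing factors of k translates both.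
--
-- Since vanishing of a p-adic coefficient is undecidable, f is replaced at a finite precision by a
-- function h : ℤ → ℤ. Such an h need not have integer coefficients; what it retains of f is that
-- D^(l+1) kills it, and this suffices for Newton interpolation. The loss l + ord(l!) consists of l!
-- from the interpolation and of one p for each linear factor in (y - r′)/p, where y = ⌊k/q⌋ and r′
-- = ⌊r/q⌋.

prime∤! : ∀ {p} → Prime p → ∀ {k} → k ℕ.< p → ¬ p ℕ∣.∣ k !
prime∤! pr {zero}  k<p d = contradiction (ℕ∣.∣1⇒≡1 d) (ℕP.>⇒≢ (ℕ.nonTrivial⇒n>1 _ {{prime⇒nonTrivial pr}}))
prime∤! pr {suc k} k<p d with euclidsLemma (suc k) (k !) pr d
... | inj₁ p∣k  = ℕP.<⇒≱ k<p (ℕ∣.∣⇒≤ p∣k)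
... | inj₂ p∣k! = prime∤! pr (ℕP.<-trans (ℕP.n<1+n k) k<p) p∣k!

-- From p! = C(p,k) k! (p-k)!: the prime p divides the left side but neither factorial on the right,
-- both being of numbers below p.
prime∣C : ∀ {p} → Prime p → ∀ {k} → 0 ℕ.< k → k ℕ.< p → p ℕ∣.∣ p C k
prime∣C {p@(suc p-1)} pr {k} 0<k k<p with euclidsLemma (p C k) (k ! ℕ.* (p ∸ k) !) pr p∣product
  where
  k≤p = ℕP.<⇒≤ k<p
  instance
    k!≢0 = ℕP._!*_!≢0 k (p ∸ k)
  p∣product : p ℕ∣.∣ (p C k) ℕ.* (k ! ℕ.* (p ∸ k) !)
  p∣product = subst (p ℕ∣.∣_)
    (sym (trans (cong (ℕ._* (k ! ℕ.* (p ∸ k) !)) (nCk≡n!/k![n-k]! k≤p))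
                (ℕDM.m/n*n≡m (k![n∸k]!∣n! k≤p))))
    (ℕ∣.m∣m*n (p-1 !))
... | inj₁ d = d
... | inj₂ d with euclidsLemma (k !) ((p ∸ k) !) pr d
...   | inj₁ p∣k!     = contradiction p∣k! (prime∤! pr k<p)
...   | inj₂ p∣[p-k]! = contradiction p∣[p-k]! (prime∤! pr (ℕP.∸-monoʳ-< 0<k (ℕP.<⇒≤ k<p)))

module Frobenius {c ℓ} (S : CommutativeSemiring c ℓ) where
  open CommutativeSemiring S renaming (_+_ to _⊹_; _*_ to _∙_; refl to ≈-refl; sym to ≈-sym; trans to ≈-trans)
  open SemiringExp semiring using () renaming (_^_ to _↑_)
  open SemiringMult semiring using (×-congʳ; ×-assocˡ) renaming (_×_ to _·_)
  open CommutativeMonoidMult +-commutativeMonoid using (×-distrib-+)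
  open SemiringSum semiring using (sum-init-last) renaming (sum to ∑)
  open SetoidReasoning setoid

  sum-of-multiples : ∀ n x {m} (t : Fin m → Carrier) →
    (∀ i → ∃[ g ] t i ≈ n · (x ∙ g)) → ∃[ g ] ∑ t ≈ n · (x ∙ g)
  sum-of-multiples n x {zero}  t h = 0# , ≈-sym (≈-trans (×-congʳ n (zeroʳ x)) (n·0 n))
    where
    n·0 : ∀ k → k · 0# ≈ 0#
    n·0 zero    = ≈-refl
    n·0 (suc k) = ≈-trans (+-identityˡ _) (n·0 k)
  sum-of-multiples n x {suc m} t h
    with h Fin.zero | sum-of-multiples n x (λ i → t (Fin.suc i)) (λ i → h (Fin.suc i))
  ... | g , t₀≈ | g′ , rest≈ = g ⊹ g′ , (begin
    t Fin.zero ⊹ ∑ (λ i → t (Fin.suc i)) ≈⟨ +-cong t₀≈ rest≈ ⟩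
    n · (x ∙ g) ⊹ n · (x ∙ g′)             ≈⟨ ×-distrib-+ (x ∙ g) (x ∙ g′) n ⟨
    n · (x ∙ g ⊹ x ∙ g′)                   ≈⟨ ×-congʳ n (≈-sym (distribˡ x g g′)) ⟩
    n · (x ∙ (g ⊹ g′))                     ∎)

  -- Every middle binomial term contains both x and y, and p divides its coefficient. The factor
  -- `x ∙ y` is kept explicit because `↑p-decomposition` needs an error that is a multiple of p A
  -- and not merely of p.
  frobenius : ∀ {p} → Prime p → ∀ x y →
    ∃[ g ] (x ⊹ y) ↑ p ≈ y ↑ p ⊹ (p · (x ∙ y ∙ g) ⊹ x ↑ p)
  frobenius {p@(suc m)} pr x y with sum-of-multiples p (x ∙ y) middle middle-multiple
    where
    open Binomial S using (binomialTerm)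
    middle : Fin m → Carrier
    middle i = binomialTerm x y p (Fin.suc (inject₁ i))

    middle-multiple : ∀ i → ∃[ g ] middle i ≈ p · (x ∙ y ∙ g)
    middle-multiple i with prime∣C pr {suc (toℕ i)} (s≤s z≤n) (s≤s (FinP.toℕ<n i))
    ... | ℕ∣.divides q pC≡ = q · (x ↑ k ∙ y ↑ (m ∸ suc k)) , (begin
      (p C suc (toℕ (inject₁ i))) · (x ↑ suc (toℕ (inject₁ i)) ∙ y ↑ (m ∸ toℕ (inject₁ i)))
        ≡⟨ cong (λ j → (p C suc j) · (x ↑ suc j ∙ y ↑ (m ∸ j))) (FinP.toℕ-inject₁ i) ⟩
      (p C suc k) · (x ↑ suc k ∙ y ↑ (m ∸ k))
        ≡⟨ cong₂ (λ c e → c · (x ↑ suc k ∙ y ↑ e)) (trans pC≡ (ℕP.*-comm q p))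
             (trans (sym (ℕP.suc-pred (m ∸ k) {{ℕ.>-nonZero (ℕP.m<n⇒0<n∸m (FinP.toℕ<n i))}}))
                    (cong suc (ℕP.pred[m∸n]≡m∸[1+n] m k))) ⟩
      (p ℕ.* q) · ((x ∙ x ↑ k) ∙ (y ∙ y ↑ (m ∸ suc k)))
        ≈⟨ ×-assocˡ _ p q ⟨
      p · (q · ((x ∙ x ↑ k) ∙ (y ∙ y ↑ (m ∸ suc k))))
        ≈⟨ ×-congʳ p (×-congʳ q (interchange x (x ↑ k) y (y ↑ (m ∸ suc k)))) ⟩
      p · (q · ((x ∙ y) ∙ (x ↑ k ∙ y ↑ (m ∸ suc k))))
        ≈⟨ ×-congʳ p (≈-sym (SemiringMult.×-comm-* semiring q _ _)) ⟩
      p · (x ∙ y ∙ (q · (x ↑ k ∙ y ↑ (m ∸ suc k)))) ∎)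
      where
      k = toℕ i
      open CommutativeSemigroupProperties *-commutativeSemigroup using (interchange)
  ... | g , middle≈ = g , (begin
    (x ⊹ y) ↑ p
      ≈⟨ Binomial.theorem S p x y ⟩
    ∑ (binomialTerm x y p)
      ≈⟨ +-cong head≈ (≈-trans (sum-init-last (λ i → binomialTerm x y p (Fin.suc i))) (+-cong middle≈ last≈)) ⟩
    y ↑ p ⊹ (p · (x ∙ y ∙ g) ⊹ x ↑ p) ∎)
    where
    open Binomial S using (binomialTerm)
    head≈ : binomialTerm x y p Fin.zero ≈ y ↑ p
    head≈ = ≈-trans (+-identityʳ _) (*-identityˡ _)

    last≈ : binomialTerm x y p (Fin.suc (fromℕ m)) ≈ x ↑ p
    last≈ = begin
      (p C suc (toℕ (fromℕ m))) · (x ↑ suc (toℕ (fromℕ m)) ∙ y ↑ (m ∸ toℕ (fromℕ m)))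
        ≡⟨ cong (λ j → (p C suc j) · (x ↑ suc j ∙ y ↑ (m ∸ j))) (FinP.toℕ-fromℕ m) ⟩
      (p C p) · (x ↑ p ∙ y ↑ (m ∸ m))
        ≡⟨ cong₂ (λ c e → c · (x ↑ p ∙ y ↑ e)) (nCn≡1 p) (ℕP.n∸n≡0 m) ⟩
      x ↑ p ∙ 1# ⊹ 0#
        ≈⟨ ≈-trans (+-identityʳ _) (*-identityʳ _) ⟩
      x ↑ p ∎

-- Powers of an element A with A + B ≡ 1 modulo p and B^p = 1

module PrimePowerMultiples {c ℓ} (R : CommutativeRing c ℓ) {p} (p-prime : Prime p) where
  open CommutativeRing R renaming (_+_ to _⊹_; _*_ to _∙_; -_ to ⊖_; refl to ≈-refl; sym to ≈-sym; trans to ≈-trans)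
  open CommutativeSemiringExp commutativeSemiring using (^-congˡ; ^-homo-*; ^-assocʳ) renaming (_^_ to _↑_)
  open SemiringMult semiring using (×-congʳ; ×-assocˡ; ×-assoc-*; ×-comm-*) renaming (_×_ to _·_)
  open CommutativeMonoidMult +-commutativeMonoid using (×-distrib-+)
  open Frobenius commutativeSemiring
  open SetoidReasoning setoid

  infix 4 _∣·_

  record _∣·_ (n : ℕ) (x : Carrier) : Set (c ⊔ ℓ) where
    constructor _,_
    field
      cofactor : Carrier
      equality : x ≈ n · cofactor
  open _∣·_

  divides-resp : ∀ {n x y} → x ≈ y → n ∣· x → n ∣· y
  divides-resp x≈y (g , x≈) = g , ≈-trans (≈-sym x≈y) x≈

  divides-+ : ∀ {n x y} → n ∣· x → n ∣· y → n ∣· (x ⊹ y)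
  divides-+ {n} (g , x≈) (g′ , y≈) = g ⊹ g′ , ≈-trans (+-cong x≈ y≈) (≈-sym (×-distrib-+ g g′ n))

  divides-*ˡ : ∀ {n x} y → n ∣· x → n ∣· (y ∙ x)
  divides-*ˡ {n} y (g , x≈) = y ∙ g , ≈-trans (*-congˡ x≈) (×-comm-* n y g)

  divides-*ʳ : ∀ {n x} y → n ∣· x → n ∣· (x ∙ y)
  divides-*ʳ y d = divides-resp (*-comm y _) (divides-*ˡ y d)

  divides-· : ∀ {n} m {x} → n ∣· x → (m ℕ.* n) ∣· (m · x)
  divides-· {n} m (g , x≈) = g , ≈-trans (×-congʳ m x≈) (×-assocˡ g m n)

  divides-self : ∀ n x → n ∣· (n · x)
  divides-self n x = x , ≈-refl

  1↑ : ∀ n → 1# ↑ n ≈ 1#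
  1↑ zero    = ≈-refl
  1↑ (suc n) = ≈-trans (*-identityˡ _) (1↑ n)

  n²∣[n·h]↑n : ∀ {n} → 1 ℕ.< n → ∀ h → (n ℕ.* n) ∣· ((n · h) ↑ n)
  n²∣[n·h]↑n {n@(suc (suc m))} 1<n h = divides-resp (*-assoc _ _ _) (divides-*ʳ _
    (divides-resp (≈-sym (×-assoc-* n h (n · h))) (divides-· n (divides-*ˡ h (divides-self n h)))))
  n²∣[n·h]↑n {suc zero} (s≤s ()) h

  p²∣[p·h]↑p : ∀ h → (p ℕ.* p) ∣· ((p · h) ↑ p)
  p²∣[p·h]↑p = n²∣[n·h]↑n (ℕ.nonTrivial⇒n>1 p {{prime⇒nonTrivial p-prime}})

  divides-weaken : ∀ {m n x} → (m ℕ.* n) ∣· x → m ∣· x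
  divides-weaken {m} {n} (g , x≈) = n · g , ≈-trans x≈ (≈-sym (×-assocˡ g m n))

  module _ {a b} (a⊹b≈1 : a ⊹ b ≈ 1#) where

    -- The p-th power of A + B + p h = 1 has the same shape again, because two uses of `frobenius`
    -- leave only multiples of p beside the p-th powers. For a = 1 - x and b = x this is (1 - x)^q ≡
    -- 1 - x^q modulo p.
    ↑p^-complement : ∀ β → ∃[ h ] a ↑ (p ^ β) ⊹ (b ↑ (p ^ β) ⊹ p · h) ≈ 1#
    ↑p^-complement zero = 0# , (begin
      a ∙ 1# ⊹ (b ∙ 1# ⊹ p · 0#)
        ≈⟨ +-cong (*-identityʳ a) (+-cong (*-identityʳ b) (≈-trans (×-congʳ p (≈-sym (zeroˡ 0#))) (≈-trans (≈-sym (×-assoc-* p 0# 0#)) (zeroʳ _)))) ⟩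
      a ⊹ (b ⊹ 0#) ≈⟨ +-congˡ (+-identityʳ b) ⟩
      a ⊹ b        ≈⟨ a⊹b≈1 ⟩
      1#           ∎)
    ↑p^-complement (suc β) with ↑p^-complement β
    ... | h , eq = h′ , (begin
      a ↑ (p ^ suc β) ⊹ (b ↑ (p ^ suc β) ⊹ p · h′)
        ≈⟨ +-cong (↑suc a) (+-cong (↑suc b) (≈-sym rest≈)) ⟩
      A ↑ p ⊹ (B ↑ p ⊹ ((p · h) ↑ p ⊹ p · (B ∙ (p · h) ∙ g₂) ⊹ p · (A ∙ B′ ∙ g₁)))
        ≈⟨ +-congˡ (rearrange (B ↑ p) ((p · h) ↑ p) (p · (B ∙ (p · h) ∙ g₂)) (p · (A ∙ B′ ∙ g₁))) ⟩
      A ↑ p ⊹ (((p · h) ↑ p ⊹ (p · (B ∙ (p · h) ∙ g₂) ⊹ B ↑ p)) ⊹ p · (A ∙ B′ ∙ g₁))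
        ≈⟨ +-congˡ (+-congʳ (≈-sym B′↑p≈)) ⟩
      A ↑ p ⊹ (B′ ↑ p ⊹ p · (A ∙ B′ ∙ g₁))
        ≈⟨ ≈-trans (+-comm _ _) (+-assoc _ _ _) ⟩
      B′ ↑ p ⊹ (p · (A ∙ B′ ∙ g₁) ⊹ A ↑ p)
        ≈⟨ [A⊹B′]↑p≈ ⟨
      (A ⊹ B′) ↑ p
        ≈⟨ ≈-trans (^-congˡ p eq) (1↑ p) ⟩
      1# ∎)
      where
      A = a ↑ (p ^ β)
      B = b ↑ (p ^ β)
      B′ = B ⊹ p · h
      g₁ = proj₁ (frobenius p-prime A B′)
      [A⊹B′]↑p≈ = proj₂ (frobenius p-prime A B′)
      g₂ = proj₁ (frobenius p-prime B (p · h))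
      B′↑p≈ = proj₂ (frobenius p-prime B (p · h))

      rest : p ∣· ((p · h) ↑ p ⊹ p · (B ∙ (p · h) ∙ g₂) ⊹ p · (A ∙ B′ ∙ g₁))
      rest = divides-+ (divides-+ (divides-weaken (p²∣[p·h]↑p h)) (divides-self p _)) (divides-self p _)
      h′ = cofactor rest
      rest≈ = equality rest

      ↑suc : ∀ z → z ↑ (p ^ suc β) ≈ (z ↑ (p ^ β)) ↑ p
      ↑suc z = begin
        z ↑ (p ℕ.* p ^ β)   ≡⟨ cong (z ↑_) (ℕP.*-comm p (p ^ β)) ⟩
        z ↑ (p ^ β ℕ.* p)   ≈⟨ ^-assocʳ z (p ^ β) p ⟨
        (z ↑ (p ^ β)) ↑ p   ∎

      rearrange : ∀ s t u v → s ⊹ (t ⊹ u ⊹ v) ≈ (t ⊹ (u ⊹ s)) ⊹ v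
      rearrange s t u v = begin
        s ⊹ (t ⊹ u ⊹ v)     ≈⟨ +-assoc s (t ⊹ u) v ⟨
        (s ⊹ (t ⊹ u)) ⊹ v   ≈⟨ +-congʳ (≈-trans (+-comm s (t ⊹ u)) (+-assoc t u s)) ⟩
        (t ⊹ (u ⊹ s)) ⊹ v   ∎

  module _ {A B h} (complement : A ⊹ (B ⊹ p · h) ≈ 1#) (B↑p≈1 : B ↑ p ≈ 1#) where

    -- The p-th power of A + B′ = 1 is A^p + p A B′ g₁ + B′^p. As B′ = B + p h, the mixed terms of
    -- B′^p carry p · p h and its last term is (p h)^p, so B′^p is B^p = 1 up to a multiple of p².
    ↑p-decomposition : ∃[ g ] ∃[ g′ ] A ↑ p ≈ p · (A ∙ g) ⊹ (p ℕ.* p) · g′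
    ↑p-decomposition = ⊖ (B′ ∙ g₁) , cofactor second , (begin
      A ↑ p
        ≈⟨ inverseˡ-unique (A ↑ p) (p · (A ∙ B′ ∙ g₁) ⊹ E) sum≈0 ⟩
      ⊖ (p · (A ∙ B′ ∙ g₁) ⊹ E)
        ≈⟨ -‿+-comm _ _ ⟨
      ⊖ (p · (A ∙ B′ ∙ g₁)) ⊹ ⊖ E
        ≈⟨ +-cong first (equality second) ⟩
      p · (A ∙ ⊖ (B′ ∙ g₁)) ⊹ (p ℕ.* p) · cofactor second ∎)
      where
      open RingProperties ring using (-‿+-comm; -‿distribʳ-*)
      open GroupProperties +-group using (inverseˡ-unique; ∙-cancelˡ)
      B′ = B ⊹ p · h
      g₁ = proj₁ (frobenius p-prime A B′)
      [A⊹B′]↑p≈ = proj₂ (frobenius p-prime A B′)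
      g₂ = proj₁ (frobenius p-prime B (p · h))
      B′↑p≈ = proj₂ (frobenius p-prime B (p · h))
      E = (p · h) ↑ p ⊹ p · (B ∙ (p · h) ∙ g₂)

      ⊖-· : ∀ n x → ⊖ (n · x) ≈ n · (⊖ x)
      ⊖-· zero    x = RingProperties.-0#≈0# ring
      ⊖-· (suc n) x = ≈-trans (≈-sym (-‿+-comm _ _)) (+-congˡ (⊖-· n x))

      first : ⊖ (p · (A ∙ B′ ∙ g₁)) ≈ p · (A ∙ ⊖ (B′ ∙ g₁))
      first = ≈-trans (⊖-· p _) (×-congʳ p (≈-trans (-‿cong (*-assoc A B′ g₁)) (-‿distribʳ-* A (B′ ∙ g₁))))

      second : (p ℕ.* p) ∣· (⊖ E)
      second with divides-+ (p²∣[p·h]↑p h) (divides-· p (divides-*ʳ g₂ (divides-*ˡ B (divides-self p h))))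
      ... | e , E≈ = ⊖ e , ≈-trans (-‿cong E≈) (⊖-· (p ℕ.* p) e)

      sum≈0 : A ↑ p ⊹ (p · (A ∙ B′ ∙ g₁) ⊹ E) ≈ 0#
      sum≈0 = ∙-cancelˡ 1# _ _ (begin
        1# ⊹ (A ↑ p ⊹ (p · (A ∙ B′ ∙ g₁) ⊹ E))
          ≈⟨ +-congʳ (≈-sym B↑p≈1) ⟩
        B ↑ p ⊹ (A ↑ p ⊹ (p · (A ∙ B′ ∙ g₁) ⊹ E))
          ≈⟨ rearrange (B ↑ p) (A ↑ p) (p · (A ∙ B′ ∙ g₁)) ((p · h) ↑ p) (p · (B ∙ (p · h) ∙ g₂)) ⟩
        ((p · h) ↑ p ⊹ (p · (B ∙ (p · h) ∙ g₂) ⊹ B ↑ p)) ⊹ (p · (A ∙ B′ ∙ g₁) ⊹ A ↑ p)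
          ≈⟨ +-congʳ B′↑p≈ ⟨
        B′ ↑ p ⊹ (p · (A ∙ B′ ∙ g₁) ⊹ A ↑ p)
          ≈⟨ [A⊹B′]↑p≈ ⟨
        (A ⊹ B′) ↑ p
          ≈⟨ ≈-trans (^-congˡ p complement) (1↑ p) ⟩
        1#
          ≈⟨ +-identityʳ 1# ⟨
        1# ⊹ 0# ∎)
        where
        rearrange : ∀ s t u v w → s ⊹ (t ⊹ (u ⊹ (v ⊹ w))) ≈ (v ⊹ (w ⊹ s)) ⊹ (u ⊹ t)
        rearrange s t u v w = begin
          s ⊹ (t ⊹ (u ⊹ (v ⊹ w)))   ≈⟨ +-congˡ (+-assoc t u (v ⊹ w)) ⟨
          s ⊹ ((t ⊹ u) ⊹ (v ⊹ w))   ≈⟨ +-congˡ (+-comm (t ⊹ u) (v ⊹ w)) ⟩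
          s ⊹ ((v ⊹ w) ⊹ (t ⊹ u))   ≈⟨ +-assoc s (v ⊹ w) (t ⊹ u) ⟨
          (s ⊹ (v ⊹ w)) ⊹ (t ⊹ u)   ≈⟨ +-cong (≈-trans (+-comm s (v ⊹ w)) (+-assoc v w s)) (+-comm t u) ⟩
          (v ⊹ (w ⊹ s)) ⊹ (u ⊹ t)   ∎

    -- A^p = p A g + p² g′ is multiplied by A^k, k = (m+1)(p-1). The first summand then contains
    -- A^(k+1), a multiple of p^(m+1); the second contains A^k, a multiple of p^m because k ≥ 1 +
    -- m(p-1) by p ≥ 2. The second falls back two steps, so the induction has two base cases.
    p^∣↑-step : ∀ m → (p ^ m) ∣· (A ↑ suc (m ℕ.* (p ∸ 1))) →
      (p ^ suc m) ∣· (A ↑ suc (suc m ℕ.* (p ∸ 1))) →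
      (p ^ suc (suc m)) ∣· (A ↑ suc (suc (suc m) ℕ.* (p ∸ 1)))
    p^∣↑-step m p^m∣ p^1+m∣ = divides-resp (≈-sym expand) (divides-+ first second)
      where
      g = proj₁ ↑p-decomposition
      g′ = proj₁ (proj₂ ↑p-decomposition)
      A↑p≈ = proj₂ (proj₂ ↑p-decomposition)
      1≤p-1 : 1 ℕ.≤ p ∸ 1
      1≤p-1 = ℕP.∸-monoˡ-≤ 1 (ℕ.nonTrivial⇒n>1 p {{prime⇒nonTrivial p-prime}})
      k = suc m ℕ.* (p ∸ 1)

      exponent : suc (suc (suc m) ℕ.* (p ∸ 1)) ≡ p ℕ.+ k
      exponent = cong (ℕ._+ k) (ℕP.suc-pred p {{prime⇒nonZero p-prime}})

      exponent′ : suc (m ℕ.* (p ∸ 1)) ℕ.+ (p ∸ 1 ∸ 1) ≡ k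
      exponent′ = trans (shift (m ℕ.* (p ∸ 1)) (p ∸ 1 ∸ 1)) (cong (ℕ._+ m ℕ.* (p ∸ 1)) (ℕP.m+[n∸m]≡n 1≤p-1))
        where
        shift : ∀ u v → suc u ℕ.+ v ≡ (1 ℕ.+ v) ℕ.+ u
        shift = ℕSolver.solve-∀

      expand : A ↑ suc (suc (suc m) ℕ.* (p ∸ 1)) ≈ p · (A ∙ g) ∙ A ↑ k ⊹ (p ℕ.* p) · g′ ∙ A ↑ k
      expand = begin
        A ↑ suc (suc (suc m) ℕ.* (p ∸ 1))                ≡⟨ cong (A ↑_) exponent ⟩
        A ↑ (p ℕ.+ k)                                    ≈⟨ ^-homo-* A p k ⟩
        A ↑ p ∙ A ↑ k                                    ≈⟨ *-congʳ A↑p≈ ⟩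
        (p · (A ∙ g) ⊹ (p ℕ.* p) · g′) ∙ A ↑ k           ≈⟨ distribʳ (A ↑ k) _ _ ⟩
        p · (A ∙ g) ∙ A ↑ k ⊹ (p ℕ.* p) · g′ ∙ A ↑ k     ∎

      first : (p ^ suc (suc m)) ∣· (p · (A ∙ g) ∙ A ↑ k)
      first = divides-resp (≈-sym (×-assoc-* p (A ∙ g) (A ↑ k))) (divides-· p
        (divides-resp (≈-trans (≈-sym (*-assoc g A (A ↑ k))) (*-congʳ (*-comm g A)))
          (divides-*ˡ g p^1+m∣)))

      second : (p ^ suc (suc m)) ∣· ((p ℕ.* p) · g′ ∙ A ↑ k)
      second = subst (_∣· ((p ℕ.* p) · g′ ∙ A ↑ k)) (ℕP.*-assoc p p (p ^ m))
        (divides-resp (≈-sym (×-assoc-* (p ℕ.* p) g′ (A ↑ k))) (divides-· (p ℕ.* p) (divides-*ˡ g′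
          (divides-resp (≈-trans (≈-sym (^-homo-* A (suc (m ℕ.* (p ∸ 1))) (p ∸ 1 ∸ 1))) (reflexive (cong (A ↑_) exponent′)))
            (divides-*ʳ (A ↑ (p ∸ 1 ∸ 1)) p^m∣)))))

    p^∣↑ : ∀ m → (p ^ m) ∣· (A ↑ suc (m ℕ.* (p ∸ 1)))
    p^∣↑ zero = A ↑ 1 , ≈-sym (+-identityʳ _)
    p^∣↑ (suc zero) = subst₂ (λ i j → i ∣· (A ↑ j)) (sym (ℕP.*-identityʳ p))
      (sym (trans (cong suc (ℕP.+-identityʳ (p ∸ 1))) (ℕP.suc-pred p {{prime⇒nonZero p-prime}})))
      (divides-resp (≈-sym A↑p≈) (divides-+ (divides-self p _) (divides-weaken (divides-self (p ℕ.* p) g′))))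
      where
      g = proj₁ ↑p-decomposition
      g′ = proj₁ (proj₂ ↑p-decomposition)
      A↑p≈ = proj₂ (proj₂ ↑p-decomposition)
    p^∣↑ (suc (suc m)) = p^∣↑-step m (p^∣↑ m) (p^∣↑ (suc m))

-- Finite differences

D : (ℤ → ℤ) → ℤ → ℤ
D a x = a x - a (x + 1ℤ)

D^ : ℕ → (ℤ → ℤ) → ℤ → ℤ
D^ zero    a = a
D^ (suc n) a = D (D^ n a)

δ : ℕ → (ℤ → ℤ) → ℤ
δ n a = D^ n a 0ℤ

D^-cong : ∀ n {a b} → a ≗ b → D^ n a ≗ D^ n b
D^-cong zero    a≗b x = a≗b x
D^-cong (suc n) a≗b x = cong₂ _-_ (D^-cong n a≗b x) (D^-cong n a≗b (x + 1ℤ))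

D^-+ : ∀ n a b x → D^ n (λ y → a y + b y) x ≡ D^ n a x + D^ n b x
D^-+ zero    a b x = refl
D^-+ (suc n) a b x = trans (cong₂ _-_ (D^-+ n a b x) (D^-+ n a b (x + 1ℤ)))
  (swap (D^ n a x) (D^ n b x) (D^ n a (x + 1ℤ)) (D^ n b (x + 1ℤ)))
  where
  swap : ∀ s t u v → (s + t) - (u + v) ≡ (s - u) + (t - v)
  swap = solve-∀

D^-* : ∀ n c a x → D^ n (λ y → c * a y) x ≡ c * D^ n a x
D^-* zero    c a x = refl
D^-* (suc n) c a x = trans (cong₂ _-_ (D^-* n c a x) (D^-* n c a (x + 1ℤ)))
  (factor c (D^ n a x) (D^ n a (x + 1ℤ)))
  where
  factor : ∀ c s t → c * s - c * t ≡ c * (s - t)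
  factor = solve-∀

D^-0 : ∀ n x → D^ n (λ _ → 0ℤ) x ≡ 0ℤ
D^-0 zero    x = refl
D^-0 (suc n) x = cong₂ _-_ (D^-0 n x) (D^-0 n (x + 1ℤ))

D^-shift : ∀ n a c x → D^ n (λ y → a (y + c)) x ≡ D^ n a (x + c)
D^-shift zero    a c x = refl
D^-shift (suc n) a c x = cong₂ _-_ (D^-shift n a c x)
  (trans (D^-shift n a c (x + 1ℤ)) (cong (D^ n a) (swap x c)))
  where
  swap : ∀ x c → x + 1ℤ + c ≡ x + c + 1ℤ
  swap = solve-∀

D^-suc : ∀ n a x → D^ (suc n) a x ≡ D^ n (D a) x
D^-suc zero    a x = refl
D^-suc (suc n) a x = cong₂ _-_ (D^-suc n a x) (D^-suc n a (x + 1ℤ))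

-- The function -y is chosen because D(-y) = 1. The formula is the Leibniz rule iterated; at x = 0
-- it becomes the absorption identity k C(n+1,k) = (n+1) C(n,k-1), which is `δ-ξ`.
D^-leibniz : ∀ n c x →
  D^ (suc n) (λ y → - y * c y) x ≡ - x * D^ (suc n) c x + + suc n * D^ n c (x + 1ℤ)
D^-leibniz zero c x = base x (c x) (c (x + 1ℤ))
  where
  base : ∀ x s t → - x * s - - (x + 1ℤ) * t ≡ - x * (s - t) + 1ℤ * t
  base = solve-∀
D^-leibniz (suc n) c x = trans (cong₂ _-_ (D^-leibniz n c x) (D^-leibniz n c (x + 1ℤ)))
  (step x (+ suc n) (D^ (suc n) c x) (D^ n c (x + 1ℤ)) (D^ n c (x + 1ℤ + 1ℤ)))
  where
  step : ∀ x k a b b′ → (- x * a + k * b) - (- (x + 1ℤ) * (b - b′) + k * b′) ≡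
    - x * (a - (b - b′)) + (1ℤ + k) * (b - b′)
  step = solve-∀

δ-ξ : ∀ n c → δ (suc n) (λ j → - j * c j) ≡ + suc n * δ n (λ j → c (j + 1ℤ))
δ-ξ n c = trans (D^-leibniz n c 0ℤ) (trans (ℤP.+-identityˡ _) (cong (+ suc n *_) (sym (D^-shift n c 1ℤ 0ℤ))))

-- Periodic functions and the ring generated by the shift

Periodic : ℕ → (ℤ → ℤ) → Set
Periodic m a = ∀ x → a (x + + m) ≡ a x

-- Polynomial expressions in the shift, as syntax: arbitrary linear operators on functions need not
-- commute, whereas for these `act-comm` follows by induction on the expression.
data Operator : Set where
  𝟎 𝟏 shift : Operator
  _⊞_ _⊠_   : Operator → Operator → Operator
  ⊟_        : Operator → Operator

act : Operator → (ℤ → ℤ) → ℤ → ℤ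
act 𝟎       a x = 0ℤ
act 𝟏       a x = a x
act shift   a x = a (x + 1ℤ)
act (s ⊞ t) a x = act s a x + act t a x
act (s ⊠ t) a x = act s (act t a) x
act (⊟ s)   a x = - act s a x

act-cong : ∀ s {a b} → a ≗ b → act s a ≗ act s b
act-cong 𝟎       a≗b x = refl
act-cong 𝟏       a≗b x = a≗b x
act-cong shift   a≗b x = a≗b (x + 1ℤ)
act-cong (s ⊞ t) a≗b x = cong₂ _+_ (act-cong s a≗b x) (act-cong t a≗b x)
act-cong (s ⊠ t) a≗b x = act-cong s (act-cong t a≗b) x
act-cong (⊟ s)   a≗b x = cong -_ (act-cong s a≗b x)

act-shift : ∀ s a c x → act s (λ y → a (y + c)) x ≡ act s a (x + c)
act-shift 𝟎       a c x = refl
act-shift 𝟏       a c x = refl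
act-shift shift   a c x = cong a (swap x c)
  where
  swap : ∀ x c → x + 1ℤ + c ≡ x + c + 1ℤ
  swap = solve-∀
act-shift (s ⊞ t) a c x = cong₂ _+_ (act-shift s a c x) (act-shift t a c x)
act-shift (s ⊠ t) a c x = trans (act-cong s (act-shift t a c) x) (act-shift s (act t a) c x)
act-shift (⊟ s)   a c x = cong -_ (act-shift s a c x)

act-0 : ∀ s x → act s (λ _ → 0ℤ) x ≡ 0ℤ
act-0 𝟎       x = refl
act-0 𝟏       x = refl
act-0 shift   x = refl
act-0 (s ⊞ t) x = cong₂ _+_ (act-0 s x) (act-0 t x)
act-0 (s ⊠ t) x = trans (act-cong s (act-0 t) x) (act-0 s x)
act-0 (⊟ s)   x = cong -_ (act-0 s x)

act-+ : ∀ s a b x → act s (λ y → a y + b y) x ≡ act s a x + act s b x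
act-+ 𝟎       a b x = refl
act-+ 𝟏       a b x = refl
act-+ shift   a b x = refl
act-+ (s ⊞ t) a b x = trans (cong₂ _+_ (act-+ s a b x) (act-+ t a b x))
  (swap (act s a x) (act s b x) (act t a x) (act t b x))
  where
  swap : ∀ i j k l → (i + j) + (k + l) ≡ (i + k) + (j + l)
  swap = solve-∀
act-+ (s ⊠ t) a b x = trans (act-cong s (act-+ t a b) x) (act-+ s (act t a) (act t b) x)
act-+ (⊟ s)   a b x = trans (cong -_ (act-+ s a b x)) (ℤP.neg-distrib-+ (act s a x) (act s b x))

act-neg : ∀ s a x → act s (λ y → - a y) x ≡ - act s a x
act-neg 𝟎       a x = refl
act-neg 𝟏       a x = refl
act-neg shift   a x = refl
act-neg (s ⊞ t) a x = trans (cong₂ _+_ (act-neg s a x) (act-neg t a x))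
  (sym (ℤP.neg-distrib-+ (act s a x) (act t a x)))
act-neg (s ⊠ t) a x = trans (act-cong s (act-neg t a) x) (act-neg s (act t a) x)
act-neg (⊟ s)   a x = cong -_ (act-neg s a x)

act-comm : ∀ s t a x → act s (act t a) x ≡ act t (act s a) x
act-comm 𝟎       t a x = sym (act-0 t x)
act-comm 𝟏       t a x = refl
act-comm shift   t a x = sym (act-shift t a 1ℤ x)
act-comm (s ⊞ u) t a x = trans (cong₂ _+_ (act-comm s t a x) (act-comm u t a x))
  (sym (act-+ t (act s a) (act u a) x))
act-comm (s ⊠ u) t a x = trans (act-cong s (act-comm u t a) x) (act-comm s t (act u a) x)
act-comm (⊟ s)   t a x = trans (cong -_ (act-comm s t a x)) (sym (act-neg t (act s a) x))

act-periodic : ∀ s {m a} → Periodic m a → Periodic m (act s a)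
act-periodic s {m} {a} per x = trans (sym (act-shift s a (+ m) x)) (act-cong s per x)

-- Identifying operators that agree on all m-periodic functions makes this ℤ[x]/(xᵐ - 1).
operatorRing : ℕ → CommutativeRing _ _
operatorRing m = record
  { Carrier = Operator
  ; _≈_ = λ s t → ∀ a → Periodic m a → act s a ≗ act t a
  ; _+_ = _⊞_ ; _*_ = _⊠_ ; -_ = ⊟_ ; 0# = 𝟎 ; 1# = 𝟏
  ; isCommutativeRing = record
    { isRing = record
      { +-isAbelianGroup = record
        { isGroup = record
          { isMonoid = record
            { isSemigroup = record
              { isMagma = record
                { isEquivalence = record
                  { refl  = λ _ _ _ → refl
                  ; sym   = λ s≈t a per x → sym (s≈t a per x)
                  ; trans = λ s≈t t≈u a per x → trans (s≈t a per x) (t≈u a per x)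
                  }
                ; ∙-cong = λ s≈s′ t≈t′ a per x → cong₂ _+_ (s≈s′ a per x) (t≈t′ a per x)
                }
              ; assoc = λ s t u a _ x → ℤP.+-assoc (act s a x) (act t a x) (act u a x)
              }
            ; identity = (λ s a _ x → ℤP.+-identityˡ (act s a x)) , (λ s a _ x → ℤP.+-identityʳ (act s a x))
            }
          ; inverse = (λ s a _ x → ℤP.+-inverseˡ (act s a x)) , (λ s a _ x → ℤP.+-inverseʳ (act s a x))
          ; ⁻¹-cong = λ s≈t a per x → cong -_ (s≈t a per x)
          }
        ; comm = λ s t a _ x → ℤP.+-comm (act s a x) (act t a x)
        }
      ; *-cong = λ {s} {s′} {t} {t′} s≈s′ t≈t′ a per x →
          trans (act-cong s (t≈t′ a per) x) (s≈s′ (act t′ a) (act-periodic t′ per) x)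
      ; *-assoc = λ _ _ _ _ _ _ → refl
      ; *-identity = (λ _ _ _ _ → refl) , (λ _ _ _ _ → refl)
      ; distrib = (λ s t u a _ x → act-+ s (act t a) (act u a) x) , (λ _ _ _ _ _ _ → refl)
      }
    ; *-comm = λ s t a _ x → act-comm s t a x
    }
  }

module _ {p} (p-prime : Prime p) (β : ℕ) where
  private
    R = operatorRing (p ^ suc β)
  open CommutativeRing R using (_≈_; semiring; commutativeSemiring)
  open CommutativeSemiringExp commutativeSemiring using (^-assocʳ) renaming (_^_ to _↑_)
  open SemiringMult semiring using () renaming (_×_ to _·_)
  open PrimePowerMultiples R p-prime
  open _∣·_

  private
    act-· : ∀ n s a x → act (n · s) a x ≡ + n * act s a x
    act-· zero    s a x = refl
    act-· (suc n) s a x = trans (cong (_+_ (act s a x)) (act-· n s a x)) (factor (+ n) (act s a x))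
      where
      factor : ∀ k z → z + k * z ≡ (1ℤ + k) * z
      factor = solve-∀

    act-shift↑ : ∀ n a x → act (shift ↑ n) a x ≡ a (x + + n)
    act-shift↑ zero    a x = cong a (sym (ℤP.+-identityʳ x))
    act-shift↑ (suc n) a x = trans (act-shift↑ n a (x + 1ℤ)) (cong a (ℤP.+-assoc x 1ℤ (+ n)))

    Δ : Operator
    Δ = 𝟏 ⊞ (⊟ shift)

    act-Δ↑ : ∀ n a x → act (Δ ↑ n) a x ≡ D^ n a x
    act-Δ↑ zero    a x = refl
    act-Δ↑ (suc n) a x = cong₂ _-_ (act-Δ↑ n a x) (act-Δ↑ n a (x + 1ℤ))

    Δ⊞shift≈𝟏 : Δ ⊞ shift ≈ 𝟏
    Δ⊞shift≈𝟏 a _ x = cancel (a x) (a (x + 1ℤ))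
      where
      cancel : ∀ s t → s - t + t ≡ s
      cancel = solve-∀

    shift↑-period : (shift ↑ (p ^ β)) ↑ p ≈ 𝟏
    shift↑-period a per x = trans (^-assocʳ shift (p ^ β) p a per x)
      (trans (act-shift↑ (p ^ β ℕ.* p) a x)
        (trans (cong (λ m → a (x + + m)) (ℕP.*-comm (p ^ β) p)) (per x)))

  -- The power of 1 - x is p^m times an operator in the ring, and that operator applied to a and
  -- evaluated at 0 is the integer quotient.
  δ-multiple : ∀ m a → Periodic (p ^ suc β) a →
    + (p ^ m) ∣ δ (p ^ β ℕ.* suc (m ℕ.* (p ∸ 1))) a
  δ-multiple m a per = divides (act (cofactor power) a 0ℤ) (begin
    δ (p ^ β ℕ.* k) a               ≡⟨ act-Δ↑ (p ^ β ℕ.* k) a 0ℤ ⟨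
    act (Δ ↑ (p ^ β ℕ.* k)) a 0ℤ    ≡⟨ ^-assocʳ Δ (p ^ β) k a per 0ℤ ⟨
    act ((Δ ↑ (p ^ β)) ↑ k) a 0ℤ    ≡⟨ equality power a per 0ℤ ⟩
    act ((p ^ m) · cofactor power) a 0ℤ ≡⟨ act-· (p ^ m) (cofactor power) a 0ℤ ⟩
    + (p ^ m) * act (cofactor power) a 0ℤ ≡⟨ ℤP.*-comm (+ (p ^ m)) _ ⟩
    act (cofactor power) a 0ℤ * + (p ^ m) ∎)
    where
    open ≡-Reasoning
    k = suc (m ℕ.* (p ∸ 1))
    power = p^∣↑ {Δ ↑ (p ^ β)} {shift ↑ (p ^ β)} (proj₂ (↑p^-complement {Δ} {shift} Δ⊞shift≈𝟏 β)) shift↑-period m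

  -- The surplus differences are applied to a first and leave it periodic.
  periodic-δ : ∀ m {n a} → Periodic (p ^ suc β) a → p ^ β ℕ.* suc (m ℕ.* (p ∸ 1)) ℕ.≤ n →
    + (p ^ m) ∣ δ n a
  periodic-δ m {n} {a} per k≤n = subst (+ (p ^ m) ∣_)
    (trans (sym (D^-∘ k (n ∸ k) a 0ℤ)) (cong (λ j → δ j a) (ℕP.m+[n∸m]≡n k≤n)))
    (δ-multiple m (D^ (n ∸ k) a) (D^-periodic (n ∸ k)))
    where
    k = p ^ β ℕ.* suc (m ℕ.* (p ∸ 1))

    D^-∘ : ∀ i j b x → D^ (i ℕ.+ j) b x ≡ D^ i (D^ j b) x
    D^-∘ zero    j b x = refl
    D^-∘ (suc i) j b x = cong₂ _-_ (D^-∘ i j b x) (D^-∘ i j b (x + 1ℤ))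

    D^-periodic : ∀ j → Periodic (p ^ suc β) (D^ j a)
    D^-periodic j x = trans (sym (D^-shift j a (+ (p ^ suc β)) x)) (D^-cong j per x)

-- Valuations of factorials

-- The product starts at y + 1: at y = 0 it is m!, and at a multiple y of q with m < q none of its
-- factors is divisible by q.
rise : ℤ → ℕ → ℤ
rise y zero    = 1ℤ
rise y (suc m) = (y + + suc m) * rise y m

rise-+ : ∀ y a b → rise y (a ℕ.+ b) ≡ rise (y + + b) a * rise y b
rise-+ y zero    b = sym (ℤP.*-identityˡ (rise y b))
rise-+ y (suc a) b = begin
  (y + + suc (a ℕ.+ b)) * rise y (a ℕ.+ b)
    ≡⟨ cong₂ _*_ (cong (λ k → y + k) (cong +_ (ℕP.+-comm (suc a) b))) (rise-+ y a b) ⟩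
  (y + (+ b + + suc a)) * (rise (y + + b) a * rise y b)
    ≡⟨ assoc y (+ b) (+ suc a) (rise (y + + b) a) (rise y b) ⟩
  (y + + b + + suc a) * rise (y + + b) a * rise y b ∎
  where
  open ≡-Reasoning
  assoc : ∀ y b c s t → (y + (b + c)) * (s * t) ≡ (y + b + c) * s * t
  assoc = solve-∀

rise-0 : ∀ m → rise 0ℤ m ≡ + (m !)
rise-0 zero    = refl
rise-0 (suc m) = trans (cong (+ suc m *_) (rise-0 m)) (sym (ℤP.pos-* (suc m) (m !)))

[m+n]!≡rise*n! : ∀ m n → + ((m ℕ.+ n) !) ≡ rise (+ n) m * + (n !)
[m+n]!≡rise*n! m n = trans (sym (rise-0 (m ℕ.+ n))) (trans (rise-+ 0ℤ m n) (cong (rise (+ n) m *_) (rise-0 n)))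

module Valuation (p : ℕ) (p-prime : Prime p) where
  open Padic p p-prime

  instance
    p≢0 : NonZero p
    p≢0 = prime⇒nonZero p-prime

  p^≢0 : ∀ e → NonZero (p ^ e)
  p^≢0 e = ℕP.m^n≢0 p e

  infix 8 _⫽_

  _⫽_ : ℕ → ℕ → ℕ
  m ⫽ i = (m ℕ./ p ^ i) {{p^≢0 i}}

  1<p : 1 ℕ.< p
  1<p = ℕ.nonTrivial⇒n>1 p {{prime⇒nonTrivial p-prime}}

  p^-+ : ∀ d e → p^ (d ℕ.+ e) ≡ p^ d * p^ e
  p^-+ d e = trans (cong +_ (ℕP.^-distribˡ-+-* p d e)) (ℤP.pos-* (p ^ d) (p ^ e))

  p^-suc : ∀ e → p^ (suc e) ≡ + p * p^ e
  p^-suc e = ℤP.pos-* p (p ^ e)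

  Unit : ℤ → Set
  Unit u = ¬ + p ∣ u

  unit-1 : Unit 1ℤ
  unit-1 d = ℕP.>⇒≢ 1<p (ℕ∣.∣1⇒≡1 (ℤ∣.∣⇒∣ᵤ d))

  prime-∣* : ∀ i j → + p ∣ i * j → + p ∣ i ⊎ + p ∣ j
  prime-∣* i j d with euclidsLemma ℤ.∣ i ∣ ℤ.∣ j ∣ p-prime (subst (p ℕ∣.∣_) (ℤP.abs-* i j) (ℤ∣.∣⇒∣ᵤ d))
  ... | inj₁ e = inj₁ (ℤ∣.∣ᵤ⇒∣ e)
  ... | inj₂ e = inj₂ (ℤ∣.∣ᵤ⇒∣ e)

  unit-* : ∀ {u u′} → Unit u → Unit u′ → Unit (u * u′)
  unit-* {u} {u′} ¬d ¬d′ d = [ ¬d , ¬d′ ]′ (prime-∣* u u′ d)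

  unit-shift : ∀ {u} x → Unit u → Unit (u + + p * x)
  unit-shift x ¬d d = ¬d (ℤ∣.∣m+n∣n⇒∣m d (ℤ∣.∣m⇒∣m*n x ℤ∣.∣-refl))

  p^∣-suc : ∀ e {z} → + p ∣ z → (∀ {z′} → z ≡ z′ * + p → p^ e ∣ z′) → p^ (suc e) ∣ z
  p^∣-suc e (divides z′ z≡) h with h {z′} z≡
  ... | divides w z′≡ = divides w (trans z≡ (trans (cong (_* + p) z′≡)
    (trans (regroup w (p^ e) (+ p)) (cong (w *_) (sym (p^-suc e))))))
    where
    regroup : ∀ w q p → w * q * p ≡ w * (p * q)
    regroup = solve-∀

  p^∣-pred : ∀ e {z} → p^ (suc e) ∣ z * + p → p^ e ∣ z
  p^∣-pred e {z} d = ℤ∣.*-cancelˡ-∣ (+ p) (subst₂ _∣_ (p^-suc e) (ℤP.*-comm z (+ p)) d)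

  -- By primality p divides z, since it does not divide u; one p is removed from z and the argument
  -- repeats with e - 1.
  unit-cancel : ∀ e {u z} → Unit u → p^ e ∣ u * z → p^ e ∣ z
  unit-cancel zero    {z = z} ¬d d = divides z (sym (ℤP.*-identityʳ z))
  unit-cancel (suc e) {u} {z} ¬d d with prime-∣* u z (ℤ∣.∣-trans (divides (p^ e) (trans (p^-suc e) (ℤP.*-comm (+ p) (p^ e)))) d)
  ... | inj₁ p∣u = contradiction p∣u ¬d
  ... | inj₂ p∣z = p^∣-suc e p∣z λ {z′} z≡ → unit-cancel e ¬d
    (p^∣-pred e (subst (p^ (suc e) ∣_) (trans (cong (u *_) z≡) (sym (ℤP.*-assoc u z′ (+ p)))) d))

  p^-mono : ∀ {d e} → d ℕ.≤ e → p^ d ∣ p^ e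
  p^-mono {d} {e} d≤e = divides (p^ (e ∸ d))
    (trans (cong p^ (sym (ℕP.m∸n+n≡m d≤e))) (p^-+ (e ∸ d) d))

  p^∣-* : ∀ {d e x y} → p^ d ∣ x → p^ e ∣ y → p^ (d ℕ.+ e) ∣ x * y
  p^∣-* {d} {e} {x} {y} d∣ e∣ = subst (_∣ x * y) (sym (p^-+ d e))
    (ℤ∣.∣-trans (ℤ∣.*-monoʳ-∣ (p^ d) e∣) (ℤ∣.*-monoˡ-∣ y d∣))

  -- Order exactly e, witnessed by a factorization, so that products and cancellation need no
  -- argument about maxima.
  record Exact (e : ℕ) (n : ℤ) : Set where
    constructor exact
    field
      cofactor      : ℤ
      cofactor-unit : Unit cofactor
      factorization : n ≡ p^ e * cofactor
  open Exact public

  exact-* : ∀ {d e m n} → Exact d m → Exact e n → Exact (d ℕ.+ e) (m * n)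
  exact-* {d} {e} (exact u ¬d m≡) (exact u′ ¬d′ n≡) = exact (u * u′) (unit-* ¬d ¬d′)
    (trans (cong₂ _*_ m≡ n≡) (trans (interchange (p^ d) u (p^ e) u′) (cong (_* (u * u′)) (sym (p^-+ d e)))))
    where
    interchange : ∀ P u Q w → (P * u) * (Q * w) ≡ (P * Q) * (u * w)
    interchange = solve-∀

  exact-p^ : ∀ e → Exact e (p^ e)
  exact-p^ e = exact 1ℤ unit-1 (sym (ℤP.*-identityʳ (p^ e)))

  exact-unit : ∀ {u} → Unit u → Exact 0 u
  exact-unit {u} ¬d = exact u ¬d (sym (ℤP.*-identityˡ u))

  exact-∣ : ∀ {e n} → Exact e n → p^ e ∣ n
  exact-∣ {e} (exact u _ n≡) = divides u (trans n≡ (ℤP.*-comm (p^ e) u))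

  exact-max : ∀ {d e n} → Exact e n → p^ d ∣ n → d ℕ.≤ e
  exact-max {d} {e} (exact u ¬d n≡) d∣n with d ℕP.≤? e
  ... | yes d≤e = d≤e
  ... | no  d≰e = contradiction p∣u ¬d
    where
    p∣u : + p ∣ u
    p∣u = ℤ∣.*-cancelˡ-∣ (p^ e) {{p^≢0 e}} (subst₂ _∣_ (trans (p^-suc e) (ℤP.*-comm (+ p) (p^ e))) n≡
      (ℤ∣.∣-trans (p^-mono {suc e} {d} (ℕP.≰⇒> d≰e)) d∣n))

  exact-unique : ∀ {d e n} → Exact d n → Exact e n → d ≡ e
  exact-unique x y = ℕP.≤-antisym (exact-max y (exact-∣ x)) (exact-max x (exact-∣ y))

  exact-cancel : ∀ {d e n z} → Exact d n → p^ (e ℕ.+ d) ∣ n * z → p^ e ∣ z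
  exact-cancel {d} {e} {n} {z} (exact u ¬d n≡) h = unit-cancel e ¬d (ℤ∣.*-cancelˡ-∣ (p^ d) {{p^≢0 d}}
    (subst₂ _∣_ (trans (p^-+ e d) (ℤP.*-comm (p^ e) (p^ d))) (trans (cong (_* z) n≡) (ℤP.*-assoc (p^ d) u z)) h))

  -- Integrality of m / p^e, read at precision e, gives p^e ∣ m. A further factor p in the quotient
  -- would make m / p^(e+1) integral, against maximality.
  ordℕ-exact : ∀ m .{{_ : NonZero m}} → Exact (ordℕ m) (+ m)
  ordℕ-exact m with ordℕ-isOrd m
  ... | (z , z≈) , max = exact w unit (trans m≡ (ℤP.*-comm w (p^ e)))
    where
    e = ordℕ m
    restore : ∀ M z P → (M * 1ℤ - z * P) + z * P ≡ M
    restore = solve-∀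
    p^e∣m : p^ e ∣ + m
    p^e∣m = subst (p^ e ∣_) (restore (+ m) (approx z e) (p^ e))
      (ℤ∣.∣m∣n⇒∣m+n (z≈ e) (ℤ∣.∣n⇒∣m*n (approx z e) ℤ∣.∣-refl))
    w = quotient p^e∣m
    m≡ = ℤ∣._∣_.equality p^e∣m
    unit : Unit w
    unit (divides w′ w≡) = ℕP.n≮n e (ℤP.drop‿+≤+ (max (+ suc e) (constᶻ w′ , λ n → divides 0ℤ
      (trans (cong (λ k → k * 1ℤ - w′ * p^ (suc e)) (trans m≡ (trans (cong (_* p^ e) w≡)
        (trans (ℤP.*-assoc w′ (+ p) (p^ e)) (cong (w′ *_) (sym (p^-suc e)))))))
        (collapse w′ (p^ (suc e)))))))
      where
      collapse : ∀ w P → w * P * 1ℤ - w * P ≡ 0ℤ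
      collapse = solve-∀

  v : ℕ → ℕ
  v m = ordℕ (m !)

  v-exact : ∀ m → Exact (v m) (+ (m !))
  v-exact m = ordℕ-exact (m !) {{m ℕP.!≢0}}

  v-unique : ∀ {e} m → Exact e (+ (m !)) → v m ≡ e
  v-unique m x = exact-unique (v-exact m) x

  v-0 : v 0 ≡ 0
  v-0 = v-unique {0} 0 (exact-unit unit-1)

  -- Multiplying by N! turns (N+1) z into (N+1)! z, whose divisibility is known; cancelling N!
  -- afterwards avoids the order of N + 1.
  v-suc : ∀ {N z} → p^ (v N) ∣ z → p^ (v (suc N)) ∣ + suc N * z
  v-suc {N = N} {z} d = exact-cancel {e = v (suc N)} (v-exact N) (subst (p^ (v (suc N) ℕ.+ v N) ∣_)
    (trans (cong (_* z) (ℤP.pos-* (suc N) (N !))) (regroup (+ suc N) (+ (N !)) z))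
    (p^∣-* {v (suc N)} {v N} (exact-∣ (v-exact (suc N))) d))
    where
    regroup : ∀ a b z → a * b * z ≡ b * (a * z)
    regroup = solve-∀

  unit-small : ∀ x {i} → 0 ℕ.< i → i ℕ.< p → Unit (+ p * x + + i)
  unit-small x {i@(suc _)} _ i<p d = ℕP.<⇒≱ i<p (ℕ∣.∣⇒≤ (ℤ∣.∣⇒∣ᵤ (ℤ∣.∣m+n∣m⇒∣n d (ℤ∣.∣m⇒∣m*n x ℤ∣.∣-refl))))

  unit-rise : ∀ x m → m ℕ.< p → Unit (rise (+ p * x) m)
  unit-rise x zero    m<p = unit-1
  unit-rise x (suc m) m<p = unit-* (unit-small x (s≤s z≤n) m<p) (unit-rise x m (ℕP.<-trans (ℕP.n<1+n m) m<p))

  -- Each step adds the block p M + 1, ..., p M + p, whose last member is p (M + 1) and whose other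
  -- members are prime to p.
  [p*M]!-exact : ∀ M → ∃[ u ] Unit u × + ((p ℕ.* M) !) ≡ p^ M * + (M !) * u
  [p*M]!-exact zero = 1ℤ , unit-1 , cong (λ k → + (k !)) (ℕP.*-zeroʳ p)
  [p*M]!-exact (suc M) with [p*M]!-exact M
  ... | u , ¬d , eq = r * u , unit-* (unit-rise (+ M) (p ∸ 1) (ℕP.∸-monoʳ-< {p} (s≤s z≤n) (ℕP.<⇒≤ 1<p))) ¬d , (begin
    + ((p ℕ.* suc M) !)                            ≡⟨ cong (λ k → + (k !)) (ℕP.*-suc p M) ⟩
    + ((p ℕ.+ p ℕ.* M) !)                          ≡⟨ [m+n]!≡rise*n! p (p ℕ.* M) ⟩
    rise (+ (p ℕ.* M)) p * + ((p ℕ.* M) !)         ≡⟨ cong₂ _*_ rise-p eq ⟩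
    + p * (+ M + 1ℤ) * r * (p^ M * + (M !) * u)    ≡⟨ regroup (+ p) (+ M) r (p^ M) (+ (M !)) u ⟩
    + p * p^ M * ((1ℤ + + M) * + (M !)) * (r * u)  ≡⟨ cong₂ (λ s t → s * t * (r * u)) (sym (p^-suc M)) (sym (ℤP.pos-* (suc M) (M !))) ⟩
    p^ (suc M) * + (suc M !) * (r * u)             ∎)
    where
    open ≡-Reasoning
    r = rise (+ p * + M) (p ∸ 1)
    regroup : ∀ p M r P F u → p * (M + 1ℤ) * r * (P * F * u) ≡ p * P * ((1ℤ + M) * F) * (r * u)
    regroup = solve-∀
    rise-p : rise (+ (p ℕ.* M)) p ≡ + p * (+ M + 1ℤ) * r
    rise-p = begin
      rise (+ (p ℕ.* M)) p                 ≡⟨ cong₂ rise (ℤP.pos-* p M) (sym (ℕP.suc-pred p)) ⟩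
      (+ p * + M + + suc (p ∸ 1)) * r      ≡⟨ cong (λ k → (+ p * + M + + k) * r) (ℕP.suc-pred p) ⟩
      (+ p * + M + + p) * r                ≡⟨ factor (+ p) (+ M) r ⟩
      + p * (+ M + 1ℤ) * r                 ∎
      where
      factor : ∀ p M r → (p * M + p) * r ≡ p * (M + 1ℤ) * r
      factor = solve-∀

  v-p* : ∀ M → v (p ℕ.* M) ≡ M ℕ.+ v M
  v-p* M with [p*M]!-exact M
  ... | u , ¬d , eq = trans (v-unique (p ℕ.* M) (subst (Exact (M ℕ.+ v M ℕ.+ 0)) (sym eq)
    (exact-* (exact-* (exact-p^ M) (v-exact M)) (exact-unit ¬d)))) (ℕP.+-identityʳ _)

  v-rec : ∀ m → v m ≡ m ℕ./ p ℕ.+ v (m ℕ./ p)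
  v-rec m = trans (v-unique m (subst (Exact (v (p ℕ.* M))) (sym eq)
      (exact-* (exact-unit (unit-rise (+ M) s (ℕDM.m%n<n m p))) (v-exact (p ℕ.* M)))))
    (v-p* M)
    where
    M = m ℕ./ p
    s = m ℕ.% p
    eq : + (m !) ≡ rise (+ p * + M) s * + ((p ℕ.* M) !)
    eq = trans (cong (λ k → + (k !)) (trans (ℕDM.m≡m%n+[m/n]*n m p) (cong (s ℕ.+_) (ℕP.*-comm M p))))
      (trans ([m+n]!≡rise*n! s (p ℕ.* M)) (cong (λ k → rise k s * + ((p ℕ.* M) !)) (ℤP.pos-* p M)))

  m/p<m : ∀ m .{{_ : NonZero m}} → m ℕ./ p ℕ.< m
  m/p<m m = ℕDM.m/n<m m p 1<p

  -- With M = ⌊N/p⌋, induction gives v(N)(p-1) = (M + v M)(p-1) < M (p-1) + M = M p ≤ N. The case M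
  -- = 0 stands apart because the strict bound fails there.
  v-bound : ∀ N → 0 ℕ.< N → v N ℕ.* (p ∸ 1) ℕ.< N
  v-bound = <-rec _ step
    where
    open ℕP.≤-Reasoning
    step : ∀ N → (∀ {M} → M ℕ.< N → 0 ℕ.< M → v M ℕ.* (p ∸ 1) ℕ.< M) → 0 ℕ.< N → v N ℕ.* (p ∸ 1) ℕ.< N
    step N@(suc _) rec 0<N = go (N ℕ./ p) (v-rec N) (m/p<m N) (ℕDM.m/n*n≤m N p)
      where
      go : ∀ M → v N ≡ M ℕ.+ v M → M ℕ.< N → M ℕ.* p ℕ.≤ N → v N ℕ.* (p ∸ 1) ℕ.< N
      go zero      vN≡ _   _    = subst (λ k → k ℕ.* (p ∸ 1) ℕ.< N) (sym (trans vN≡ v-0)) 0<N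
      go M@(suc _) vN≡ M<N Mp≤N = begin-strict
        v N ℕ.* (p ∸ 1)                       ≡⟨ cong (ℕ._* (p ∸ 1)) vN≡ ⟩
        (M ℕ.+ v M) ℕ.* (p ∸ 1)               ≡⟨ ℕP.*-distribʳ-+ (p ∸ 1) M (v M) ⟩
        M ℕ.* (p ∸ 1) ℕ.+ v M ℕ.* (p ∸ 1)     <⟨ ℕP.+-monoʳ-< (M ℕ.* (p ∸ 1)) (rec M<N (s≤s z≤n)) ⟩
        M ℕ.* (p ∸ 1) ℕ.+ M                   ≡⟨ ℕP.+-comm _ M ⟩
        M ℕ.+ M ℕ.* (p ∸ 1)                   ≡⟨ ℕP.*-suc M (p ∸ 1) ⟨
        M ℕ.* suc (p ∸ 1)                     ≡⟨ cong (M ℕ.*_) (ℕP.suc-pred p) ⟩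
        M ℕ.* p                               ≤⟨ Mp≤N ⟩
        N                                     ∎

  -- Legendre's formula and Kummer's theorem

  sum-cong : ∀ {f g : ℕ → ℕ} → f ≗ g → ∀ T → sum (applyUpTo f T) ≡ sum (applyUpTo g T)
  sum-cong f≗g zero    = refl
  sum-cong f≗g (suc T) = cong₂ ℕ._+_ (f≗g 0) (sum-cong (f≗g ∘ suc) T)

  sum-+ : ∀ (f g : ℕ → ℕ) T →
    sum (applyUpTo (λ i → f i ℕ.+ g i) T) ≡ sum (applyUpTo f T) ℕ.+ sum (applyUpTo g T)
  sum-+ f g zero    = refl
  sum-+ f g (suc T) = trans (cong (f 0 ℕ.+ g 0 ℕ.+_) (sum-+ (f ∘ suc) (g ∘ suc) T))
    (interchange (f 0) (g 0) _ _)
    where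
    interchange : ∀ a b c d → a ℕ.+ b ℕ.+ (c ℕ.+ d) ≡ a ℕ.+ c ℕ.+ (b ℕ.+ d)
    interchange = ℕSolver.solve-∀

  /p^-suc : ∀ m i → m ⫽ suc i ≡ (m ⫽ i) ℕ./ p
  /p^-suc m i = sym (trans (ℕDM.m/n/o≡m/[n*o] m (p ^ i) p {{p^≢0 i}} {{p≢0}} {{ℕP.m*n≢0 (p ^ i) p {{p^≢0 i}}}})
    (ℕDM./-congʳ {{ℕP.m*n≢0 (p ^ i) p {{p^≢0 i}}}} {{p^≢0 (suc i)}} (ℕP.*-comm (p ^ i) p)))

  -- Terms with p^i > m vanish, so any cut-off T ≥ m will do; `kummer` uses one cut-off for a, b and
  -- a + b.
  legendre : ∀ T m → m ℕ.≤ T → v m ≡ sum (applyUpTo (λ i → m ⫽ suc i) T)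
  legendre zero    zero    _   = v-0
  legendre (suc T) m       m≤T = begin
    v m                                        ≡⟨ v-rec m ⟩
    m ℕ./ p ℕ.+ v (m ℕ./ p)                    ≡⟨ cong₂ ℕ._+_ (ℕDM./-congʳ {{p≢0}} {{p^≢0 1}} (sym (ℕP.*-identityʳ p))) (legendre T (m ℕ./ p) (m/p≤T m m≤T)) ⟩
    m ⫽ 1 ℕ.+ sum (applyUpTo (λ i → (m ℕ./ p) ⫽ suc i) T)
      ≡⟨ cong (m ⫽ 1 ℕ.+_) (sum-cong (λ i → ℕDM.m/n/o≡m/[n*o] m p (p ^ suc i) {{p≢0}} {{p^≢0 (suc i)}} {{p^≢0 (2 ℕ.+ i)}}) T) ⟩
    m ⫽ 1 ℕ.+ sum (applyUpTo (λ i → m ⫽ (2 ℕ.+ i)) T) ∎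
    where
    open ≡-Reasoning
    m/p≤T : ∀ m → m ℕ.≤ suc T → m ℕ./ p ℕ.≤ T
    m/p≤T zero      _   = subst (ℕ._≤ T) (sym (ℕDM.0/n≡0 p)) z≤n
    m/p≤T m@(suc _) m≤T = ℕP.≤-pred (ℕP.<-≤-trans (m/p<m m) m≤T)

  -- The carry into position i is the defect of additivity of ⌊·/p^i⌋. In the step each quotient is
  -- written as its last digit plus p times the next quotient.
  carry-/ : ∀ a b i → (a ℕ.+ b) ⫽ i ≡ a ⫽ i ℕ.+ b ⫽ i ℕ.+ carry a b i
  carry-/ a b zero = trans (ℕDM.n/1≡n (a ℕ.+ b))
    (sym (trans (ℕP.+-identityʳ _) (cong₂ ℕ._+_ (ℕDM.n/1≡n a) (ℕDM.n/1≡n b))))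
  carry-/ a b (suc i) = begin
    (a ℕ.+ b) ⫽ suc i                        ≡⟨ /p^-suc (a ℕ.+ b) i ⟩
    ((a ℕ.+ b) ⫽ i) ℕ./ p                    ≡⟨ cong (ℕ._/ p) (carry-/ a b i) ⟩
    (A ℕ.+ B ℕ.+ c) ℕ./ p                          ≡⟨ cong (ℕ._/ p) regrouped ⟩
    ((A ℕ./ p ℕ.+ B ℕ./ p) ℕ.* p ℕ.+ (A ℕ.% p ℕ.+ B ℕ.% p ℕ.+ c)) ℕ./ p
      ≡⟨ ℕDM.+-distrib-/-∣ˡ (A ℕ.% p ℕ.+ B ℕ.% p ℕ.+ c) (ℕ∣.n∣m*n (A ℕ./ p ℕ.+ B ℕ./ p)) ⟩
    (A ℕ./ p ℕ.+ B ℕ./ p) ℕ.* p ℕ./ p ℕ.+ carry a b (suc i)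
      ≡⟨ cong (ℕ._+ carry a b (suc i)) (trans (ℕDM.m*n/n≡m (A ℕ./ p ℕ.+ B ℕ./ p) p) (cong₂ ℕ._+_ (sym (/p^-suc a i)) (sym (/p^-suc b i)))) ⟩
    a ⫽ suc i ℕ.+ b ⫽ suc i ℕ.+ carry a b (suc i) ∎
    where
    open ≡-Reasoning
    A = a ⫽ i
    B = b ⫽ i
    c = carry a b i
    collect : ∀ s t s′ t′ c p → s ℕ.+ t ℕ.* p ℕ.+ (s′ ℕ.+ t′ ℕ.* p) ℕ.+ c ≡ (t ℕ.+ t′) ℕ.* p ℕ.+ (s ℕ.+ s′ ℕ.+ c)
    collect = ℕSolver.solve-∀
    regrouped : A ℕ.+ B ℕ.+ c ≡ (A ℕ./ p ℕ.+ B ℕ./ p) ℕ.* p ℕ.+ (A ℕ.% p ℕ.+ B ℕ.% p ℕ.+ c)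
    regrouped = trans (cong₂ (λ s t → s ℕ.+ t ℕ.+ c) (ℕDM.m≡m%n+[m/n]*n A p) (ℕDM.m≡m%n+[m/n]*n B p))
      (collect (A ℕ.% p) (A ℕ./ p) (B ℕ.% p) (B ℕ./ p) c p)

  kummer : ∀ a b → v (a ℕ.+ b) ≡ v a ℕ.+ v b ℕ.+ τ a b
  kummer a b = begin
    v (a ℕ.+ b)                                       ≡⟨ legendre T T ℕP.≤-refl ⟩
    Σ (λ i → (a ℕ.+ b) ⫽ suc i)                 ≡⟨ sum-cong (λ i → carry-/ a b (suc i)) T ⟩
    Σ (λ i → a ⫽ suc i ℕ.+ b ⫽ suc i ℕ.+ carry a b (suc i))
      ≡⟨ trans (sum-+ _ _ T) (cong (ℕ._+ Σ (λ i → carry a b (suc i))) (sum-+ _ _ T)) ⟩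
    Σ (λ i → a ⫽ suc i) ℕ.+ Σ (λ i → b ⫽ suc i) ℕ.+ Σ (λ i → carry a b (suc i))
      ≡⟨ cong₂ ℕ._+_ (cong₂ ℕ._+_ (sym (legendre T a (ℕP.m≤m+n a b))) (sym (legendre T b (ℕP.m≤n+m b a))))
           (cong sum (sym (ListP.map-upTo (λ i → carry a b (suc i)) T))) ⟩
    v a ℕ.+ v b ℕ.+ τ a b                             ∎
    where
    open ≡-Reasoning
    T = a ℕ.+ b
    Σ = λ (f : ℕ → ℕ) → sum (applyUpTo f T)

-- Weighted differences and functions supported on a residue class

-- No degree or normal form is recorded: the bounds below hold for all integer polynomials at once,
-- and rest on closure under products and composition and on splitting off the constant term.
data IsPoly : (ℤ → ℤ) → Set where
  const : ∀ c → IsPoly (λ _ → c)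
  ident : IsPoly (λ x → x)
  add   : ∀ {f g} → IsPoly f → IsPoly g → IsPoly (λ x → f x + g x)
  mul   : ∀ {f g} → IsPoly f → IsPoly g → IsPoly (λ x → f x * g x)

poly-∘ : ∀ {f g} → IsPoly f → IsPoly g → IsPoly (f ∘ g)
poly-∘ (const c) h = const c
poly-∘ ident     h = h
poly-∘ (add f g) h = add (poly-∘ f h) (poly-∘ g h)
poly-∘ (mul f g) h = mul (poly-∘ f h) (poly-∘ g h)

poly-horner : ∀ {f} → IsPoly f → ∃[ c ] ∃[ g ] IsPoly g × f ≗ (λ x → c + - x * g x)
poly-horner (const c) = c , _ , const 0ℤ , λ x → lemma c x
  where
  lemma : ∀ c x → c ≡ c + - x * 0ℤ
  lemma = solve-∀
poly-horner ident = 0ℤ , _ , const -1ℤ , lemma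
  where
  lemma : ∀ x → x ≡ 0ℤ + - x * -1ℤ
  lemma = solve-∀
poly-horner (add f g) with poly-horner f | poly-horner g
... | c , F , F-poly , f≗ | d , G , G-poly , g≗ = c + d , _ , add F-poly G-poly ,
  λ x → trans (cong₂ _+_ (f≗ x) (g≗ x)) (lemma c d x (F x) (G x))
  where
  lemma : ∀ c d x s t → (c + - x * s) + (d + - x * t) ≡ (c + d) + - x * (s + t)
  lemma = solve-∀
poly-horner (mul f g) with poly-horner f | poly-horner g
... | c , F , F-poly , f≗ | d , G , G-poly , g≗ = c * d , _ ,
  add (mul (const c) G-poly) (mul F-poly (add (const d) (mul (mul (const -1ℤ) ident) G-poly))) ,
  λ x → trans (cong₂ _*_ (f≗ x) (g≗ x)) (lemma c d x (F x) (G x))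
  where
  lemma : ∀ c d x s t → (c + - x * s) * (d + - x * t) ≡ c * d + - x * (c * t + s * (d + -1ℤ * x * t))
  lemma = solve-∀

-- The falling factorial x(x-1)⋯(x-l+1) times (-1)^l. With this sign D takes φ_l to l φ_(l-1), as in
-- `D-φ`.
φ : ℕ → ℤ → ℤ
φ zero    x = 1ℤ
φ (suc l) x = - x * φ l (x - 1ℤ)

rise-suc : ∀ z m → rise z (suc m) ≡ (z + 1ℤ) * rise (z + 1ℤ) m
rise-suc z m = trans (cong (rise z) (ℕP.+-comm 1 m)) (trans (rise-+ z m 1)
  (swap (rise (z + 1ℤ) m) z))
  where
  swap : ∀ s z → s * ((z + 1ℤ) * 1ℤ) ≡ (z + 1ℤ) * s
  swap = solve-∀

φ≡rise : ∀ m y → φ (suc m) y ≡ - y * rise (- y) m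
φ≡rise zero    y = refl
φ≡rise (suc m) y = cong (- y *_) (begin
  φ (suc m) (y - 1ℤ)                      ≡⟨ φ≡rise m (y - 1ℤ) ⟩
  - (y - 1ℤ) * rise (- (y - 1ℤ)) m        ≡⟨ cong (λ z → z * rise z m) (negate y) ⟩
  (- y + 1ℤ) * rise (- y + 1ℤ) m          ≡⟨ rise-suc (- y) m ⟨
  rise (- y) (suc m)                      ∎)
  where
  open ≡-Reasoning
  negate : ∀ y → - (y - 1ℤ) ≡ - y + 1ℤ
  negate = solve-∀

sgn : ℕ → ℤ
sgn zero    = 1ℤ
sgn (suc r) = - sgn r

sgn*sgn : ∀ r → sgn r * sgn r ≡ 1ℤ
sgn*sgn zero    = refl
sgn*sgn (suc r) = trans (lemma (sgn r)) (sgn*sgn r)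
  where
  lemma : ∀ s → - s * - s ≡ s * s
  lemma = solve-∀

φ-shifted : ∀ r y → φ r (+ r + y) ≡ sgn r * rise y r
φ-shifted zero    y = refl
φ-shifted (suc r) y = begin
  - (+ suc r + y) * φ r (+ suc r + y - 1ℤ)  ≡⟨ cong (λ z → - (+ suc r + y) * φ r z) (unshift (+ r) y) ⟩
  - (+ suc r + y) * φ r (+ r + y)           ≡⟨ cong (- (+ suc r + y) *_) (φ-shifted r y) ⟩
  - (+ suc r + y) * (sgn r * rise y r)      ≡⟨ regroup (+ suc r) y (sgn r) (rise y r) ⟩
  - sgn r * ((y + + suc r) * rise y r)      ∎
  where
  open ≡-Reasoning
  unshift : ∀ r y → (1ℤ + r) + y - 1ℤ ≡ r + y
  unshift = solve-∀
  regroup : ∀ r y s t → - (r + y) * (s * t) ≡ - s * ((y + r) * t)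
  regroup = solve-∀

-- `δ-ξ` applied m times. The sign in `φ` compensates the change from (-1)^k to (-1)^(k-m).
δ-φ : ∀ m n c → δ (m ℕ.+ n) (λ j → φ m j * c j) ≡ rise (+ n) m * δ n (λ j → c (j + + m))
δ-φ zero    n c = trans (D^-cong n (λ j → trans (ℤP.*-identityˡ (c j)) (cong c (sym (ℤP.+-identityʳ j)))) 0ℤ)
  (sym (ℤP.*-identityˡ _))
δ-φ (suc m) n c = begin
  δ (suc (m ℕ.+ n)) (λ j → - j * φ m (j - 1ℤ) * c j)
    ≡⟨ D^-cong (suc (m ℕ.+ n)) (λ j → ℤP.*-assoc (- j) (φ m (j - 1ℤ)) (c j)) 0ℤ ⟩
  δ (suc (m ℕ.+ n)) (λ j → - j * (φ m (j - 1ℤ) * c j))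
    ≡⟨ δ-ξ (m ℕ.+ n) (λ j → φ m (j - 1ℤ) * c j) ⟩
  + suc (m ℕ.+ n) * δ (m ℕ.+ n) (λ j → φ m (j + 1ℤ - 1ℤ) * c (j + 1ℤ))
    ≡⟨ cong (+ suc (m ℕ.+ n) *_) (D^-cong (m ℕ.+ n) (λ j → cong (λ z → φ m z * c (j + 1ℤ)) (unshift j)) 0ℤ) ⟩
  + suc (m ℕ.+ n) * δ (m ℕ.+ n) (λ j → φ m j * c (j + 1ℤ))
    ≡⟨ cong (+ suc (m ℕ.+ n) *_) (δ-φ m n (λ j → c (j + 1ℤ))) ⟩
  + suc (m ℕ.+ n) * (rise (+ n) m * δ n (λ j → c (j + + m + 1ℤ)))
    ≡⟨ cong₂ (λ s t → s * (rise (+ n) m * t)) (cong +_ (ℕP.+-comm (suc m) n))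
         (D^-cong n (λ j → cong c (shift-assoc j (+ m))) 0ℤ) ⟩
  (+ n + + suc m) * (rise (+ n) m * δ n (λ j → c (j + + suc m)))
    ≡⟨ ℤP.*-assoc (+ n + + suc m) (rise (+ n) m) _ ⟨
  rise (+ n) (suc m) * δ n (λ j → c (j + + suc m)) ∎
  where
  open ≡-Reasoning
  unshift : ∀ j → j + 1ℤ - 1ℤ ≡ j
  unshift = solve-∀
  shift-assoc : ∀ j m → j + m + 1ℤ ≡ j + (1ℤ + m)
  shift-assoc = solve-∀

-- This is (n+1-k) C(n+1,k) = (n+1) C(n,k). The part n + 1 contributes D^n c at 0 minus D^n c at 1,
-- and by `δ-ξ` the part -k cancels the value at 1.
δ-complement : ∀ n c → δ (suc n) (λ j → (+ suc n - j) * c j) ≡ + suc n * δ n c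
δ-complement n c = begin
  δ (suc n) (λ j → (+ suc n - j) * c j)
    ≡⟨ D^-cong (suc n) (λ j → ℤP.*-distribʳ-+ (c j) (+ suc n) (- j)) 0ℤ ⟩
  δ (suc n) (λ j → + suc n * c j + - j * c j)
    ≡⟨ D^-+ (suc n) (λ j → + suc n * c j) (λ j → - j * c j) 0ℤ ⟩
  δ (suc n) (λ j → + suc n * c j) + δ (suc n) (λ j → - j * c j)
    ≡⟨ cong₂ _+_ (D^-* (suc n) (+ suc n) c 0ℤ) (δ-ξ n c) ⟩
  + suc n * (D^ n c 0ℤ - D^ n c 1ℤ) + + suc n * δ n (λ j → c (j + 1ℤ))
    ≡⟨ cong (λ t → + suc n * (D^ n c 0ℤ - D^ n c 1ℤ) + + suc n * t) (D^-shift n c 1ℤ 0ℤ) ⟩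
  + suc n * (D^ n c 0ℤ - D^ n c 1ℤ) + + suc n * D^ n c 1ℤ
    ≡⟨ collect (+ suc n) (D^ n c 0ℤ) (D^ n c 1ℤ) ⟩
  + suc n * δ n c ∎
  where
  open ≡-Reasoning
  collect : ∀ k s t → k * (s - t) + k * t ≡ k * s
  collect = solve-∀

-- The mirror image of `δ-φ` under k ↦ n - k; c is not translated and no sign arises.
δ-rise : ∀ s M c → δ (s ℕ.+ M) (λ j → rise (+ M - j) s * c j) ≡ rise (+ M) s * δ M c
δ-rise zero    M c = trans (D^-cong M (λ j → ℤP.*-identityˡ (c j)) 0ℤ) (sym (ℤP.*-identityˡ _))
δ-rise (suc s) M c = begin
  δ (suc (s ℕ.+ M)) (λ j → (+ M - j + + suc s) * rise (+ M - j) s * c j)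
    ≡⟨ D^-cong (suc (s ℕ.+ M)) (λ j → regroup (+ M) j (+ s) (rise (+ M - j) s) (c j)) 0ℤ ⟩
  δ (suc (s ℕ.+ M)) (λ j → (+ suc (s ℕ.+ M) - j) * (rise (+ M - j) s * c j))
    ≡⟨ δ-complement (s ℕ.+ M) (λ j → rise (+ M - j) s * c j) ⟩
  + suc (s ℕ.+ M) * δ (s ℕ.+ M) (λ j → rise (+ M - j) s * c j)
    ≡⟨ cong₂ _*_ (cong +_ (ℕP.+-comm (suc s) M)) (δ-rise s M c) ⟩
  (+ M + + suc s) * (rise (+ M) s * δ M c)
    ≡⟨ ℤP.*-assoc (+ M + + suc s) (rise (+ M) s) (δ M c) ⟨
  rise (+ M) (suc s) * δ M c ∎
  where
  open ≡-Reasoning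
  regroup : ∀ M j s t c → (M - j + (1ℤ + s)) * t * c ≡ ((1ℤ + (s + M)) - j) * (t * c)
  regroup = solve-∀

D^-vanish : ∀ n a x → (∀ j → j ℕ.≤ n → a (x + + j) ≡ 0ℤ) → D^ n a x ≡ 0ℤ
D^-vanish zero    a x a≡0 = trans (cong a (sym (ℤP.+-identityʳ x))) (a≡0 0 z≤n)
D^-vanish (suc n) a x a≡0 = cong₂ _-_ (D^-vanish n a x (λ j j≤n → a≡0 j (ℕP.m≤n⇒m≤1+n j≤n)))
  (D^-vanish n a (x + 1ℤ) (λ j j≤n → trans (cong a (ℤP.+-assoc x 1ℤ (+ j))) (a≡0 (suc j) (s≤s j≤n))))

-- The decision is an argument, so that the lemmas on `spread` can distinguish cases for an
-- arbitrary decision.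
on-support : ∀ {d z} → (ℤ → ℤ) → Dec (d ∣ z) → ℤ
on-support c (yes d) = c (quotient d)
on-support c (no  _) = 0ℤ

spread : ℕ → ℤ → (ℤ → ℤ) → ℤ → ℤ
spread m r c j = on-support c (+ m ∣? j - r)

spread-cong : ∀ m r {c d} → c ≗ d → spread m r c ≗ spread m r d
spread-cong m r {c} {d} c≗d j = go (+ m ∣? j - r)
  where
  go : (dec : Dec (+ m ∣ j - r)) → on-support c dec ≡ on-support d dec
  go (yes e) = c≗d (quotient e)
  go (no  _) = refl

spread-+ : ∀ m r c d → spread m r (λ x → c x + d x) ≗ (λ j → spread m r c j + spread m r d j)
spread-+ m r c d j = go (+ m ∣? j - r)
  where
  go : (dec : Dec (+ m ∣ j - r)) → on-support (λ x → c x + d x) dec ≡ on-support c dec + on-support d dec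
  go (yes _) = refl
  go (no  _) = refl

-- On the support j = r + m x, so a factor depending on k becomes a factor in the quotient x. This
-- turns products of consecutive integers near k into polynomials in ⌊k/q⌋.
spread-* : ∀ m r (g c : ℤ → ℤ) → (λ j → g j * spread m r c j) ≗ spread m r (λ x → g (r + + m * x) * c x)
spread-* m r g c j = go (+ m ∣? j - r)
  where
  go : (dec : Dec (+ m ∣ j - r)) → g j * on-support c dec ≡ on-support (λ x → g (r + + m * x) * c x) dec
  go (yes (divides x j-r≡)) = cong (λ i → g i * c x)
    (trans (restore j r) (cong (_+_ r) (trans j-r≡ (ℤP.*-comm x (+ m)))))
    where
    restore : ∀ j r → j ≡ r + (j - r)
    restore = solve-∀
  go (no  _) = ℤP.*-zeroʳ (g j)

spread-scale : ∀ m r (k : ℤ) (c : ℤ → ℤ) → spread m r (λ x → k * c x) ≗ (λ j → k * spread m r c j)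
spread-scale m r k c j = sym (spread-* m r (λ _ → k) c j)

spread-off : ∀ m r c j → ¬ + m ∣ j - r → spread m r c j ≡ 0ℤ
spread-off m r c j ¬d = go (+ m ∣? j - r)
  where
  go : (dec : Dec (+ m ∣ j - r)) → on-support c dec ≡ 0ℤ
  go (yes d) = contradiction d ¬d
  go (no  _) = refl

spread-on : ∀ m .{{_ : NonZero m}} r c x → spread m r c (r + + m * x) ≡ c x
spread-on m r c x = go (+ m ∣? (r + + m * x) - r)
  where
  simplify : ∀ r m x → (r + m * x) - r ≡ x * m
  simplify = solve-∀
  go : (dec : Dec (+ m ∣ (r + + m * x) - r)) → on-support c dec ≡ c x
  go (yes (divides y eq)) = cong c (ℤP.*-cancelʳ-≡ y x (+ m) (trans (sym eq) (simplify r (+ m) x)))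
  go (no ¬d) = contradiction (divides x (simplify r (+ m) x)) ¬d

spread-unique : ∀ m r c f → (∀ x → f (r + + m * x) ≡ c x) → (∀ j → ¬ + m ∣ j - r → f j ≡ 0ℤ) →
  f ≗ spread m r c
spread-unique m r c f on off j = go (+ m ∣? j - r)
  where
  go : (dec : Dec (+ m ∣ j - r)) → f j ≡ on-support c dec
  go (yes (divides x j-r≡)) = trans (cong f
    (trans (restore j r) (cong (_+_ r) (trans j-r≡ (ℤP.*-comm x (+ m)))))) (on x)
    where
    restore : ∀ j r → j ≡ r + (j - r)
    restore = solve-∀
  go (no ¬d) = off j ¬d

spread-translate : ∀ m .{{_ : NonZero m}} r c k → (λ j → spread m (r + k) c (j + k)) ≗ spread m r c
spread-translate m r c k = spread-unique m r c _
  (λ x → trans (cong (spread m (r + k) c) (swap r (+ m * x) k)) (spread-on m (r + k) c x))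
  (λ j ¬d → spread-off m (r + k) c (j + k) (λ d → ¬d (subst (+ m ∣_) (cancel j r k) d)))
  where
  swap : ∀ r y k → r + y + k ≡ (r + k) + y
  swap = solve-∀
  cancel : ∀ j r k → (j + k) - (r + k) ≡ j - r
  cancel = solve-∀

spread-step : ∀ m .{{_ : NonZero m}} r c k → (λ j → spread m r c (j + + m * k)) ≗ spread m r (λ x → c (x + k))
spread-step m r c k = spread-unique m r _ _
  (λ x → trans (cong (spread m r c) (factor r (+ m) x k)) (spread-on m r c (x + k)))
  (λ j ¬d → spread-off m r c (j + + m * k) (λ d → ¬d (ℤ∣.∣m+n∣n⇒∣m (subst (+ m ∣_) (swap j (+ m * k) r) d) (ℤ∣.∣m⇒∣m*n k ℤ∣.∣-refl))))
  where
  factor : ∀ r m x k → r + m * x + m * k ≡ r + m * (x + k)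
  factor = solve-∀
  swap : ∀ j y r → (j + y) - r ≡ (j - r) + y
  swap = solve-∀

spread-periodic : ∀ m .{{_ : NonZero m}} r {c k} → Periodic k c → Periodic (m ℕ.* k) (spread m r c)
spread-periodic m r {c} {k} per j = trans (cong (λ y → spread m r c (j + y)) (ℤP.pos-* m k))
  (trans (spread-step m r c (+ k) j) (spread-cong m r per j))

-- From r + m (s + k x) = (r + m s) + m k x. It merges a class of k modulo q and a class of ⌊k/q⌋
-- modulo p into one class modulo p^α.
spread-spread : ∀ m .{{_ : NonZero m}} r k .{{_ : NonZero k}} s c →
  spread m r (spread k s c) ≗ spread (m ℕ.* k) (r + + m * s) c
spread-spread m r k s c = spread-unique (m ℕ.* k) (r + + m * s) c _ on off
  where
  on : ∀ x → spread m r (spread k s c) ((r + + m * s) + + (m ℕ.* k) * x) ≡ c x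
  on x = trans (cong (spread m r (spread k s c))
      (trans (cong (λ y → (r + + m * s) + y * x) (ℤP.pos-* m k)) (factor r (+ m) s (+ k) x)))
    (trans (spread-on m r (spread k s c) (s + + k * x)) (spread-on k s c x))
    where
    factor : ∀ r m s k x → (r + m * s) + (m * k) * x ≡ r + m * (s + k * x)
    factor = solve-∀
  off : ∀ j → ¬ + (m ℕ.* k) ∣ j - (r + + m * s) → spread m r (spread k s c) j ≡ 0ℤ
  off j ¬d = go (+ m ∣? j - r)
    where
    go : (dec : Dec (+ m ∣ j - r)) → on-support (spread k s c) dec ≡ 0ℤ
    go (no _) = refl
    go (yes (divides x j-r≡)) = spread-off k s c x (λ (divides y x-s≡) → ¬d (divides y
      (trans (regroup j r (+ m) s) (trans (cong (_- s * + m) j-r≡)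
        (trans (factor x (+ m) s) (trans (cong (_* + m) x-s≡)
          (trans (collect y (+ k) (+ m)) (cong (y *_) (sym (ℤP.pos-* m k))))))))))
      where
      regroup : ∀ j r m s → j - (r + m * s) ≡ (j - r) - s * m
      regroup = solve-∀
      factor : ∀ x m s → x * m - s * m ≡ (x - s) * m
      factor = solve-∀
      collect : ∀ y k m → y * k * m ≡ y * (m * k)
      collect = solve-∀

-- Divisibility for integer polynomial weights

module Core (p : ℕ) (p-prime : Prime p) where
  open Padic p p-prime
  open Valuation p p-prime

  -- All values have the same order e, and the unit part is moreover constant modulo p;
  -- `good-cancel` depends on this constancy.
  record Good (e : ℕ) (f : ℤ → ℤ) : Set where
    constructor good
    field
      {u}    : ℤ
      {V}    : ℤ → ℤ
      u-unit : Unit u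
      V-poly : IsPoly V
      shape  : ∀ x → f x ≡ p^ e * (u + + p * V x)

    unitPart : ℤ → ℤ
    unitPart x = u + + p * V x
  open Good public using (unitPart)

  good-exact : ∀ {e f} → Good e f → ∀ x → Exact e (f x)
  good-exact (good {V = V} ¬d _ shape) x = exact _ (unit-shift (V x) ¬d) (shape x)

  good-1 : Good 0 (λ _ → 1ℤ)
  good-1 = good unit-1 (const 0ℤ) (λ _ → lemma (+ p))
    where
    lemma : ∀ p → 1ℤ ≡ 1ℤ * (1ℤ + p * 0ℤ)
    lemma = solve-∀

  good-* : ∀ {d e f g} → Good d f → Good e g → Good (d ℕ.+ e) (λ x → f x * g x)
  good-* {d} {e} (good {u} {V} ¬d V-poly f≡) (good {u′} {V′} ¬d′ V′-poly g≡) =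
    good {V = λ x → u * V′ x + V x * (u′ + + p * V′ x)} (unit-* ¬d ¬d′)
      (add (mul (const u) V′-poly) (mul V-poly (add (const u′) (mul (const (+ p)) V′-poly))))
      λ x → trans (cong₂ _*_ (f≡ x) (g≡ x)) (trans (lemma (p^ d) (p^ e) (+ p) u u′ (V x) (V′ x))
        (cong (_* (u * u′ + + p * (u * V′ x + V x * (u′ + + p * V′ x)))) (sym (p^-+ d e))))
    where
    lemma : ∀ P Q p u u′ V V′ → (P * (u + p * V)) * (Q * (u′ + p * V′)) ≡
      (P * Q) * (u * u′ + p * (u * V′ + V * (u′ + p * V′)))
    lemma = solve-∀

  good-∘ : ∀ {e f g} → Good e f → IsPoly g → Good e (f ∘ g)
  good-∘ {g = g} (good ¬d V-poly f≡) g-poly = good ¬d (poly-∘ V-poly g-poly) (f≡ ∘ g)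

  -- As 0 < i < p^β, the order of i is below β and the term p^β x cannot change it. Common factors p
  -- are divided out one at a time, each lowering β.
  good-linear : ∀ β {i} → 0 ℕ.< i → i ℕ.< p ^ β → ∃[ e ] Good e (λ x → p^ β * x + + i)
  good-linear zero    {suc i} _ (s≤s ())
  good-linear (suc β) {i@(suc _)} 0<i i<p^ with p ℕ∣.∣? i
  ... | no p∤i = 0 , good {u = + i} (λ d → p∤i (ℤ∣.∣⇒∣ᵤ d)) (mul (const (p^ β)) ident)
    (λ x → trans (cong (λ P → P * x + + i) (p^-suc β)) (lemma (+ p) (p^ β) x (+ i)))
    where
    lemma : ∀ p P x i → p * P * x + i ≡ 1ℤ * (i + p * (P * x))
    lemma = solve-∀
  ... | yes (ℕ∣.divides k@(suc _) i≡k*p)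
    with good-linear β {k} (s≤s z≤n) (ℕP.*-cancelʳ-< p k (p ^ β) (subst₂ ℕ._<_ i≡k*p (ℕP.*-comm p (p ^ β)) i<p^))
  ...   | e , good {u} {V} ¬d V-poly k≡ = suc e , good ¬d V-poly λ x → (begin
      p^ (suc β) * x + + i                 ≡⟨ cong₂ (λ P j → P * x + j) (p^-suc β) (trans (cong +_ i≡k*p) (ℤP.pos-* k p)) ⟩
      + p * p^ β * x + + k * + p           ≡⟨ factor (+ p) (p^ β) x (+ k) ⟩
      + p * (p^ β * x + + k)               ≡⟨ cong (+ p *_) (k≡ x) ⟩
      + p * (p^ e * (u + + p * V x))       ≡⟨ ℤP.*-assoc (+ p) (p^ e) _ ⟨
      + p * p^ e * (u + + p * V x)         ≡⟨ cong (_* (u + + p * V x)) (p^-suc e) ⟨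
      p^ (suc e) * (u + + p * V x)         ∎)
    where
    open ≡-Reasoning
    factor : ∀ p P x k → p * P * x + k * p ≡ p * (P * x + k)
    factor = solve-∀

  good-rise′ : ∀ β m → m ℕ.< p ^ β → ∃[ e ] Good e (λ x → rise (p^ β * x) m)
  good-rise′ β zero    _   = 0 , good-1
  good-rise′ β (suc m) m<q with good-linear β (s≤s z≤n) m<q | good-rise′ β m (ℕP.<-trans (ℕP.n<1+n m) m<q)
  ... | d , g | e , h = d ℕ.+ e , good-* g h

  -- The exponent is the same for all x, hence can be read off at x = 0, where the product is m!.
  good-rise : ∀ β m → m ℕ.< p ^ β → Good (v m) (λ x → rise (p^ β * x) m)
  good-rise β m m<q with good-rise′ β m m<q
  ... | e , g = subst (λ d → Good d (λ x → rise (p^ β * x) m)) (sym (v-unique m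
    (subst (Exact e) (trans (cong (λ y → rise y m) (ℤP.*-zeroʳ (p^ β))) (rise-0 m)) (good-exact g 0ℤ)))) g

  record Functional : Set where
    field
      apply   : (ℤ → ℤ) → ℤ
      apply-≗ : ∀ {f g} → f ≗ g → apply f ≡ apply g
      apply-+ : ∀ f g → apply (λ x → f x + g x) ≡ apply f + apply g
      apply-* : ∀ k f → apply (λ x → k * f x) ≡ k * apply f
  open Functional

  -- Induction on i, with u L(P) = L((u + pV) P) - p L(V P).
  good-cancel : ∀ {e f} (g : Good e f) (L : Functional) i →
    (∀ {P} → IsPoly P → p^ i ∣ apply L (λ x → unitPart g x * P x)) →
    ∀ {P} → IsPoly P → p^ i ∣ apply L P
  good-cancel g L zero h {P} _ = divides (apply L P) (sym (ℤP.*-identityʳ (apply L P)))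
  good-cancel g@(good {u} {V} ¬d V-poly _) L (suc i) h {P} P-poly = unit-cancel (suc i) ¬d
    (ℤ∣.∣m+n∣n⇒∣m (subst (p^ (suc i) ∣_) split (h P-poly))
      (subst (_∣ + p * apply L (λ x → V x * P x)) (sym (p^-suc i))
        (ℤ∣.*-monoʳ-∣ (+ p) (good-cancel g L i
          (λ Q-poly → ℤ∣.∣-trans (p^-mono (ℕP.n≤1+n i)) (h Q-poly)) (mul V-poly P-poly)))))
    where
    open ≡-Reasoning
    expand : ∀ u p V P → (u + p * V) * P ≡ u * P + p * (V * P)
    expand = solve-∀
    split : apply L (λ x → (u + + p * V x) * P x) ≡ u * apply L P + + p * apply L (λ x → V x * P x)
    split = begin
      apply L (λ x → (u + + p * V x) * P x)
        ≡⟨ apply-≗ L (λ x → expand u (+ p) (V x) (P x)) ⟩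
      apply L (λ x → u * P x + + p * (V x * P x))
        ≡⟨ apply-+ L (λ x → u * P x) (λ x → + p * (V x * P x)) ⟩
      apply L (λ x → u * P x) + apply L (λ x → + p * (V x * P x))
        ≡⟨ cong₂ _+_ (apply-* L u P) (apply-* L (+ p) (λ x → V x * P x)) ⟩
      u * apply L P + + p * apply L (λ x → V x * P x) ∎

  module _ (β : ℕ) where
    private
      q = p ^ β
      instance
        q≢0 : NonZero q
        q≢0 = p^≢0 β

      0<q : 0 ℕ.< q
      0<q = ℕ.>-nonZero⁻¹ q

      q-1<q : q ∸ 1 ℕ.< q
      q-1<q = ℕP.∸-monoʳ-< {q} (s≤s z≤n) 0<q

      1+[q-1]≡q : suc (q ∸ 1) ≡ q
      1+[q-1]≡q = ℕP.suc-pred q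

      neg-poly : IsPoly (λ x → -1ℤ * x)
      neg-poly = mul (const -1ℤ) ident

    -- The sum of C(n,k) (-1)^k w(x) P(x) over k = r + q x, as a functional of P alone; w holds the
    -- factors that stay fixed while P varies.
    weighted : ℕ → ℤ → (ℤ → ℤ) → Functional
    weighted n r w = record
      { apply   = λ P → δ n (spread q r (λ x → w x * P x))
      ; apply-≗ = λ f≗g → D^-cong n (spread-cong q r (λ x → cong (w x *_) (f≗g x))) 0ℤ
      ; apply-+ = λ f g → trans (D^-cong n (λ j → trans (spread-cong q r (λ x → ℤP.*-distribˡ-+ (w x) (f x) (g x)) j)
          (spread-+ q r (λ x → w x * f x) (λ x → w x * g x) j)) 0ℤ) (D^-+ n _ _ 0ℤ)
      ; apply-* = λ k f → trans (D^-cong n (λ j → trans (spread-cong q r (λ x → swap (w x) k (f x)) j)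
          (spread-scale q r k (λ x → w x * f x) j)) 0ℤ) (D^-* n k _ 0ℤ)
      }
      where
      swap : ∀ w k f → w * (k * f) ≡ k * (w * f)
      swap = solve-∀

    -- Induction on N. All periodic w are treated together because the step from N to N + 1 uses the
    -- case N for the translate w(x + 1).
    central : ∀ N {w} → Periodic p w → ∀ {P} → IsPoly P → p^ (v N) ∣ apply (weighted (q ℕ.* N) 0ℤ w) P
    central zero    {w} per {P} _ = subst (λ e → p^ e ∣ L) (sym v-0) (divides L (sym (ℤP.*-identityʳ L)))
      where L = apply (weighted (q ℕ.* 0) 0ℤ w) P
    central (suc N) {w} per P-poly with poly-horner P-poly
    ... | c , Q , Q-poly , P≗ = subst (p^ (v (suc N)) ∣_) (sym split)
      (ℤ∣.∣m∣n⇒∣m+n (ℤ∣.∣n⇒∣m*n c constant-part) (good-cancel g Lξ (v (suc N)) reduced Q-poly))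
      where
      open ≡-Reasoning
      n = q ℕ.* suc N
      L = weighted n 0ℤ w
      -- The factor -x joins the weight, so that the bound for this functional can be claimed for
      -- every polynomial, as `good-cancel` requires.
      Lξ = weighted n 0ℤ (λ x → w x * - x)

      split : apply L _ ≡ c * δ n (spread q 0ℤ w) + apply Lξ Q
      split = begin
        apply L _                                        ≡⟨ apply-≗ L P≗ ⟩
        apply L (λ x → c + - x * Q x)                    ≡⟨ apply-+ L (λ _ → c) (λ x → - x * Q x) ⟩
        apply L (λ _ → c) + apply L (λ x → - x * Q x)
          ≡⟨ cong₂ _+_
               (trans (D^-cong n (λ j → trans (spread-cong q 0ℤ (λ x → ℤP.*-comm (w x) c) j) (spread-scale q 0ℤ c w j)) 0ℤ)
                 (D^-* n c (spread q 0ℤ w) 0ℤ))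
               (D^-cong n (spread-cong q 0ℤ (λ x → sym (ℤP.*-assoc (w x) (- x) (Q x)))) 0ℤ) ⟩
        c * δ n (spread q 0ℤ w) + apply Lξ Q             ∎

      constant-part : p^ (v (suc N)) ∣ δ n (spread q 0ℤ w)
      constant-part = periodic-δ p-prime β (v (suc N))
        (subst (λ m → Periodic m (spread q 0ℤ w)) (ℕP.*-comm q p) (spread-periodic q 0ℤ per))
        -- Strictness of `v-bound` supplies the 1 in 1 + v(N+1)(p-1) ≤ N + 1.
        (ℕP.*-monoʳ-≤ q (v-bound (suc N) (s≤s z≤n)))

      r-1 = good-rise β (q ∸ 1) q-1<q
      e = v (q ∸ 1)
      -- By `φ≡rise` the remaining factors of φ_q(q x) are -q x + i with 0 < i < q, hence the
      -- substitution of -x.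
      g = good-∘ r-1 neg-poly

      -- Multiplied by q p^e, the weight -x `unitPart g x` is φ_q(q x). Absorbing it produces `rise`
      -- at q N of length q, which is q p^e (N+1) times a unit part. The same q p^e cancels, and N +
      -- 1 times the case N is left for `v-suc`.
      reduced : ∀ {P} → IsPoly P → p^ (v (suc N)) ∣ apply Lξ (λ x → unitPart g x * P x)
      reduced {P} P-poly = ℤ∣.*-cancelˡ-∣ (p^ e) {{p^≢0 e}}
        (ℤ∣.*-cancelˡ-∣ (+ q) (subst (+ q * (p^ e * p^ (v (suc N))) ∣_) (sym identity)
          (ℤ∣.*-monoʳ-∣ (+ q) (ℤ∣.*-monoʳ-∣ (p^ e) (ℤ∣.∣n⇒∣m*n (unitPart r-1 (+ N))
            (v-suc {N} (central N (λ x → trans (cong w (swap x 1ℤ)) (per (x + 1ℤ))) (poly-∘ P-poly (add ident (const 1ℤ))))))))))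
        where
        swap : ∀ x k → x + + p + k ≡ x + k + + p
        swap = swap′ (+ p)
          where
          swap′ : ∀ p x k → x + p + k ≡ x + k + p
          swap′ = solve-∀
        LN = apply (weighted (q ℕ.* N) 0ℤ (λ x → w (x + 1ℤ))) (λ x → P (x + 1ℤ))

        φ-on : ∀ x → φ q (0ℤ + + q * x) ≡ + q * (p^ e * (- x * unitPart g x))
        φ-on x = begin
          φ q (0ℤ + + q * x)
            ≡⟨ cong₂ φ (sym 1+[q-1]≡q) (ℤP.+-identityˡ (+ q * x)) ⟩
          φ (suc (q ∸ 1)) (+ q * x)
            ≡⟨ φ≡rise (q ∸ 1) (+ q * x) ⟩
          - (+ q * x) * rise (- (+ q * x)) (q ∸ 1)
            ≡⟨ cong (λ y → - (+ q * x) * rise y (q ∸ 1)) (negate (+ q) x) ⟩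
          - (+ q * x) * rise (+ q * (-1ℤ * x)) (q ∸ 1)
            ≡⟨ cong (- (+ q * x) *_) (Good.shape g x) ⟩
          - (+ q * x) * (p^ e * unitPart g x)
            ≡⟨ regroup (+ q) x (p^ e) (unitPart g x) ⟩
          + q * (p^ e * (- x * unitPart g x)) ∎
          where
          negate : ∀ q x → - (q * x) ≡ q * (-1ℤ * x)
          negate = solve-∀
          regroup : ∀ q x P U → - (q * x) * (P * U) ≡ q * (P * (- x * U))
          regroup = solve-∀

        n≡ : n ≡ q ℕ.+ q ℕ.* N
        n≡ = ℕP.*-suc q N

        rise-q : rise (+ (q ℕ.* N)) q ≡ + q * (p^ e * (unitPart r-1 (+ N) * + suc N))
        rise-q = begin
          rise (+ (q ℕ.* N)) q
            ≡⟨ cong₂ rise (ℤP.pos-* q N) (sym 1+[q-1]≡q) ⟩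
          (+ q * + N + + suc (q ∸ 1)) * rise (+ q * + N) (q ∸ 1)
            ≡⟨ cong₂ (λ s t → (+ q * + N + + s) * t) 1+[q-1]≡q (Good.shape r-1 (+ N)) ⟩
          (+ q * + N + + q) * (p^ e * unitPart r-1 (+ N))
            ≡⟨ regroup (+ q) (+ N) (p^ e) (unitPart r-1 (+ N)) ⟩
          + q * (p^ e * (unitPart r-1 (+ N) * (1ℤ + + N))) ∎
          where
          regroup : ∀ q N P U → (q * N + q) * (P * U) ≡ q * (P * (U * (1ℤ + N)))
          regroup = solve-∀

        identity : + q * (p^ e * apply Lξ (λ x → unitPart g x * P x)) ≡
          + q * (p^ e * (unitPart r-1 (+ N) * (+ suc N * LN)))
        identity = begin
          + q * (p^ e * apply Lξ (λ x → unitPart g x * P x))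
            ≡⟨ ℤP.*-assoc (+ q) (p^ e) _ ⟨
          + q * p^ e * apply Lξ (λ x → unitPart g x * P x)
            ≡⟨ apply-* Lξ (+ q * p^ e) (λ x → unitPart g x * P x) ⟨
          apply Lξ (λ x → + q * p^ e * (unitPart g x * P x))
            ≡⟨ D^-cong n (λ j → trans (spread-cong q 0ℤ (λ x → trans (regroup (w x) x (+ q) (p^ e) (unitPart g x) (P x))
                 (cong (_* (w x * P x)) (sym (φ-on x)))) j)
                 (sym (spread-* q 0ℤ (φ q) (λ x → w x * P x) j))) 0ℤ ⟩
          δ n (λ j → φ q j * spread q 0ℤ (λ x → w x * P x) j)
            ≡⟨ cong (λ m → δ m (λ j → φ q j * spread q 0ℤ (λ x → w x * P x) j)) n≡ ⟩
          δ (q ℕ.+ q ℕ.* N) (λ j → φ q j * spread q 0ℤ (λ x → w x * P x) j)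
            ≡⟨ δ-φ q (q ℕ.* N) (spread q 0ℤ (λ x → w x * P x)) ⟩
          rise (+ (q ℕ.* N)) q * δ (q ℕ.* N) (λ j → spread q 0ℤ (λ x → w x * P x) (j + + q))
            ≡⟨ cong₂ _*_ rise-q (D^-cong (q ℕ.* N) (λ j →
                 trans (cong (λ y → spread q 0ℤ (λ x → w x * P x) (j + y)) (sym (ℤP.*-identityʳ (+ q))))
                   (spread-step q 0ℤ (λ x → w x * P x) 1ℤ j)) 0ℤ) ⟩
          + q * (p^ e * (unitPart r-1 (+ N) * + suc N)) * LN
            ≡⟨ assoc (+ q) (p^ e) (unitPart r-1 (+ N)) (+ suc N) LN ⟩
          + q * (p^ e * (unitPart r-1 (+ N) * (+ suc N * LN))) ∎
          where
          regroup : ∀ w x q E U P → w * - x * (q * E * (U * P)) ≡ q * (E * (- x * U)) * (w * P)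
          regroup = solve-∀
          assoc : ∀ q E U N L → q * (E * (U * N)) * L ≡ q * (E * (U * (N * L)))
          assoc = solve-∀

    -- For m < 2q the product rise (q N′) m carries at most one factor divisible by q, namely q (N′ + 1).
    rise-multiple : ∀ N′ m {N z} → m ℕ.< q ℕ.+ q → (m ℕ.+ q ℕ.* N′) ℕ./ q ≡ N → p^ (v N′) ∣ z →
      p^ (v N ℕ.+ v m) ∣ rise (+ q * + N′) m * z
    rise-multiple N′ m {N} {z} m<2q N≡ d with m ℕP.<? q
    ... | yes m<q = subst (λ e → p^ e ∣ rise (+ q * + N′) m * z)
        (trans (ℕP.+-comm (v m) (v N′)) (cong (λ M → v M ℕ.+ v m) N′≡N))
        (p^∣-* {v m} {v N′} (exact-∣ (good-exact (good-rise β m m<q) (+ N′))) d)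
      where
      open ≡-Reasoning
      N′≡N : N′ ≡ N
      N′≡N = sym (begin
        N                                ≡⟨ N≡ ⟨
        (m ℕ.+ q ℕ.* N′) ℕ./ q           ≡⟨ ℕDM.+-distrib-/-∣ʳ m (ℕ∣.m∣m*n N′) ⟩
        m ℕ./ q ℕ.+ q ℕ.* N′ ℕ./ q       ≡⟨ cong₂ ℕ._+_ (ℕDM.m<n⇒m/n≡0 m<q) (trans (cong (ℕ._/ q) (ℕP.*-comm q N′)) (ℕDM.m*n/n≡m N′ q)) ⟩
        N′                               ∎)
    ... | no m≮q = subst₂ (λ M y → p^ (v M ℕ.+ v m) ∣ y) suc-N′≡N (begin
        rest (+ N′) * (+ suc N′ * z)     ≡⟨ ℤP.*-assoc (rest (+ N′)) (+ suc N′) z ⟨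
        rest (+ N′) * + suc N′ * z       ≡⟨ cong (_* z) (rise≡ (+ N′)) ⟨
        rise (+ q * + N′) m * z          ∎)
        (subst (λ e → p^ e ∣ rest (+ N′) * (+ suc N′ * z))
          (trans (ℕP.+-comm (E) (v (suc N′))) (cong (v (suc N′) ℕ.+_) (sym v-m≡)))
          (p^∣-* {E} {v (suc N′)} (exact-∣ (rest-exact (+ N′))) (v-suc {N′} d)))
      where
      open ≡-Reasoning
      m₀ = m ∸ q
      m≡ : m₀ ℕ.+ q ≡ m
      m≡ = ℕP.m∸n+n≡m (ℕP.≮⇒≥ m≮q)
      m₀<q : m₀ ℕ.< q
      m₀<q = ℕP.+-cancelʳ-< q m₀ q (subst (ℕ._< q ℕ.+ q) (sym m≡) m<2q)
      E = v m₀ ℕ.+ (β ℕ.+ v (q ∸ 1))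

      rest : ℤ → ℤ
      rest x = rise (+ q * (x + 1ℤ)) m₀ * (+ q * rise (+ q * x) (q ∸ 1))

      rest-exact : ∀ x → Exact E (rest x)
      rest-exact x = exact-* (good-exact (good-rise β m₀ m₀<q) (x + 1ℤ))
        (exact-* (exact-p^ β) (good-exact (good-rise β (q ∸ 1) q-1<q) x))

      rise≡ : ∀ x → rise (+ q * x) m ≡ rest x * (1ℤ + x)
      rise≡ x = begin
        rise (+ q * x) m
          ≡⟨ cong (rise (+ q * x)) m≡ ⟨
        rise (+ q * x) (m₀ ℕ.+ q)
          ≡⟨ rise-+ (+ q * x) m₀ q ⟩
        rise (+ q * x + + q) m₀ * rise (+ q * x) q
          ≡⟨ cong₂ _*_ (cong (λ y → rise y m₀) (factor (+ q) x)) (cong (rise (+ q * x)) (sym 1+[q-1]≡q)) ⟩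
        rise (+ q * (x + 1ℤ)) m₀ * ((+ q * x + + suc (q ∸ 1)) * rise (+ q * x) (q ∸ 1))
          ≡⟨ cong (λ k → rise (+ q * (x + 1ℤ)) m₀ * ((+ q * x + + k) * rise (+ q * x) (q ∸ 1))) 1+[q-1]≡q ⟩
        rise (+ q * (x + 1ℤ)) m₀ * ((+ q * x + + q) * rise (+ q * x) (q ∸ 1))
          ≡⟨ regroup (rise (+ q * (x + 1ℤ)) m₀) (+ q) x (rise (+ q * x) (q ∸ 1)) ⟩
        rest x * (1ℤ + x) ∎
        where
        factor : ∀ q x → q * x + q ≡ q * (x + 1ℤ)
        factor = solve-∀
        regroup : ∀ s q x t → s * ((q * x + q) * t) ≡ s * (q * t) * (1ℤ + x)
        regroup = solve-∀

      -- The order E of `rest x` does not depend on x, and at x = 0 the product `rest x` (1 + x) is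
      -- m!.
      v-m≡ : v m ≡ E
      v-m≡ = v-unique m (subst (Exact E)
        (trans (sym (ℤP.*-identityʳ (rest 0ℤ))) (trans (sym (rise≡ 0ℤ))
          (trans (cong (λ y → rise y m) (ℤP.*-zeroʳ (+ q))) (rise-0 m))))
        (rest-exact 0ℤ))

      suc-N′≡N : suc N′ ≡ N
      suc-N′≡N = sym (begin
        N                                         ≡⟨ N≡ ⟨
        (m ℕ.+ q ℕ.* N′) ℕ./ q                    ≡⟨ cong (ℕ._/ q) (trans (cong (ℕ._+ q ℕ.* N′) (sym m≡)) (regroup m₀ q N′)) ⟩
        (m₀ ℕ.+ suc N′ ℕ.* q) ℕ./ q               ≡⟨ ℕDM.+-distrib-/-∣ʳ m₀ (ℕ∣.n∣m*n (suc N′)) ⟩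
        m₀ ℕ./ q ℕ.+ suc N′ ℕ.* q ℕ./ q           ≡⟨ cong₂ ℕ._+_ (ℕDM.m<n⇒m/n≡0 m₀<q) (ℕDM.m*n/n≡m (suc N′) q) ⟩
        suc N′                                    ∎)
        where
        regroup : ∀ m q N → m ℕ.+ q ℕ.+ q ℕ.* N ≡ m ℕ.+ (1 ℕ.+ N) ℕ.* q
        regroup = ℕSolver.solve-∀

    -- General residues: the last digits and their carries

    module _ {r s} (r<q : r ℕ.< q) (s<q : s ℕ.< q) {w} (w-periodic : Periodic p w) where

      -- The factors k, ..., k-r+1 and n-k, ..., n-k-s+1 reduce C(n,k) to C(M,k-r) with M = q N′. On
      -- the support they have order v r + v s, while the product obtained in exchange is `rise` at
      -- M of length r + s. By `kummer` the difference between v(r+s) and v r + v s is τ(r,s).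
      noncentral : ∀ N′ {n} → n ≡ r ℕ.+ (s ℕ.+ q ℕ.* N′) → ∀ {P} → IsPoly P →
        p^ (v (n ℕ./ q) ℕ.+ τ r s) ∣ apply (weighted n (+ r) w) P
      noncentral N′ {n} refl = good-cancel g L (v N ℕ.+ τ r s) reduced
        where
        open ≡-Reasoning
        M = q ℕ.* N′
        N = n ℕ./ q
        L = weighted n (+ r) w
        g-r = good-rise β r r<q
        g-s = good-∘ (good-rise β s s<q) (add (const (+ N′)) (mul (const -1ℤ) ident))
        g = good-* g-r g-s
        E = v r ℕ.+ v s

        reduced : ∀ {P} → IsPoly P → p^ (v N ℕ.+ τ r s) ∣ apply L (λ x → unitPart g x * P x)
        reduced {P} P-poly = unit-cancel (v N ℕ.+ τ r s) unit-sgn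
          (ℤ∣.*-cancelˡ-∣ (p^ E) {{p^≢0 E}} (subst₂ _∣_ power identity
            (rise-multiple N′ (r ℕ.+ s) {N} (ℕP.+-mono-< r<q s<q) (cong (ℕ._/ q) (ℕP.+-assoc r s M))
              (central N′ w-periodic P-poly))))
          where
          LM = apply (weighted M 0ℤ w) P
          Z = apply L (λ x → unitPart g x * P x)

          unit-sgn : Unit (sgn r)
          unit-sgn d = unit-1 (subst (+ p ∣_) (sgn*sgn r) (ℤ∣.∣m⇒∣m*n (sgn r) d))

          power : p^ (v N ℕ.+ v (r ℕ.+ s)) ≡ p^ E * p^ (v N ℕ.+ τ r s)
          power = trans (cong p^ (trans (cong (v N ℕ.+_) (kummer r s)) (shuffle (v N) E (τ r s))))
            (p^-+ E (v N ℕ.+ τ r s))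
            where
            shuffle : ∀ a b c → a ℕ.+ (b ℕ.+ c) ≡ b ℕ.+ (a ℕ.+ c)
            shuffle = ℕSolver.solve-∀

          a = spread q (+ r) (λ x → w x * P x)

          on : ∀ x → φ r (+ r + + q * x) * (rise (+ M + + r - (+ r + + q * x)) s * (w x * P x)) ≡
            p^ E * sgn r * (w x * (unitPart g x * P x))
          on x = begin
            φ r (+ r + + q * x) * (rise (+ M + + r - (+ r + + q * x)) s * (w x * P x))
              ≡⟨ cong₂ (λ y z → y * (rise z s * (w x * P x))) (φ-shifted r (+ q * x))
                   (trans (cong (λ m → m + + r - (+ r + + q * x)) (ℤP.pos-* q N′)) (collect (+ q) (+ N′) (+ r) x)) ⟩
            sgn r * rise (+ q * x) r * (rise (+ q * (+ N′ + -1ℤ * x)) s * (w x * P x))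
              ≡⟨ regroup (sgn r) (rise (+ q * x) r) (rise (+ q * (+ N′ + -1ℤ * x)) s) (w x) (P x) ⟩
            sgn r * (rise (+ q * x) r * rise (+ q * (+ N′ + -1ℤ * x)) s) * (w x * P x)
              ≡⟨ cong (λ y → sgn r * y * (w x * P x)) (Good.shape g x) ⟩
            sgn r * (p^ E * unitPart g x) * (w x * P x)
              ≡⟨ regroup′ (sgn r) (p^ E) (unitPart g x) (w x) (P x) ⟩
            p^ E * sgn r * (w x * (unitPart g x * P x)) ∎
            where
            collect : ∀ q N r x → q * N + r - (r + q * x) ≡ q * (N + -1ℤ * x)
            collect = solve-∀
            regroup : ∀ s t u w P → s * t * (u * (w * P)) ≡ s * (t * u) * (w * P)
            regroup = solve-∀
            regroup′ : ∀ s E U w P → s * (E * U) * (w * P) ≡ E * s * (w * (U * P))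
            regroup′ = solve-∀

          identity : rise (+ q * + N′) (r ℕ.+ s) * LM ≡ p^ E * (sgn r * Z)
          identity = begin
            rise (+ q * + N′) (r ℕ.+ s) * LM
              ≡⟨ cong (λ y → rise y (r ℕ.+ s) * LM) (ℤP.pos-* q N′) ⟨
            rise (+ M) (r ℕ.+ s) * LM
              ≡⟨ cong (_* LM) (trans (rise-+ (+ M) r s) (cong (λ y → rise y r * rise (+ M) s) (cong +_ (ℕP.+-comm M s)))) ⟩
            rise (+ (s ℕ.+ M)) r * rise (+ M) s * LM
              ≡⟨ ℤP.*-assoc (rise (+ (s ℕ.+ M)) r) (rise (+ M) s) LM ⟩
            rise (+ (s ℕ.+ M)) r * (rise (+ M) s * LM)
              ≡⟨ cong (rise (+ (s ℕ.+ M)) r *_) (δ-rise s M (spread q 0ℤ (λ x → w x * P x))) ⟨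
            rise (+ (s ℕ.+ M)) r * δ (s ℕ.+ M) (λ j → rise (+ M - j) s * spread q 0ℤ (λ x → w x * P x) j)
              ≡⟨ cong (rise (+ (s ℕ.+ M)) r *_) (D^-cong (s ℕ.+ M) (λ j → cong₂ (λ y z → rise y s * z)
                   (cancel (+ M) (+ r) j) (trans (sym (spread-translate q 0ℤ _ (+ r) j))
                     (cong (λ y → spread q y (λ x → w x * P x) (j + + r)) (ℤP.+-identityˡ (+ r))))) 0ℤ) ⟩
            rise (+ (s ℕ.+ M)) r * δ (s ℕ.+ M) (λ j → rise (+ M + + r - (j + + r)) s * a (j + + r))
              ≡⟨ δ-φ r (s ℕ.+ M) (λ j → rise (+ M + + r - j) s * a j) ⟨
            δ n (λ j → φ r j * (rise (+ M + + r - j) s * a j))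
              ≡⟨ D^-cong n (λ j → trans (cong (φ r j *_) (spread-* q (+ r) (λ j → rise (+ M + + r - j) s) _ j))
                   (trans (spread-* q (+ r) (φ r) _ j) (spread-cong q (+ r) on j))) 0ℤ ⟩
            δ n (spread q (+ r) (λ x → p^ E * sgn r * (w x * (unitPart g x * P x))))
              ≡⟨ D^-cong n (spread-scale q (+ r) (p^ E * sgn r) _) 0ℤ ⟩
            δ n (λ j → p^ E * sgn r * spread q (+ r) (λ x → w x * (unitPart g x * P x)) j)
              ≡⟨ D^-* n (p^ E * sgn r) _ 0ℤ ⟩
            p^ E * sgn r * Z
              ≡⟨ ℤP.*-assoc (p^ E) (sgn r) Z ⟩
            p^ E * (sgn r * Z) ∎
            where
            cancel : ∀ M r j → M - j ≡ M + r - (j + r)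
            cancel = solve-∀

      core : ∀ n → + q ∣ + n - (+ r + + s) → ∀ {P} → IsPoly P →
        p^ (v (n ℕ./ q) ℕ.+ τ r s) ∣ δ n (spread q (+ r) (λ x → w x * P x))
      core n q∣ {P} P-poly with (r ℕ.+ s) ℕP.≤? n
      ... | yes r+s≤n = noncentral (quotient′) n≡ P-poly
        where
        q∣n-[r+s] : q ℕ∣.∣ n ∸ (r ℕ.+ s)
        q∣n-[r+s] = subst (q ℕ∣.∣_) (cong ℤ.∣_∣ (trans (ℤP.m-n≡m⊖n n (r ℕ.+ s)) (ℤP.⊖-≥ r+s≤n))) (ℤ∣.∣⇒∣ᵤ q∣)
        quotient′ = ℕ∣._∣_.quotient q∣n-[r+s]
        n≡ : n ≡ r ℕ.+ (s ℕ.+ q ℕ.* quotient′)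
        n≡ = trans (sym (ℕP.m+[n∸m]≡n r+s≤n)) (trans (cong (r ℕ.+ s ℕ.+_)
          (trans (ℕ∣._∣_.equality q∣n-[r+s]) (ℕP.*-comm quotient′ q))) (ℕP.+-assoc r s _))
      -- Now r + s - n is a positive multiple of q, so n ≤ r + s - q < r. As r < q, no k ≤ n lies in
      -- the class of r modulo q and the sum is empty.
      ... | no r+s≰n = subst (p^ (v (n ℕ./ q) ℕ.+ τ r s) ∣_) (sym (D^-vanish n a 0ℤ vanish)) (divides 0ℤ refl)
        where
        a = spread q (+ r) (λ x → w x * P x)
        n<r+s = ℕP.≰⇒> r+s≰n
        q∣[r+s]-n : q ℕ∣.∣ r ℕ.+ s ∸ n
        q∣[r+s]-n = subst (q ℕ∣.∣_) (trans (cong ℤ.∣_∣ (ℤP.m-n≡m⊖n n (r ℕ.+ s))) (ℤP.∣⊖∣-≤ (ℕP.<⇒≤ n<r+s))) (ℤ∣.∣⇒∣ᵤ q∣)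
        n<r : n ℕ.< r
        n<r = ℕP.+-cancelʳ-< s n r (begin-strict
          n ℕ.+ s                  <⟨ ℕP.+-monoʳ-< n s<q ⟩
          n ℕ.+ q                  ≤⟨ ℕP.+-monoʳ-≤ n (ℕ∣.∣⇒≤ {{ℕ.>-nonZero (ℕP.m<n⇒0<n∸m n<r+s)}} q∣[r+s]-n) ⟩
          n ℕ.+ (r ℕ.+ s ∸ n)      ≡⟨ ℕP.m+[n∸m]≡n (ℕP.<⇒≤ n<r+s) ⟩
          r ℕ.+ s                  ∎)
          where open ℕP.≤-Reasoning
        vanish : ∀ j → j ℕ.≤ n → a (0ℤ + + j) ≡ 0ℤ
        vanish j j≤n = spread-off q (+ r) _ (0ℤ + + j) λ d →
          ℕP.<⇒≱ (ℕP.≤-<-trans (ℕP.m∸n≤m r j) r<q)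
            (ℕ∣.∣⇒≤ {{ℕ.>-nonZero (ℕP.m<n⇒0<n∸m j<r)}}
              (subst (q ℕ∣.∣_) (trans (cong ℤ.∣_∣ (ℤP.m-n≡m⊖n j r)) (ℤP.∣⊖∣-≤ (ℕP.<⇒≤ j<r))) (ℤ∣.∣⇒∣ᵤ d)))
          where
          j<r = ℕP.≤-<-trans j≤n n<r

-- Integer-valued polynomials

D-injective : ∀ a b → a 0ℤ ≡ b 0ℤ → D a ≗ D b → a ≗ b
D-injective a b a0≡b0 Da≗Db = go
  where
  open ≡-Reasoning
  recover : ∀ s t → s ≡ s - t + t
  recover = solve-∀
  recover′ : ∀ s t → t ≡ s - (s - t)
  recover′ = solve-∀
  below : ∀ x → a (x + 1ℤ) ≡ b (x + 1ℤ) → a x ≡ b x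
  below x eq = begin
    a x                        ≡⟨ recover (a x) (a (x + 1ℤ)) ⟩
    D a x + a (x + 1ℤ)         ≡⟨ cong₂ _+_ (Da≗Db x) eq ⟩
    D b x + b (x + 1ℤ)         ≡⟨ recover (b x) (b (x + 1ℤ)) ⟨
    b x                        ∎
  above : ∀ x → a x ≡ b x → a (x + 1ℤ) ≡ b (x + 1ℤ)
  above x eq = begin
    a (x + 1ℤ)                 ≡⟨ recover′ (a x) (a (x + 1ℤ)) ⟩
    a x - D a x                ≡⟨ cong₂ _-_ eq (Da≗Db x) ⟩
    b x - D b x                ≡⟨ recover′ (b x) (b (x + 1ℤ)) ⟨
    b (x + 1ℤ)                 ∎
  go : a ≗ b
  go (+ zero)       = a0≡b0
  go (+ suc n)      = subst (λ x → a x ≡ b x) (ℤP.+-comm (+ n) 1ℤ) (above (+ n) (go (+ n)))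
  go -[1+ zero ]    = below -1ℤ a0≡b0
  go -[1+ suc n ]   = below -[1+ suc n ] (go -[1+ n ])

D^-≗0 : ∀ n k {a} → (∀ x → D^ n a x ≡ 0ℤ) → ∀ x → D^ (k ℕ.+ n) a x ≡ 0ℤ
D^-≗0 n zero    D≡0 x = D≡0 x
D^-≗0 n (suc k) D≡0 x = cong₂ _-_ (D^-≗0 n k D≡0 x) (D^-≗0 n k D≡0 (x + 1ℤ))

D-φ : ∀ l x → D (φ (suc l)) x ≡ + suc l * φ l x
D-φ zero    x = base x
  where
  base : ∀ x → - x * 1ℤ - - (x + 1ℤ) * 1ℤ ≡ 1ℤ * 1ℤ
  base = solve-∀
D-φ (suc l) x = begin
  - x * φ (suc l) (x - 1ℤ) - - (x + 1ℤ) * φ (suc l) (x + 1ℤ - 1ℤ)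
    ≡⟨ cong₂ (λ s y → - x * s - - (x + 1ℤ) * φ (suc l) y) (recover (φ (suc l) (x - 1ℤ)) (φ (suc l) (x - 1ℤ + 1ℤ))) (shift₁ x) ⟩
  - x * (D (φ (suc l)) (x - 1ℤ) + φ (suc l) (x - 1ℤ + 1ℤ)) - - (x + 1ℤ) * φ (suc l) x
    ≡⟨ cong₂ (λ s y → - x * (s + φ (suc l) y) - - (x + 1ℤ) * φ (suc l) x) (D-φ l (x - 1ℤ)) (shift₂ x) ⟩
  - x * (+ suc l * φ l (x - 1ℤ) + φ (suc l) x) - - (x + 1ℤ) * φ (suc l) x
    ≡⟨ collect x (+ suc l) (φ l (x - 1ℤ)) (φ (suc l) x) ⟩
  + suc l * φ (suc l) x + φ (suc l) x
    ≡⟨ factor (+ suc l) (φ (suc l) x) ⟩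
  + suc (suc l) * φ (suc l) x ∎
  where
  open ≡-Reasoning
  recover : ∀ s t → s ≡ s - t + t
  recover = solve-∀
  shift₁ : ∀ x → x + 1ℤ - 1ℤ ≡ x
  shift₁ = solve-∀
  shift₂ : ∀ x → x - 1ℤ + 1ℤ ≡ x
  shift₂ = solve-∀
  collect : ∀ x k s t → - x * (k * s + t) - - (x + 1ℤ) * t ≡ k * (- x * s) + t
  collect = solve-∀
  factor : ∀ k t → k * t + t ≡ (1ℤ + k) * t
  factor = solve-∀

-- l! times the Newton interpolation of h at 0, …, l.
newtonSum : ℕ → (ℤ → ℤ) → ℤ → ℤ
newtonSum zero    h x = h 0ℤ
newtonSum (suc l) h x = + suc l * newtonSum l h x + D^ (suc l) h 0ℤ * φ (suc l) x

newtonSum-0 : ∀ l h → newtonSum l h 0ℤ ≡ + (l !) * h 0ℤ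
newtonSum-0 zero    h = sym (ℤP.*-identityˡ (h 0ℤ))
newtonSum-0 (suc l) h = trans (cong (λ s → + suc l * s + D^ (suc l) h 0ℤ * (0ℤ * φ l -1ℤ)) (newtonSum-0 l h))
  (trans (lemma (+ suc l) (+ (l !)) (h 0ℤ) (D^ (suc l) h 0ℤ) (φ l -1ℤ)) (cong (_* h 0ℤ) (sym (ℤP.pos-* (suc l) (l !)))))
  where
  lemma : ∀ k f h d t → k * (f * h) + d * (0ℤ * t) ≡ k * f * h
  lemma = solve-∀

-- D lowers the index of each φ, so differencing the interpolation of h gives that of D h; this
-- drives the induction in `newton`.
D-newtonSum : ∀ l h x → D (newtonSum (suc l) h) x ≡ + suc l * newtonSum l (D h) x
D-newtonSum l h x = begin
  D (newtonSum (suc l) h) x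
    ≡⟨ linear (+ suc l) (newtonSum l h x) (newtonSum l h (x + 1ℤ)) (D^ (suc l) h 0ℤ) (φ (suc l) x) (φ (suc l) (x + 1ℤ)) ⟩
  + suc l * D (newtonSum l h) x + D^ (suc l) h 0ℤ * D (φ (suc l)) x
    ≡⟨ cong₂ (λ s t → + suc l * D (newtonSum l h) x + s * t) (D^-suc l h 0ℤ) (D-φ l x) ⟩
  + suc l * D (newtonSum l h) x + D^ l (D h) 0ℤ * (+ suc l * φ l x)
    ≡⟨ factor (+ suc l) (D (newtonSum l h) x) (D^ l (D h) 0ℤ) (φ l x) ⟩
  + suc l * (D (newtonSum l h) x + D^ l (D h) 0ℤ * φ l x)
    ≡⟨ cong (+ suc l *_) (step l) ⟩
  + suc l * newtonSum l (D h) x ∎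
  where
  open ≡-Reasoning
  linear : ∀ k s s′ d t t′ → (k * s + d * t) - (k * s′ + d * t′) ≡ k * (s - s′) + d * (t - t′)
  linear = solve-∀
  factor : ∀ k s d t → k * s + d * (k * t) ≡ k * (s + d * t)
  factor = solve-∀
  step : ∀ l → D (newtonSum l h) x + D^ l (D h) 0ℤ * φ l x ≡ newtonSum l (D h) x
  step zero    = base (h 0ℤ) (D h 0ℤ)
    where
    base : ∀ s d → (s - s) + d * 1ℤ ≡ d
    base = solve-∀
  step (suc l) = cong (_+ D^ (suc l) (D h) 0ℤ * φ (suc l) x) (D-newtonSum l h x)

-- Both sides agree at 0 and, by induction, have equal differences. The hypothesis is on differences
-- because h will be a mere function on ℤ without integer coefficients.
newton : ∀ l h → (∀ x → D^ (suc l) h x ≡ 0ℤ) → ∀ x → + (l !) * h x ≡ newtonSum l h x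
newton zero h Dh≡0 = D-injective _ _ (ℤP.*-identityˡ (h 0ℤ)) λ x →
  trans (lemma (h x) (h (x + 1ℤ))) (trans (Dh≡0 x) (sym (ℤP.+-inverseʳ (h 0ℤ))))
  where
  lemma : ∀ s t → 1ℤ * s - 1ℤ * t ≡ s - t
  lemma = solve-∀
newton (suc l) h D^h≡0 = D-injective _ _ (sym (newtonSum-0 (suc l) h)) λ x → begin
  + (suc l !) * h x - + (suc l !) * h (x + 1ℤ)
    ≡⟨ cong (λ f → f * h x - f * h (x + 1ℤ)) (ℤP.pos-* (suc l) (l !)) ⟩
  + suc l * + (l !) * h x - + suc l * + (l !) * h (x + 1ℤ)
    ≡⟨ factor (+ suc l) (+ (l !)) (h x) (h (x + 1ℤ)) ⟩
  + suc l * (+ (l !) * D h x)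
    ≡⟨ cong (+ suc l *_) (newton l (D h) (λ y → trans (sym (D^-suc (suc l) h y)) (D^h≡0 y)) x) ⟩
  + suc l * newtonSum l (D h) x
    ≡⟨ D-newtonSum l h x ⟨
  D (newtonSum (suc l) h) x ∎
  where
  open ≡-Reasoning
  factor : ∀ k f s t → k * f * s - k * f * t ≡ k * (f * (s - t))
  factor = solve-∀

-- Each of the l linear factors takes one k, since k (x - i) = k x - k i. With k = p it expresses
-- p^l φ_l in terms of p x = ⌊k/q⌋ - r′.
φ-homogenised : ∀ k l → ∃[ Q ] IsPoly Q × (∀ x → + (k ^ l) * φ l x ≡ Q (+ k * x))
φ-homogenised k zero    = _ , const 1ℤ , λ _ → refl
φ-homogenised k (suc l) with φ-homogenised k l
... | Q , Q-poly , Q≡ = (λ y → -1ℤ * y * Q (y + - + k)) ,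
  mul (mul (const -1ℤ) ident) (poly-∘ Q-poly (add ident (const (- + k)))) , λ x → begin
    + (k ^ suc l) * (- x * φ l (x - 1ℤ))            ≡⟨ cong (_* (- x * φ l (x - 1ℤ))) (ℤP.pos-* k (k ^ l)) ⟩
    + k * + (k ^ l) * (- x * φ l (x - 1ℤ))          ≡⟨ regroup (+ k) (+ (k ^ l)) x (φ l (x - 1ℤ)) ⟩
    -1ℤ * (+ k * x) * (+ (k ^ l) * φ l (x - 1ℤ))    ≡⟨ cong (-1ℤ * (+ k * x) *_) (Q≡ (x - 1ℤ)) ⟩
    -1ℤ * (+ k * x) * Q (+ k * (x - 1ℤ))            ≡⟨ cong (λ y → -1ℤ * (+ k * x) * Q y) (expand (+ k) x) ⟩
    -1ℤ * (+ k * x) * Q (+ k * x + - + k)           ∎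
  where
  open ≡-Reasoning
  regroup : ∀ k K x t → k * K * (- x * t) ≡ -1ℤ * (k * x) * (K * t)
  regroup = solve-∀
  expand : ∀ k x → k * (x - 1ℤ) ≡ k * x + - k
  expand = solve-∀

newtonSum-homogenised : ∀ k l h → ∃[ Q ] IsPoly Q × (∀ x → + (k ^ l) * newtonSum l h x ≡ Q (+ k * x))
newtonSum-homogenised k zero    h = _ , const (h 0ℤ) , λ _ → ℤP.*-identityˡ (h 0ℤ)
newtonSum-homogenised k (suc l) h with newtonSum-homogenised k l h | φ-homogenised k (suc l)
... | Q , Q-poly , Q≡ | Φ , Φ-poly , Φ≡ = _ ,
  add (mul (const (+ k * + suc l)) Q-poly) (mul (const (D^ (suc l) h 0ℤ)) Φ-poly) , λ x → begin
    + (k ^ suc l) * (+ suc l * newtonSum l h x + d * φ (suc l) x)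
      ≡⟨ ℤP.*-distribˡ-+ (+ (k ^ suc l)) (+ suc l * newtonSum l h x) (d * φ (suc l) x) ⟩
    + (k ^ suc l) * (+ suc l * newtonSum l h x) + + (k ^ suc l) * (d * φ (suc l) x)
      ≡⟨ cong₂ _+_ (trans (cong (_* (+ suc l * newtonSum l h x)) (ℤP.pos-* k (k ^ l)))
                     (regroup (+ k) (+ (k ^ l)) (+ suc l) (newtonSum l h x)))
                   (swap (+ (k ^ suc l)) d (φ (suc l) x)) ⟩
    + k * + suc l * (+ (k ^ l) * newtonSum l h x) + d * (+ (k ^ suc l) * φ (suc l) x)
      ≡⟨ cong₂ (λ s t → + k * + suc l * s + d * t) (Q≡ x) (Φ≡ x) ⟩
    + k * + suc l * Q (+ k * x) + d * Φ (+ k * x) ∎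
  where
  open ≡-Reasoning
  d = D^ (suc l) h 0ℤ
  regroup : ∀ k K l s → k * K * (l * s) ≡ k * l * (K * s)
  regroup = solve-∀
  swap : ∀ K d t → K * (d * t) ≡ d * (K * t)
  swap = solve-∀

-- The bound for integer-valued functions killed by D^(l+1)

module IntegerValued (p : ℕ) (p-prime : Prime p) where
  open Padic p p-prime
  open Valuation p p-prime
  open Core p p-prime

  v-mono : ∀ {m n} → m ℕ.≤ n → v m ℕ.≤ v n
  v-mono {m} {n} m≤n = exact-max (v-exact n) (ℤ∣.∣-trans (exact-∣ (v-exact m)) (ℤ∣.∣ᵤ⇒∣ (ℕ∣.m≤n⇒m!∣n! m≤n)))

  spread-sum-bound : ∀ α n r l {h} → (∀ x → D^ (suc l) h x ≡ 0ℤ) →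
    p^ (v ⌊ n /p^ α -1⌋ ℕ.+ τ ⟨ r ⟩[p^ α -1] ⟨ + n - r ⟩[p^ α -1])
      ∣ p^ (l ℕ.+ v l) * δ n (spread (p ^ α) r h)
  -- For α = 0 every k is allowed and the sum is D^n h at -r, which vanishes if n > l. If n ≤ l, the
  -- factor p^(l + v l) suffices alone: v(p n) = n + v n ≤ l + v l, and there are no carries.
  spread-sum-bound zero n r l {h} D^h≡0 with n ℕP.≤? l
  ... | yes n≤l = ℤ∣.∣m⇒∣m*n (δ n (spread 1 r h)) (p^-mono
    (subst (ℕ._≤ l ℕ.+ v l) (sym (trans (ℕP.+-identityʳ _) (v-p* n))) (ℕP.+-mono-≤ n≤l (v-mono n≤l))))
  ... | no  n≰l = ℤ∣.∣n⇒∣m*n (p^ (l ℕ.+ v l)) (subst (_ ∣_) (sym vanish) (divides 0ℤ refl))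
    where
    open ≡-Reasoning
    translate : spread 1 r h ≗ (λ j → h (j + - r))
    translate j = sym (spread-unique 1 r h (λ j → h (j + - r)) (λ x → cong h (cancel r x))
      (λ j ¬d → contradiction (divides (j - r) (sym (ℤP.*-identityʳ (j - r)))) ¬d) j)
      where
      cancel : ∀ r x → r + 1ℤ * x + - r ≡ x
      cancel = solve-∀
    vanish : δ n (spread 1 r h) ≡ 0ℤ
    vanish = begin
      δ n (spread 1 r h)               ≡⟨ D^-cong n translate 0ℤ ⟩
      δ n (λ j → h (j + - r))          ≡⟨ D^-shift n h (- r) 0ℤ ⟩
      D^ n h (0ℤ + - r)                ≡⟨ cong (λ m → D^ m h (0ℤ + - r)) (ℕP.m∸n+n≡m (ℕP.≰⇒> n≰l)) ⟨
      D^ (n ∸ suc l ℕ.+ suc l) h (0ℤ + - r) ≡⟨ D^-≗0 (suc l) (n ∸ suc l) D^h≡0 (0ℤ + - r) ⟩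
      0ℤ                               ∎
  spread-sum-bound (suc β) n r l {h} D^h≡0 with newtonSum-homogenised p l h
  ... | Q , Q-poly , Q≡ = unit-cancel e (cofactor-unit (v-exact l)) (subst (p^ e ∣_) scaled
      (core β (ℤDM.n%ℕd<d r q) (ℤDM.n%ℕd<d (+ n - r) q) w-periodic n q∣ (poly-∘ Q-poly (add ident (const (- r′))))))
    where
    open ≡-Reasoning
    q = p ^ β
    instance
      q≢0 : NonZero q
      q≢0 = p^≢0 β
    r₀ = r ℤDM.%ℕ q
    r′ = r ℤDM./ℕ q
    s₀ = (+ n - r) ℤDM.%ℕ q
    s′ = (+ n - r) ℤDM./ℕ q
    e = v (n ℕ./ q) ℕ.+ τ r₀ s₀
    u = cofactor (v-exact l)
    -- The indicator of y ≡ r′ (mod p) for y = ⌊k/q⌋. Where it is 1, y = r′ + p x and Q(y - r′) =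
    -- p^l l! h(x).
    w = spread p r′ (λ _ → 1ℤ)

    r≡ : r ≡ + r₀ + + q * r′
    r≡ = trans (ℤDM.a≡a%ℕn+[a/ℕn]*n r q) (cong (_+_ (+ r₀)) (ℤP.*-comm r′ (+ q)))

    q∣ : + q ∣ + n - (+ r₀ + + s₀)
    q∣ = divides (r′ + s′) (begin
      + n - (+ r₀ + + s₀)                                        ≡⟨ split (+ n) r (+ r₀) (+ s₀) ⟩
      (r - + r₀) + ((+ n - r) - + s₀)
        ≡⟨ cong₂ (λ x y → (x - + r₀) + (y - + s₀)) (ℤDM.a≡a%ℕn+[a/ℕn]*n r q) (ℤDM.a≡a%ℕn+[a/ℕn]*n (+ n - r) q) ⟩
      (+ r₀ + r′ * + q - + r₀) + (+ s₀ + s′ * + q - + s₀)        ≡⟨ collect (+ r₀) (+ s₀) r′ s′ (+ q) ⟩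
      (r′ + s′) * + q                                            ∎)
      where
      split : ∀ n r a b → n - (a + b) ≡ (r - a) + ((n - r) - b)
      split = solve-∀
      collect : ∀ a b r s q → (a + r * q - a) + (b + s * q - b) ≡ (r + s) * q
      collect = solve-∀

    w-periodic : Periodic p w
    w-periodic = subst (λ m → Periodic m w) (ℕP.*-identityʳ p) (spread-periodic p r′ {λ _ → 1ℤ} {1} (λ _ → refl))

    K = p^ l * + (l !)

    pointwise : ∀ y → w y * Q (y + - r′) ≡ K * spread p r′ h y
    pointwise y = begin
      w y * Q (y + - r′)                                    ≡⟨ ℤP.*-comm (w y) (Q (y + - r′)) ⟩
      Q (y + - r′) * w y                                    ≡⟨ spread-* p r′ (λ y → Q (y + - r′)) (λ _ → 1ℤ) y ⟩
      spread p r′ (λ x → Q (r′ + + p * x + - r′) * 1ℤ) y    ≡⟨ spread-cong p r′ value y ⟩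
      spread p r′ (λ x → K * h x) y                         ≡⟨ spread-scale p r′ K h y ⟩
      K * spread p r′ h y                                   ∎
      where
      cancel : ∀ r y → r + y + - r ≡ y
      cancel = solve-∀
      value : ∀ x → Q (r′ + + p * x + - r′) * 1ℤ ≡ K * h x
      value x = begin
        Q (r′ + + p * x + - r′) * 1ℤ   ≡⟨ ℤP.*-identityʳ _ ⟩
        Q (r′ + + p * x + - r′)        ≡⟨ cong Q (cancel r′ (+ p * x)) ⟩
        Q (+ p * x)                    ≡⟨ Q≡ x ⟨
        p^ l * newtonSum l h x         ≡⟨ cong (p^ l *_) (newton l h D^h≡0 x) ⟨
        p^ l * (+ (l !) * h x)         ≡⟨ ℤP.*-assoc (p^ l) (+ (l !)) (h x) ⟨
        K * h x                        ∎

    scaled : δ n (spread q (+ r₀) (λ y → w y * Q (y + - r′))) ≡ u * (p^ (l ℕ.+ v l) * δ n (spread (p ^ suc β) r h))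
    scaled = begin
      δ n (spread q (+ r₀) (λ y → w y * Q (y + - r′)))
        ≡⟨ D^-cong n (spread-cong q (+ r₀) pointwise) 0ℤ ⟩
      δ n (spread q (+ r₀) (λ y → K * spread p r′ h y))
        ≡⟨ D^-cong n (spread-scale q (+ r₀) K (spread p r′ h)) 0ℤ ⟩
      δ n (λ j → K * spread q (+ r₀) (spread p r′ h) j)
        ≡⟨ D^-* n K (spread q (+ r₀) (spread p r′ h)) 0ℤ ⟩
      K * δ n (spread q (+ r₀) (spread p r′ h))
        ≡⟨ cong (K *_) (D^-cong n (spread-spread q (+ r₀) p r′ h) 0ℤ) ⟩
      K * δ n (spread (q ℕ.* p) (+ r₀ + + q * r′) h)
        ≡⟨ cong₂ (λ m i → K * δ n (spread m i h)) (ℕP.*-comm q p) (sym r≡) ⟩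
      K * Z
        ≡⟨ cong (λ f → p^ l * f * Z) (factorization (v-exact l)) ⟩
      p^ l * (p^ (v l) * u) * Z
        ≡⟨ regroup (p^ l) (p^ (v l)) u Z ⟩
      u * (p^ l * p^ (v l) * Z)
        ≡⟨ cong (λ P → u * (P * Z)) (p^-+ l (v l)) ⟨
      u * (p^ (l ℕ.+ v l) * Z) ∎
      where
      Z = δ n (spread (p ^ suc β) r h)
      regroup : ∀ L P u Z → L * (P * u) * Z ≡ u * (L * P * Z)
      regroup = solve-∀

-- Passage to p-adic coefficients

sumᶻ : List ℤ → ℤ
sumᶻ = foldr _+_ 0ℤ

sumᶻ-last : ∀ f m → sumᶻ (applyUpTo f (suc m)) ≡ sumᶻ (applyUpTo f m) + f m
sumᶻ-last f zero    = ℤP.+-comm (f 0) 0ℤ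
sumᶻ-last f (suc m) = trans (cong (_+_ (f 0)) (sumᶻ-last (f ∘ suc) m)) (sym (ℤP.+-assoc (f 0) _ _))

sumᶻ-cong : ∀ {f g : ℕ → ℤ} → (∀ i → f i ≡ g i) → ∀ m → sumᶻ (applyUpTo f m) ≡ sumᶻ (applyUpTo g m)
sumᶻ-cong f≗g zero    = refl
sumᶻ-cong f≗g (suc m) = cong₂ _+_ (f≗g 0) (sumᶻ-cong (f≗g ∘ suc) m)

sumᶻ-- : ∀ (f g : ℕ → ℤ) m →
  sumᶻ (applyUpTo (λ i → f i - g i) m) ≡ sumᶻ (applyUpTo f m) - sumᶻ (applyUpTo g m)
sumᶻ-- f g zero    = refl
sumᶻ-- f g (suc m) = trans (cong (_+_ (f 0 - g 0)) (sumᶻ-- (f ∘ suc) (g ∘ suc) m))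
  (interchange (f 0) (g 0) _ _)
  where
  interchange : ∀ a b c d → (a - b) + (c - d) ≡ (a + c) - (b + d)
  interchange = solve-∀

binomialTerm : ℕ → (ℤ → ℤ) → ℤ → ℕ → ℤ
binomialTerm n a x k = + (n C k) * -1ℤ ℤ.^ k * a (x + + k)

D^-binomial : ∀ n a x → D^ n a x ≡ sumᶻ (applyUpTo (binomialTerm n a x) (suc n))
D^-binomial zero    a x = trans (cong a (sym (ℤP.+-identityʳ x))) (lemma (a (x + 0ℤ)))
  where
  lemma : ∀ s → s ≡ 1ℤ * 1ℤ * s + 0ℤ
  lemma = solve-∀
D^-binomial (suc n) a x = begin
  D^ n a x - D^ n a (x + 1ℤ)
    ≡⟨ cong₂ _-_ (D^-binomial n a x) (D^-binomial n a (x + 1ℤ)) ⟩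
  S (binomialTerm n a x) (suc n) - S (binomialTerm n a (x + 1ℤ)) (suc n)
    ≡⟨ cong (_- S (binomialTerm n a (x + 1ℤ)) (suc n)) extend ⟩
  (binomialTerm n a x 0 + S (binomialTerm n a x ∘ suc) (suc n)) - S (binomialTerm n a (x + 1ℤ)) (suc n)
    ≡⟨ ℤP.+-assoc (binomialTerm n a x 0) _ _ ⟩
  binomialTerm n a x 0 + (S (binomialTerm n a x ∘ suc) (suc n) - S (binomialTerm n a (x + 1ℤ)) (suc n))
    ≡⟨ cong (_+_ (binomialTerm n a x 0)) (sumᶻ-- (binomialTerm n a x ∘ suc) (binomialTerm n a (x + 1ℤ)) (suc n)) ⟨
  binomialTerm n a x 0 + S (λ k → binomialTerm n a x (suc k) - binomialTerm n a (x + 1ℤ) k) (suc n)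
    ≡⟨ cong (_+_ (binomialTerm n a x 0)) (sumᶻ-cong pascal (suc n)) ⟩
  binomialTerm (suc n) a x 0 + S (binomialTerm (suc n) a x ∘ suc) (suc n) ∎
  where
  open ≡-Reasoning
  S = λ (f : ℕ → ℤ) m → sumᶻ (applyUpTo f m)

  -- The added term has coefficient C(n,n+1) = 0; it aligns the two sums for Pascal's rule.
  extend : S (binomialTerm n a x) (suc n) ≡ S (binomialTerm n a x) (suc (suc n))
  extend = sym (trans (sumᶻ-last (binomialTerm n a x) (suc n))
    (trans (cong (λ c → S (binomialTerm n a x) (suc n) + + c * -1ℤ ℤ.^ suc n * a (x + + suc n)) (k>n⇒nCk≡0 (ℕP.n<1+n n)))
      (ℤP.+-identityʳ _)))

  pascal : ∀ k → binomialTerm n a x (suc k) - binomialTerm n a (x + 1ℤ) k ≡ binomialTerm (suc n) a x (suc k)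
  pascal k = begin
    + (n C suc k) * (-1ℤ * s) * a (x + + suc k) - + (n C k) * s * a (x + 1ℤ + + k)
      ≡⟨ cong (λ y → + (n C suc k) * (-1ℤ * s) * a (x + + suc k) - + (n C k) * s * a y) (ℤP.+-assoc x 1ℤ (+ k)) ⟩
    + (n C suc k) * (-1ℤ * s) * a (x + + suc k) - + (n C k) * s * a (x + + suc k)
      ≡⟨ collect (+ (n C suc k)) (+ (n C k)) s (a (x + + suc k)) ⟩
    + ((n C k) ℕ.+ (n C suc k)) * (-1ℤ * s) * a (x + + suc k)
      ≡⟨ cong (λ c → + c * (-1ℤ * s) * a (x + + suc k)) (nCk+nC[k+1]≡[n+1]C[k+1] n k) ⟩
    binomialTerm (suc n) a x (suc k) ∎
    where
    s = -1ℤ ℤ.^ k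
    collect : ∀ c d s t → c * (-1ℤ * s) * t - d * s * t ≡ (d + c) * (-1ℤ * s) * t
    collect = solve-∀

horner : List ℤ → ℤ → ℤ
horner []      x = 0ℤ
horner (c ∷ f) x = c + x * horner f x

-- By the Leibniz rule, multiplication by x costs one more difference, and each coefficient of the
-- list accounts for one such step.
D^-horner : ∀ f x → D^ (length f) (horner f) x ≡ 0ℤ
D^-horner []      x = refl
D^-horner (c ∷ f) x = begin
  D^ (suc m) (λ y → c + y * horner f y) x
    ≡⟨ D^-cong (suc m) (λ y → cong (_+_ c) (signs y (horner f y))) x ⟩
  D^ (suc m) (λ y → c + - y * g y) x
    ≡⟨ D^-+ (suc m) (λ _ → c) (λ y → - y * g y) x ⟩
  D^ (suc m) (λ _ → c) x + D^ (suc m) (λ y → - y * g y) x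
    ≡⟨ cong₂ _+_ (trans (D^-suc m (λ _ → c) x) (trans (D^-cong m (λ _ → ℤP.+-inverseʳ c) x) (D^-0 m x))) (D^-leibniz m g x) ⟩
  0ℤ + (- x * D^ (suc m) g x + + suc m * D^ m g (x + 1ℤ))
    ≡⟨ cong₂ (λ s t → 0ℤ + (- x * s + + suc m * t)) (D^-≗0 m 1 {g} vanish x) (vanish (x + 1ℤ)) ⟩
  0ℤ + (- x * 0ℤ + + suc m * 0ℤ)
    ≡⟨ zeros x (+ suc m) ⟩
  0ℤ ∎
  where
  open ≡-Reasoning
  m = length f
  g = λ y → -1ℤ * horner f y
  signs : ∀ y s → y * s ≡ - y * (-1ℤ * s)
  signs = solve-∀
  zeros : ∀ x k → 0ℤ + (- x * 0ℤ + k * 0ℤ) ≡ 0ℤ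
  zeros = solve-∀
  vanish : ∀ y → D^ m g y ≡ 0ℤ
  vanish y = trans (D^-* m -1ℤ (horner f) y) (cong (-1ℤ *_) (D^-horner f y))

-- Approximation of the p-adic sum at a finite precision

module PadicSum (p : ℕ) (p-prime : Prime p) where
  open Padic p p-prime
  open Valuation p p-prime
  open IntegerValued p p-prime

  approx-coherent : ∀ x m k → p^ m ∣ approx x (k ℕ.+ m) - approx x m
  approx-coherent x m zero    = divides 0ℤ (ℤP.+-inverseʳ (approx x m))
  approx-coherent x m (suc k) = subst (p^ m ∣_) (telescope (approx x (suc (k ℕ.+ m))) (approx x (k ℕ.+ m)) (approx x m))
    (ℤ∣.∣m∣n⇒∣m+n (ℤ∣.∣-trans (p^-mono (ℕP.m≤n+m m k)) (coherent x (k ℕ.+ m))) (approx-coherent x m k))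
    where
    telescope : ∀ a b c → (a - b) + (b - c) ≡ a - c
    telescope = solve-∀

  approx-coherent′ : ∀ x {m n} → m ℕ.≤ n → p^ m ∣ approx x n - approx x m
  approx-coherent′ x {m} {n} m≤n =
    subst (λ k → p^ m ∣ approx x k - approx x m) (ℕP.m∸n+n≡m m≤n) (approx-coherent x m (n ∸ m))

  -- By coherence one approximation of precision at least e decides divisibility by p^e for all
  -- later ones. Division by p^e loses e digits, so entry n of the quotient comes from approximation
  -- n + e.
  p^∣⇒∈ℤₚ : ∀ x e {K} → e ℕ.≤ K → p^ e ∣ approx x K → (x /p^ e) ∈ℤₚ
  p^∣⇒∈ℤₚ x e {K} e≤K p^e∣ = mkℤₚ z z-coherent , λ n →
    subst (p^ n ∣_) (trans (flip (approx x (n ℕ.+ e)) (approx x n)) (cong (λ y → approx x n * 1ℤ - y) (z≡ n)))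
      (ℤ∣.∣m⇒∣-m (approx-coherent′ x (ℕP.m≤m+n n e)))
    where
    restore : ∀ a b → a ≡ b - (b - a)
    restore = solve-∀
    restore′ : ∀ a b → a ≡ (a - b) + b
    restore′ = solve-∀
    p^e∣x_e : p^ e ∣ approx x e
    p^e∣x_e = subst (p^ e ∣_) (sym (restore (approx x e) (approx x K))) (ℤ∣.∣m∣n⇒∣m-n p^e∣ (approx-coherent′ x e≤K))
    p^e∣x : ∀ n → p^ e ∣ approx x (n ℕ.+ e)
    p^e∣x n = subst (p^ e ∣_) (sym (restore′ (approx x (n ℕ.+ e)) (approx x e)))
      (ℤ∣.∣m∣n⇒∣m+n (approx-coherent x e n) p^e∣x_e)
    z : ℕ → ℤ
    z n = quotient (p^e∣x n)
    z≡ : ∀ n → approx x (n ℕ.+ e) ≡ z n * p^ e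
    z≡ n = ℤ∣._∣_.equality (p^e∣x n)
    z-coherent : ∀ n → p^ n ∣ z (suc n) - z n
    z-coherent n = ℤ∣.*-cancelʳ-∣ (p^ e) {{p^≢0 e}} (subst₂ _∣_ (p^-+ n e)
      (trans (cong₂ _-_ (z≡ (suc n)) (z≡ n)) (factor (z (suc n)) (z n) (p^ e))) (coherent x (n ℕ.+ e)))
      where
      factor : ∀ a b P → a * P - b * P ≡ (a - b) * P
      factor = solve-∀
    flip : ∀ a b → - (a - b) ≡ b * 1ℤ - a
    flip = solve-∀

  -- The exponents `den` add under `⊕` and `⊗`, so the denominator of a value at an integer does not
  -- depend on that integer.
  evalDen : Poly → ℕ
  evalDen []      = 0
  evalDen (c ∷ f) = den c ℕ.+ evalDen f

  den-eval : ∀ f a → den (eval f (fromℤ a)) ≡ evalDen f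
  den-eval []      a = refl
  den-eval (c ∷ f) a = cong (den c ℕ.+_) (den-eval f a)

  module _ (K : ℕ) where
    approxNum : ℚₚ → ℤ
    approxNum ω = approx (num ω) K

    -- The coefficients of f over the common denominator p^(evalDen f), multiplied by m.
    numerators : ℤ → Poly → List ℤ
    numerators m []      = []
    numerators m (c ∷ f) = m * approxNum c * p^ (evalDen f) ∷ numerators (m * p^ (den c)) f

    horner-numerators : ∀ m f a → horner (numerators m f) a ≡ m * approxNum (eval f (fromℤ a))
    horner-numerators m []      a = sym (ℤP.*-zeroʳ m)
    horner-numerators m (c ∷ f) a = begin
      m * approxNum c * p^ (evalDen f) + a * horner (numerators (m * p^ (den c)) f) a
        ≡⟨ cong₂ (λ e s → m * approxNum c * p^ e + a * s) (sym (den-eval f a)) (horner-numerators (m * p^ (den c)) f a) ⟩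
      m * approxNum c * p^ (den (eval f (fromℤ a))) + a * (m * p^ (den c) * approxNum (eval f (fromℤ a)))
        ≡⟨ regroup m (approxNum c) (p^ (den (eval f (fromℤ a)))) a (p^ (den c)) (approxNum (eval f (fromℤ a))) ⟩
      m * approxNum (eval (c ∷ f) (fromℤ a)) ∎
      where
      open ≡-Reasoning
      regroup : ∀ m c P a Q s → m * c * P + a * (m * Q * s) ≡ m * (c * P + a * s * Q)
      regroup = solve-∀

    -- The list may be longer than the degree allows, with tail coefficients only `≈` 0. At
    -- precision K their numerators are multiples of p^K, so cutting them off leaves an error p^K ε.
    truncate : ∀ m f l → (∀ i → l ℕ.≤ i → coeff f i ≈ 0ₚ) →
      Σ[ ε ∈ (ℤ → ℤ) ] (∀ a → horner (numerators m f) a ≡ horner (take l (numerators m f)) a + p^ K * ε a)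
    truncate m [] l _ = (λ _ → 0ℤ) , λ a → trans (lemma (p^ K)) (cong (λ g → horner g a + p^ K * 0ℤ) (sym (take-[] l)))
      where
      lemma : ∀ P → 0ℤ ≡ 0ℤ + P * 0ℤ
      lemma = solve-∀
      take-[] : ∀ l → take l [] ≡ []
      take-[] zero    = refl
      take-[] (suc l) = refl
    truncate m (c ∷ f) zero high with high 0 z≤n K | truncate (m * p^ (den c)) f 0 (λ i _ → high (suc i) z≤n)
    ... | divides z eq | ε , rest = (λ a → m * z * p^ (evalDen f) + a * ε a) , λ a →
      trans (cong₂ (λ s t → m * s * p^ (evalDen f) + a * t) (trans (lemma (approxNum c) (p^ (den c))) eq) (rest a))
        (regroup m z (p^ K) (p^ (evalDen f)) a (ε a))
      where
      lemma : ∀ c P → c ≡ c * 1ℤ - 0ℤ * P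
      lemma = solve-∀
      regroup : ∀ m z P Q a e → m * (z * P) * Q + a * (0ℤ + P * e) ≡ 0ℤ + P * (m * z * Q + a * e)
      regroup = solve-∀
    truncate m (c ∷ f) (suc l) high with truncate (m * p^ (den c)) f l (λ i l≤i → high (suc i) (s≤s l≤i))
    ... | ε , rest = (λ a → a * ε a) , λ a →
      trans (cong (λ t → m * approxNum c * p^ (evalDen f) + a * t) (rest a))
        (regroup (m * approxNum c * p^ (evalDen f)) a (horner (take l (numerators (m * p^ (den c)) f)) a) (p^ K) (ε a))
      where
      regroup : ∀ c a s P e → c + a * (s + P * e) ≡ (c + a * s) + P * (a * e)
      regroup = solve-∀

    -- Terms off the support have denominator exponent 0 and the others `evalDen f`, so the
    -- comparison is carried through the sum in cross-multiplied form.
    approxNum-sum : ∀ E (ω : ℕ → ℚₚ) (t : ℕ → ℤ) → (∀ k → approxNum (ω k) * p^ E ≡ t k * p^ (den (ω k))) → ∀ ks →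
      let total = foldr _⊕_ 0ₚ (map ω ks) in approxNum total * p^ E ≡ sumᶻ (map t ks) * p^ (den total)
    approxNum-sum E ω t h []       = refl
    approxNum-sum E ω t h (k ∷ ks) = begin
      (approxNum (ω k) * p^ (den total) + approxNum total * p^ (den (ω k))) * p^ E
        ≡⟨ distribute (approxNum (ω k)) (p^ (den total)) (approxNum total) (p^ (den (ω k))) (p^ E) ⟩
      (approxNum (ω k) * p^ E) * p^ (den total) + (approxNum total * p^ E) * p^ (den (ω k))
        ≡⟨ cong₂ (λ x y → x * p^ (den total) + y * p^ (den (ω k))) (h k) (approxNum-sum E ω t h ks) ⟩
      (t k * p^ (den (ω k))) * p^ (den total) + (sumᶻ (map t ks) * p^ (den total)) * p^ (den (ω k))
        ≡⟨ collect (t k) (p^ (den (ω k))) (p^ (den total)) (sumᶻ (map t ks)) ⟩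
      (t k + sumᶻ (map t ks)) * (p^ (den (ω k)) * p^ (den total))
        ≡⟨ cong ((t k + sumᶻ (map t ks)) *_) (p^-+ (den (ω k)) (den total)) ⟨
      (t k + sumᶻ (map t ks)) * p^ (den (ω k) ℕ.+ den total) ∎
      where
      open ≡-Reasoning
      total = foldr _⊕_ 0ₚ (map ω ks)
      distribute : ∀ a P b Q E → (a * P + b * Q) * E ≡ (a * E) * P + (b * E) * Q
      distribute = solve-∀
      collect : ∀ t Q P s → (t * Q) * P + (s * P) * Q ≡ (t + s) * (Q * P)
      collect = solve-∀

    approxNum-term : ∀ α n r f k → approxNum (term α n r f k) * p^ (evalDen f) ≡
      binomialTerm n (spread (p ^ α) r (λ a → approxNum (eval f (fromℤ a)))) 0ℤ k * p^ (den (term α n r f k))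
    approxNum-term α n r f k rewrite ℤP.+-identityˡ (+ k) with p^ α ∣? + k - r
    ... | yes d = cong (λ e → + (n C k) * -1ℤ ℤ.^ k * approxNum (eval f (fromℤ (quotient d))) * p^ e)
      (sym (den-eval f (quotient d)))
    ... | no  _ = sym (cong (_* 1ℤ) (ℤP.*-zeroʳ (+ (n C k) * -1ℤ ℤ.^ k)))

    approxNum-binomialSum : ∀ α n r f → let ω = binomialSum α n r f in
      approxNum ω * p^ (evalDen f) ≡ δ n (spread (p ^ α) r (λ a → approxNum (eval f (fromℤ a)))) * p^ (den ω)
    approxNum-binomialSum α n r f = trans
      (approxNum-sum (evalDen f) (term α n r f) (binomialTerm n g 0ℤ) (approxNum-term α n r f) (upTo (suc n)))
      (cong (_* p^ (den (binomialSum α n r f))) (trans (cong sumᶻ (ListP.map-upTo (binomialTerm n g 0ℤ) (suc n)))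
        (sym (D^-binomial n g 0ℤ))))
      where
      g = spread (p ^ α) r (λ a → approxNum (eval f (fromℤ a)))

  module _ {f l} (f-degree : deg f ≤ l) (f-integral : ∀ a → eval f (fromℤ a) ∈ℤₚ) where

    -- The common denominator p^E uses up E of the K = E + m digits. Integrality of f at a makes p^E
    -- divide the truncated numerator polynomial at a; the quotients define h, and D^(l+1) kills h
    -- because it kills p^E h.
    integer-model : ∀ m → let E = evalDen f ; K = E ℕ.+ m in
      ∃[ h ] Σ[ ε ∈ (ℤ → ℤ) ] (∀ x → D^ (suc l) h x ≡ 0ℤ) ×
        (∀ a → approxNum K (eval f (fromℤ a)) ≡ p^ E * (h a + p^ m * ε a))
    integer-model m with truncate (evalDen f ℕ.+ m) 1ℤ f (suc l) f-degree
    ... | ε , truncated = h , ε , D^h≡0 , value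
      where
      open ≡-Reasoning
      E = evalDen f
      K = E ℕ.+ m
      G = take (suc l) (numerators K 1ℤ f)
      N = λ a → approxNum K (eval f (fromℤ a))

      N≡ : ∀ a → N a ≡ horner G a + p^ K * ε a
      N≡ a = trans (sym (trans (horner-numerators K 1ℤ f a) (ℤP.*-identityˡ (N a)))) (truncated a)

      p^E∣N : ∀ a → p^ E ∣ N a
      p^E∣N a with f-integral a
      ... | z , z≈ = subst (p^ E ∣_) (restore (N a) (approx z K) (p^ (den (eval f (fromℤ a)))))
        (ℤ∣.∣m∣n⇒∣m+n (ℤ∣.∣-trans (p^-mono (ℕP.m≤m+n E m)) (z≈ K))
          (ℤ∣.∣n⇒∣m*n (approx z K) (subst (λ e → p^ E ∣ p^ e) (sym (den-eval f a)) ℤ∣.∣-refl)))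
        where
        restore : ∀ M z P → (M * 1ℤ - z * P) + z * P ≡ M
        restore = solve-∀

      p^E∣G : ∀ a → p^ E ∣ horner G a
      p^E∣G a = ℤ∣.∣m+n∣n⇒∣m (subst (p^ E ∣_) (N≡ a) (p^E∣N a)) (ℤ∣.∣m⇒∣m*n (ε a) (p^-mono (ℕP.m≤m+n E m)))

      h : ℤ → ℤ
      h a = quotient (p^E∣G a)

      G≡ : ∀ a → horner G a ≡ p^ E * h a
      G≡ a = trans (ℤ∣._∣_.equality (p^E∣G a)) (ℤP.*-comm (h a) (p^ E))

      D^G≡0 : ∀ x → D^ (suc l) (horner G) x ≡ 0ℤ
      D^G≡0 x = subst (λ k → D^ k (horner G) x ≡ 0ℤ) (ℕP.m∸n+n≡m length≤)
        (D^-≗0 (length G) (suc l ∸ length G) (D^-horner G) x)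
        where
        length≤ : length G ℕ.≤ suc l
        length≤ = subst (ℕ._≤ suc l) (sym (ListP.length-take (suc l) (numerators K 1ℤ f))) (ℕP.m⊓n≤m (suc l) _)

      D^h≡0 : ∀ x → D^ (suc l) h x ≡ 0ℤ
      D^h≡0 x = ℤP.*-cancelˡ-≡ (p^ E) (D^ (suc l) h x) 0ℤ {{p^≢0 E}} (begin
        p^ E * D^ (suc l) h x               ≡⟨ D^-* (suc l) (p^ E) h x ⟨
        D^ (suc l) (λ a → p^ E * h a) x     ≡⟨ D^-cong (suc l) G≡ x ⟨
        D^ (suc l) (horner G) x             ≡⟨ D^G≡0 x ⟩
        0ℤ                                  ≡⟨ ℤP.*-zeroʳ (p^ E) ⟨
        p^ E * 0ℤ                           ∎)

      value : ∀ a → N a ≡ p^ E * (h a + p^ m * ε a)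
      value a = begin
        N a                                   ≡⟨ N≡ a ⟩
        horner G a + p^ K * ε a               ≡⟨ cong₂ (λ s P → s + P * ε a) (G≡ a) (p^-+ E m) ⟩
        p^ E * h a + p^ E * p^ m * ε a        ≡⟨ factor (p^ E) (h a) (p^ m) (ε a) ⟩
        p^ E * (h a + p^ m * ε a)             ∎
        where
        factor : ∀ P h Q e → P * h + P * Q * e ≡ P * (h + Q * e)
        factor = solve-∀

    -- The precision is chosen to make the error a multiple of p^m: W is the order guaranteed by
    -- `spread-sum-bound`, and `den ω` accounts for the denominator of the sum.
    numerator-bound : ∀ α n r → let
        ω = binomialSum α n r f
        W = v ⌊ n /p^ α -1⌋ ℕ.+ τ ⟨ r ⟩[p^ α -1] ⟨ + n - r ⟩[p^ α -1]
        m = W ℕ.+ den ω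
      in p^ m ∣ p^ (l ℕ.+ v l) * approxNum (evalDen f ℕ.+ m) ω
    numerator-bound α n r = subst (p^ m ∣_) (sym scaled) (ℤ∣.∣m∣n⇒∣m+n
        (p^∣-* {W} {den ω} (spread-sum-bound α n r l D^h≡0) ℤ∣.∣-refl)
        (ℤ∣.∣m⇒∣m*n (L * δε * p^ (den ω)) ℤ∣.∣-refl))
      where
      open ≡-Reasoning
      ω = binomialSum α n r f
      W = v ⌊ n /p^ α -1⌋ ℕ.+ τ ⟨ r ⟩[p^ α -1] ⟨ + n - r ⟩[p^ α -1]
      m = W ℕ.+ den ω
      E = evalDen f
      K = E ℕ.+ m
      L = p^ (l ℕ.+ v l)
      A = approxNum K ω
      model = integer-model m
      h = proj₁ model
      ε = proj₁ (proj₂ model)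
      D^h≡0 = proj₁ (proj₂ (proj₂ model))
      value = proj₂ (proj₂ (proj₂ model))
      δh = δ n (spread (p ^ α) r h)
      δε = δ n (spread (p ^ α) r ε)

      δN≡ : δ n (spread (p ^ α) r (λ a → approxNum K (eval f (fromℤ a)))) ≡ p^ E * (δh + p^ m * δε)
      δN≡ = begin
        δ n (spread (p ^ α) r (λ a → approxNum K (eval f (fromℤ a))))
          ≡⟨ D^-cong n (λ j → trans (spread-cong (p ^ α) r value j) (spread-scale (p ^ α) r (p^ E) _ j)) 0ℤ ⟩
        δ n (λ j → p^ E * spread (p ^ α) r (λ a → h a + p^ m * ε a) j)
          ≡⟨ D^-* n (p^ E) _ 0ℤ ⟩
        p^ E * δ n (spread (p ^ α) r (λ a → h a + p^ m * ε a))
          ≡⟨ cong (p^ E *_) (D^-cong n (λ j → trans (spread-+ (p ^ α) r h (λ a → p^ m * ε a) j)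
               (cong (_+_ (spread (p ^ α) r h j)) (spread-scale (p ^ α) r (p^ m) ε j))) 0ℤ) ⟩
        p^ E * δ n (λ j → spread (p ^ α) r h j + p^ m * spread (p ^ α) r ε j)
          ≡⟨ cong (p^ E *_) (trans (D^-+ n _ _ 0ℤ) (cong (_+_ δh) (D^-* n (p^ m) _ 0ℤ))) ⟩
        p^ E * (δh + p^ m * δε) ∎

      A≡ : A ≡ (δh + p^ m * δε) * p^ (den ω)
      A≡ = ℤP.*-cancelˡ-≡ (p^ E) A ((δh + p^ m * δε) * p^ (den ω)) {{p^≢0 E}} (begin
        p^ E * A                                  ≡⟨ ℤP.*-comm (p^ E) A ⟩
        A * p^ E                                  ≡⟨ approxNum-binomialSum K α n r f ⟩
        δ n (spread (p ^ α) r (λ a → approxNum K (eval f (fromℤ a)))) * p^ (den ω)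
                                                  ≡⟨ cong (_* p^ (den ω)) δN≡ ⟩
        p^ E * (δh + p^ m * δε) * p^ (den ω)      ≡⟨ ℤP.*-assoc (p^ E) _ _ ⟩
        p^ E * ((δh + p^ m * δε) * p^ (den ω))    ∎)

      scaled : L * A ≡ L * δh * p^ (den ω) + p^ m * (L * δε * p^ (den ω))
      scaled = trans (cong (L *_) A≡) (expand L δh (p^ m) δε (p^ (den ω)))
        where
        expand : ∀ L s M t P → L * ((s + M * t) * P) ≡ L * s * P + M * (L * t * P)
        expand = solve-∀

    bound : ∀ α n r → ord binomialSum α n r f ≥
      (+ v ⌊ n /p^ α -1⌋ - + l - + v l + + τ ⟨ r ⟩[p^ α -1] ⟨ + n - r ⟩[p^ α -1])
    bound α n r = b , ℤP.≤-refl , subst (λ a → (ω ÷p^ a) ∈ℤₚ) (sym b≡) (integral (L ℕP.≤? W))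
      where
      ω = binomialSum α n r f
      N = v ⌊ n /p^ α -1⌋
      t = τ ⟨ r ⟩[p^ α -1] ⟨ + n - r ⟩[p^ α -1]
      W = N ℕ.+ t
      L = l ℕ.+ v l
      m = W ℕ.+ den ω
      K = evalDen f ℕ.+ m
      b = + N - + l - + v l + + t

      b≡ : b ≡ + W - + L
      b≡ = regroup (+ N) (+ l) (+ v l) (+ t)
        where
        regroup : ∀ N l u t → N - l - u + t ≡ (N + t) - (l + u)
        regroup = solve-∀

      -- W - L may be negative. Then `÷p^` multiplies the numerator by p^(L-W), which supplies the
      -- missing powers of p.
      integral : Dec (L ℕ.≤ W) → (ω ÷p^ (+ W - + L)) ∈ℤₚ
      integral (yes L≤W) = subst (λ a → (ω ÷p^ a) ∈ℤₚ) (trans (sym (ℤP.⊖-≥ L≤W)) (sym (ℤP.m-n≡m⊖n W L)))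
        (p^∣⇒∈ℤₚ (num ω) (den ω ℕ.+ k) (ℕP.≤-trans e≤m (ℕP.m≤n+m m (evalDen f)))
          (ℤ∣.*-cancelˡ-∣ (p^ L) {{p^≢0 L}} (subst (_∣ p^ L * approxNum K ω) power (numerator-bound α n r))))
        where
        k = W ∸ L
        shuffle : ∀ L k d → L ℕ.+ k ℕ.+ d ≡ L ℕ.+ (d ℕ.+ k)
        shuffle = ℕSolver.solve-∀
        m≡ : m ≡ L ℕ.+ (den ω ℕ.+ k)
        m≡ = trans (cong (ℕ._+ den ω) (sym (ℕP.m+[n∸m]≡n L≤W))) (shuffle L k (den ω))
        e≤m : den ω ℕ.+ k ℕ.≤ m
        e≤m = subst (den ω ℕ.+ k ℕ.≤_) (sym m≡) (ℕP.m≤n+m _ L)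
        power : p^ m ≡ p^ L * p^ (den ω ℕ.+ k)
        power = trans (cong p^ m≡) (p^-+ L (den ω ℕ.+ k))
      integral (no L≰W) = subst (λ a → (ω ÷p^ a) ∈ℤₚ) (sym difference)
        (p^∣⇒∈ℤₚ (num ω *ᶻ constᶻ (p^ (suc j))) (den ω) (ℕP.≤-trans (ℕP.m≤n+m (den ω) W) (ℕP.m≤n+m m (evalDen f)))
          (ℤ∣.*-cancelˡ-∣ (p^ W) {{p^≢0 W}} (subst₂ _∣_ (p^-+ W (den ω)) value (numerator-bound α n r))))
        where
        j = L ∸ suc W
        L≡ : L ≡ W ℕ.+ suc j
        L≡ = trans (sym (ℕP.m+[n∸m]≡n (ℕP.≰⇒> L≰W))) (sym (ℕP.+-suc W j))
        cancel : ∀ w s → w - (w + s) ≡ - s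
        cancel = solve-∀
        difference : + W - + L ≡ -[1+ j ]
        difference = trans (cong (λ k → + W - + k) L≡) (cancel (+ W) (+ suc j))
        value : p^ L * approxNum K ω ≡ p^ W * (approxNum K ω * p^ (suc j))
        value = trans (cong (_* approxNum K ω) (trans (cong p^ L≡) (p^-+ W (suc j))))
          (regroup (p^ W) (p^ (suc j)) (approxNum K ω))
          where
          regroup : ∀ P Q A → P * Q * A ≡ P * (A * Q)
          regroup = solve-∀

theorem1p2 : (p : ℕ) (p-prime : Prime p) → let open Padic p p-prime in
    (α n : ℕ) (r : ℤ) (f : Poly) (l : ℕ) →
    deg f ≤ l →
    (∀ (a : ℤ) → eval f (fromℤ a) ∈ℤₚ) →
    ord binomialSum α n r f ≥
    (+ ordℕ (⌊ n /p^ α -1⌋ !) - + l - + ordℕ (l !)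
    + + τ ⟨ r ⟩[p^ α -1] ⟨ + n - r ⟩[p^ α -1])
theorem1p2 p p-prime α n r f l f-degree f-integral =
  PadicSum.bound p p-prime {f} {l} f-degree f-integral α n r
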